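{- Let $\beta\approx 2.24698$ be the dominant root (root of maximal modulus) of $X^3-2X^2-X+1$, and let $c=\lim_{n\to+\infty}B(n)/\beta^n\approx 1.22041$, where $(B(n))_{n\ge0}$ is defined by $B(0)=1$, $B(1)=3$, $B(2)=6$ and $B(n+3)=2B(n+2)+B(n+1)-B(n)$ for all $n\ge 0$. There exists a continuous and periodic function $\mathcal{G}:\mathbb{R}\to\mathbb{R}$ of period $1$ such that, for $N\ge 3$, $$\sum_{j=0}^N \mathsf{s}_F(j)=c\,\beta^{\log_F N}\,\mathcal{G}(\log_F N)+o\big(\beta^{\lfloor \log_F N\rfloor}\big)\qquad (N\to+\infty).$$
   Context: Let $F(0)=1$, $F(1)=2$, $F(n+2)=F(n+1)+F(n)$ for $n\ge0$. Every integer $n\ge1$ can be uniquely written as $n=\sum_{j=0}^{\ell-1}c_jF(j)$ with $\ell\ge 1$, $c_j\in\{0,1\}$, $c_{\ell-1}=1$ and $c_jc_{j-1}=0$ for $1\le j\le \ell-1$; the word $\mathrm{rep}_F(n)=c_{\ell-1}\cdots c_0$ is the normal $F$-representation (Zeckendorf expansion) of $n$, and $\mathrm{rep}_F(0)=\varepsilon$ (the empty word). Thus $\mathrm{rep}_F(\mathbb{N})=1\{0,01\}^*\cup\{\varepsilon\}$. For finite words $u,v\in\{0,1\}^*$, $\binom{u}{v}$ denotes the number of times $v$ occurs as a subsequence (scattered subword) of $u$. For $n\ge0$, $$\mathsf{s}_F(n)=\#\left\{v\in \mathrm{rep}_F(\mathbb{N}) \;\middle|\; \binom{\mathrm{rep}_F(n)}{v}>0\right\}.$$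 Let $\varphi=(1+\sqrt5)/2$. If $n\ge3$ and $\mathrm{rep}_F(n)=10r_1\cdots r_k$ with $k\ge1$ and $r_i\in\{0,1\}$, then $$\mathrm{relpos}_F(n)=\sum_{i=1}^k\frac{r_i}{\varphi^i}\in[0,1),\qquad \log_F(n)=|\mathrm{rep}_F(n)|-1+\mathrm{relpos}_F(n),$$ where $|w|$ is the length of the word $w$; so $\lfloor\log_F n\rfloor=|\mathrm{rep}_F(n)|-1$. -}

module Defs where

open import Data.Bool using (if_then_else_; true; false)
open import Data.Fin using (Fin; toℕ)
open import Data.Fin.Patterns using (0F; 1F)
import Data.Fin.Properties as Fin
open import Data.Integer as ℤ using (ℤ; +_; -[1+_])
import Data.Integer.Properties as ℤ
open import Data.List using (List; []; _∷_; length; filter; upTo; allFin; concatMap; cartesianProductWith; dropWhile)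
import Data.List.Properties as List
open import Data.List.Relation.Unary.Linked using (Linked; []; [-]; _∷_)
import Data.List.Relation.Unary.Linked as Linked
open import Data.Nat as ℕ using (ℕ; zero; suc; _!)
import Data.Nat.Properties as ℕ
open import Data.Product using (∃; ∃-syntax; _×_; _,_)
open import Data.Rational as ℚ using (ℚ; 0ℚ; 1ℚ; ½)
import Data.Rational.Properties as ℚ
import Data.Rational.Unnormalised as ℚᵘ
import Data.Rational.Unnormalised.Properties as ℚᵘ
open import Data.Rational.Solver using (module +-*-Solver)
open import Data.Sum using (inj₁; inj₂)
open import Data.Unit using (⊤; tt)
open import Relation.Binary.PropositionalEquality using (_≡_; refl; sym; trans; cong; cong₂; subst; subst₂)
open import Relation.Nullary using (Dec; yes; no; ¬_; contradiction; does)
open import Relation.Nullary.Decidable using (map′; _×-dec_)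

F : ℕ → ℕ
F 0             = 1
F 1             = 2
F (suc (suc n)) = F (suc n) ℕ.+ F n

-- Words over {0,1}, most significant digit first.
Word : Set
Word = List (Fin 2)

value : Word → ℕ
value []      = 0
value (c ∷ w) = toℕ c ℕ.* F (length w) ℕ.+ value w

greedy : ℕ → ℕ → Word
greedy zero    n = []
greedy (suc ℓ) n with F ℓ ℕ.≤? n
... | yes _ = 1F ∷ greedy ℓ (n ℕ.∸ F ℓ)
... | no  _ = 0F ∷ greedy ℓ n

-- The greedy expansion on n digits, long enough since n < F n, without its leading zeros;
-- rep-normal, value-rep and rep-unique below show that it is the normal F-representation.
rep : ℕ → Word
rep n = dropWhile (Fin._≟ 0F) (greedy n n)

LeadingOne : Word → Set
LeadingOne []      = ⊤
LeadingOne (c ∷ _) = c ≡ 1F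

NotBothOne : Fin 2 → Fin 2 → Set
NotBothOne c d = ¬ (c ≡ 1F × d ≡ 1F)

IsNormal : Word → Set
IsNormal w = LeadingOne w × Linked NotBothOne w

F-mono : ∀ n → F n ℕ.≤ F (suc n)
F-mono zero    = ℕ.s≤s ℕ.z≤n
F-mono (suc n) = ℕ.m≤m+n (F (suc n)) (F n)

n<Fn : ∀ n → n ℕ.< F n
n<Fn zero          = ℕ.s≤s ℕ.z≤n
n<Fn (suc zero)    = ℕ.s≤s (ℕ.s≤s ℕ.z≤n)
n<Fn (suc (suc n)) = ℕ.≤-trans (ℕ.≤-reflexive (ℕ.+-comm 1 (suc (suc n))))
  (ℕ.+-mono-≤ (n<Fn (suc n)) (ℕ.≤-trans (ℕ.s≤s ℕ.z≤n) (n<Fn n)))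

F-suc≤ : ∀ n → F (suc n) ℕ.≤ F n ℕ.+ F n
F-suc≤ zero    = ℕ.≤-refl
F-suc≤ (suc n) = ℕ.+-monoʳ-≤ (F (suc n)) (F-mono n)

length-greedy : ∀ ℓ n → length (greedy ℓ n) ≡ ℓ
length-greedy zero    n = refl
length-greedy (suc ℓ) n with F ℓ ℕ.≤? n
... | yes _ = cong suc (length-greedy ℓ _)
... | no  _ = cong suc (length-greedy ℓ n)

rest< : ∀ ℓ n → F ℓ ℕ.≤ n → n ℕ.< F (suc ℓ) → n ℕ.∸ F ℓ ℕ.< F ℓ
rest< ℓ n F≤n n<F = ℕ.+-cancelʳ-< (F ℓ) _ _
  (subst (ℕ._< F ℓ ℕ.+ F ℓ) (sym (ℕ.m∸n+n≡m F≤n)) (ℕ.<-≤-trans n<F (F-suc≤ ℓ)))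

value-greedy : ∀ ℓ n → n ℕ.< F ℓ → value (greedy ℓ n) ≡ n
value-greedy zero    zero    _ = refl
value-greedy zero    (suc n) (ℕ.s≤s ())
value-greedy (suc ℓ) n n<F with F ℓ ℕ.≤? n
... | yes F≤n = trans
  (cong₂ ℕ._+_ (trans (ℕ.*-identityˡ _) (cong F (length-greedy ℓ _))) (value-greedy ℓ _ (rest< ℓ n F≤n n<F)))
  (ℕ.m+[n∸m]≡n F≤n)
... | no F≰n = value-greedy ℓ n (ℕ.≰⇒> F≰n)

value-dropWhile : ∀ w → value (dropWhile (Fin._≟ 0F) w) ≡ value w
value-dropWhile []       = refl
value-dropWhile (0F ∷ w) = value-dropWhile w
value-dropWhile (1F ∷ w) = refl

zero-∷ : ∀ w → Linked NotBothOne w → Linked NotBothOne (0F ∷ w)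
zero-∷ []      _ = [-]
zero-∷ (c ∷ w) h = (λ ()) ∷ h

-- after a digit 1 the remainder is below F (ℓ - 1), so the next digit is 0
one-∷ : ∀ ℓ n → n ℕ.+ F ℓ ℕ.< F (suc ℓ) → Linked NotBothOne (greedy ℓ n) → Linked NotBothOne (1F ∷ greedy ℓ n)
one-∷ zero    n _ _ = [-]
one-∷ (suc ℓ) n n<F h with F ℓ ℕ.≤? n
... | yes F≤n = contradiction
  (ℕ.+-cancelʳ-< (F (suc ℓ)) _ _ (subst (n ℕ.+ F (suc ℓ) ℕ.<_) (ℕ.+-comm (F (suc ℓ)) (F ℓ)) n<F)) (ℕ.≤⇒≯ F≤n)
... | no  _ = (λ ()) ∷ h

linked-greedy : ∀ ℓ n → n ℕ.< F ℓ → Linked NotBothOne (greedy ℓ n)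
linked-greedy zero    n _ = []
linked-greedy (suc ℓ) n n<F with F ℓ ℕ.≤? n
... | yes F≤n = one-∷ ℓ (n ℕ.∸ F ℓ) (subst (ℕ._< F (suc ℓ)) (sym (ℕ.m∸n+n≡m F≤n)) n<F)
                      (linked-greedy ℓ _ (rest< ℓ n F≤n n<F))
... | no F≰n = zero-∷ (greedy ℓ n) (linked-greedy ℓ n (ℕ.≰⇒> F≰n))

normal-dropWhile : ∀ w → Linked NotBothOne w → IsNormal (dropWhile (Fin._≟ 0F) w)
normal-dropWhile []       h = tt , h
normal-dropWhile (0F ∷ w) h = normal-dropWhile w (Linked.tail h)
normal-dropWhile (1F ∷ w) h = refl , h

tail-value< : ∀ w → Linked NotBothOne w → value w ℕ.< F (length w)
tail-value< []            _ = ℕ.s≤s ℕ.z≤n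
tail-value< (0F ∷ w)      h = ℕ.<-≤-trans (tail-value< w (Linked.tail h)) (F-mono (length w))
tail-value< (1F ∷ [])     h = ℕ.s≤s (ℕ.s≤s ℕ.z≤n)
tail-value< (1F ∷ 1F ∷ w) (¬11 ∷ _) = contradiction (refl , refl) ¬11
tail-value< (1F ∷ 0F ∷ w) h = subst (ℕ._< F (suc (length w)) ℕ.+ F (length w))
  (cong (ℕ._+ value w) (sym (ℕ.*-identityˡ (F (suc (length w))))))
  (ℕ.+-monoʳ-< (F (suc (length w))) (tail-value< w (Linked.tail (Linked.tail h))))

greedy-value : ∀ w → Linked NotBothOne w → greedy (length w) (value w) ≡ w
greedy-value []       _ = refl
greedy-value (0F ∷ w) h with F (length w) ℕ.≤? value w
... | yes F≤ = contradiction (tail-value< w (Linked.tail h)) (ℕ.≤⇒≯ F≤)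
... | no  _  = cong (0F ∷_) (greedy-value w (Linked.tail h))
greedy-value (1F ∷ w) h with F (length w) ℕ.≤? 1 ℕ.* F (length w) ℕ.+ value w
... | yes _ = cong (1F ∷_) (trans
  (cong (greedy (length w)) (trans (cong (λ t → t ℕ.+ value w ℕ.∸ F (length w)) (ℕ.*-identityˡ (F (length w)))) (ℕ.m+n∸m≡n (F (length w)) (value w))))
  (greedy-value w (Linked.tail h)))
... | no F≰ = contradiction (ℕ.≤-trans (ℕ.≤-reflexive (sym (ℕ.*-identityˡ (F (length w))))) (ℕ.m≤m+n _ (value w))) F≰

strip-greedy : ∀ k ℓ n → n ℕ.< F ℓ →
  dropWhile (Fin._≟ 0F) (greedy (k ℕ.+ ℓ) n) ≡ dropWhile (Fin._≟ 0F) (greedy ℓ n)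
strip-greedy zero    ℓ n _ = refl
strip-greedy (suc k) ℓ n n<F with F (k ℕ.+ ℓ) ℕ.≤? n
... | yes F≤n = contradiction (ℕ.<-≤-trans n<F (F-mono* k)) (ℕ.≤⇒≯ F≤n)
  where
  F-mono* : ∀ k → F ℓ ℕ.≤ F (k ℕ.+ ℓ)
  F-mono* zero    = ℕ.≤-refl
  F-mono* (suc k) = ℕ.≤-trans (F-mono* k) (F-mono (k ℕ.+ ℓ))
... | no  _ = strip-greedy k ℓ n n<F

strip-normal : ∀ w → LeadingOne w → dropWhile (Fin._≟ 0F) w ≡ w
strip-normal []       _ = refl
strip-normal (1F ∷ w) _ = refl

length≤value : ∀ w → LeadingOne w → length w ℕ.≤ value w
length≤value []       _ = ℕ.z≤n
length≤value (1F ∷ w) _ = ℕ.≤-trans (n<Fn (length w))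
  (ℕ.≤-trans (ℕ.≤-reflexive (sym (ℕ.*-identityˡ (F (length w))))) (ℕ.m≤m+n _ (value w)))

rep-normal : ∀ n → IsNormal (rep n)
rep-normal n = normal-dropWhile (greedy n n) (linked-greedy n n (n<Fn n))

value-rep : ∀ n → value (rep n) ≡ n
value-rep n = trans (value-dropWhile (greedy n n)) (value-greedy n n (n<Fn n))

rep-unique : ∀ w → IsNormal w → rep (value w) ≡ w
rep-unique w (lead , linked) = trans
  (subst (λ ℓ → dropWhile (Fin._≟ 0F) (greedy ℓ (value w)) ≡ dropWhile (Fin._≟ 0F) (greedy (length w) (value w)))
    (ℕ.m∸n+n≡m (length≤value w lead))
    (strip-greedy (value w ℕ.∸ length w) (length w) (value w) (tail-value< w linked)))
  (trans (cong (dropWhile (Fin._≟ 0F)) (greedy-value w linked)) (strip-normal w lead))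

_∈rep[ℕ] : Word → Set
v ∈rep[ℕ] = ∃ λ n → rep n ≡ v

_∈rep[ℕ]? : ∀ v → Dec (v ∈rep[ℕ])
v ∈rep[ℕ]? = map′ (value v ,_) (λ (n , eq) → trans (cong rep (trans (cong value (sym eq)) (value-rep n))) eq)
                  (List.≡-dec Fin._≟_ (rep (value v)) v)

binom : Word → Word → ℕ
binom u       []      = 1
binom []      (_ ∷ _) = 0
binom (a ∷ u) (b ∷ v) = binom u (b ∷ v) ℕ.+ (if does (a Fin.≟ b) then binom u v else 0)

binom-long : ∀ u v → length u ℕ.< length v → binom u v ≡ 0
binom-long []      (_ ∷ _) _ = refl
binom-long (a ∷ u) (b ∷ v) (ℕ.s≤s u<v) with does (a Fin.≟ b)
... | true  = cong₂ ℕ._+_ (binom-long u (b ∷ v) (ℕ.m<n⇒m<1+n u<v)) (binom-long u v u<v)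
... | false = cong₂ ℕ._+_ (binom-long u (b ∷ v) (ℕ.m<n⇒m<1+n u<v)) refl

wordsOfLength : ℕ → List Word
wordsOfLength zero    = [] ∷ []
wordsOfLength (suc n) = cartesianProductWith _∷_ (allFin 2) (wordsOfLength n)

-- By binom-long it is enough to count among the words no longer than rep n.
sF : ℕ → ℕ
sF n = length (filter (λ v → (v ∈rep[ℕ]?) ×-dec (0 ℕ.<? binom (rep n) v))
                     (concatMap wordsOfLength (upTo (suc (length (rep n))))))

IsCauchy : (ℕ → ℚ) → Set
IsCauchy x = ∀ ε → 0ℚ ℚ.< ε →
  ∃ λ N → ∀ m n → N ℕ.≤ m → N ℕ.≤ n → ℚ.∣ x m ℚ.- x n ∣ ℚ.≤ ε

module Sequences where
  open import Data.Rational
  open ℚ.≤-Reasoning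
  open +-*-Solver

  0<* : ∀ {p q} → 0ℚ < p → 0ℚ < q → 0ℚ < p * q
  0<* {p} {q} 0<p 0<q = subst (_< p * q) (ℚ.*-zeroˡ q) (ℚ.*-monoˡ-<-pos q {{ℚ.positive 0<q}} {0ℚ} {p} 0<p)

  *-mono-≤ : ∀ {p q r s} → 0ℚ ≤ p → p ≤ q → 0ℚ ≤ r → r ≤ s → p * r ≤ q * s
  *-mono-≤ {p} {q} {r} {s} 0≤p p≤q 0≤r r≤s = ℚ.≤-trans
    (ℚ.*-monoʳ-≤-nonNeg r {{ℚ.nonNegative 0≤r}} p≤q)
    (ℚ.*-monoˡ-≤-nonNeg q {{ℚ.nonNegative (ℚ.≤-trans 0≤p p≤q)}} r≤s)

  half+half : ∀ ε → ε * ½ + ε * ½ ≡ ε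
  half+half ε = trans (sym (ℚ.*-distribˡ-+ ε ½ ½)) (ℚ.*-identityʳ ε)

  0<half : ∀ {ε} → 0ℚ < ε → 0ℚ < ε * ½
  0<half {ε} 0<ε = subst (_< ε * ½) (ℚ.*-zeroˡ ½) (ℚ.*-monoˡ-<-pos ½ {0ℚ} {ε} 0<ε)

  ≤-abs : ∀ p → p ≤ ∣ p ∣
  ≤-abs p with ℚ.≤-total 0ℚ p
  ... | inj₁ 0≤p = ℚ.≤-reflexive (sym (ℚ.0≤p⇒∣p∣≡p 0≤p))
  ... | inj₂ p≤0 = ℚ.≤-trans p≤0 (ℚ.0≤∣p∣ p)

  abs-≤ : ∀ {p e} → p ≤ e → - p ≤ e → ∣ p ∣ ≤ e
  abs-≤ {p} p≤e -p≤e with ℚ.∣p∣≡p∨∣p∣≡-p p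
  ... | inj₁ eq = subst (_≤ _) (sym eq) p≤e
  ... | inj₂ eq = subst (_≤ _) (sym eq) -p≤e

  abs-sym : ∀ p q → ∣ p - q ∣ ≡ ∣ q - p ∣
  abs-sym p q = trans (cong ∣_∣ (solve 2 (λ p q → p :- q := :- (q :- p)) refl p q)) (ℚ.∣-p∣≡∣p∣ (q - p))

  p-q≤e⇒p≤q+e : ∀ {p q e} → p - q ≤ e → p ≤ q + e
  p-q≤e⇒p≤q+e {p} {q} {e} h = begin
    p            ≡⟨ solve 2 (λ p q → p := q :+ (p :- q)) refl p q ⟩
    q + (p - q)  ≤⟨ ℚ.+-monoʳ-≤ q h ⟩
    q + e        ∎

  p≤q+e⇒p-q≤e : ∀ {p q e} → p ≤ q + e → p - q ≤ e
  p≤q+e⇒p-q≤e {p} {q} {e} h = begin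
    p - q      ≤⟨ ℚ.+-monoˡ-≤ (- q) h ⟩
    q + e - q  ≡⟨ solve 2 (λ q e → q :+ e :- q := e) refl q e ⟩
    e          ∎

  close⇒≤ : ∀ {p q e} → ∣ p - q ∣ ≤ e → p ≤ q + e
  close⇒≤ {p} {q} h = p-q≤e⇒p≤q+e (ℚ.≤-trans (≤-abs (p - q)) h)

  ≤⇒close : ∀ {p q e} → p ≤ q + e → q ≤ p + e → ∣ p - q ∣ ≤ e
  ≤⇒close {p} {q} {e} h₁ h₂ = abs-≤ (p≤q+e⇒p-q≤e h₁)
    (subst (_≤ e) (solve 2 (λ p q → q :- p := :- (p :- q)) refl p q) (p≤q+e⇒p-q≤e h₂))

  scale : ∀ {M} ε → 0ℚ < M → 0ℚ < ε → ∃ λ δ → 0ℚ < δ × M * δ ≡ ε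
  scale {M} ε 0<M 0<ε = 1/ M * ε , 0<* (ℚ.positive⁻¹ (1/ M) {{ℚ.1/pos⇒pos M}}) 0<ε ,
    trans (sym (ℚ.*-assoc M (1/ M) ε)) (trans (cong (_* ε) (ℚ.*-inverseʳ M)) (ℚ.*-identityˡ ε))
    where instance
      M-pos : Positive M
      M-pos = ℚ.positive 0<M
      M-nonZero : NonZero M
      M-nonZero = ℚ.pos⇒nonZero M

  0≤⊔ : ∀ p → 0ℚ ≤ p ⊔ 0ℚ
  0≤⊔ p = ℚ.p≤q⊔p p 0ℚ

  ⊔-close : ∀ r {p q e} → 0ℚ ≤ e → p ≤ q + e → p ⊔ r ≤ (q ⊔ r) + e
  ⊔-close r {p} {q} {e} 0≤e h = ℚ.⊔-lub
    (ℚ.≤-trans h (ℚ.+-monoˡ-≤ e (ℚ.p≤p⊔q q r)))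
    (ℚ.≤-trans (ℚ.p≤q⊔p q r) (subst (_≤ (q ⊔ r) + e) (ℚ.+-identityʳ (q ⊔ r)) (ℚ.+-monoʳ-≤ (q ⊔ r) 0≤e)))

  bounded : ∀ {x} → IsCauchy x →
    ∃ λ M → 0ℚ < M × ∃ λ N → ∀ n → N ℕ.≤ n → ∣ x n ∣ ≤ M
  bounded {x} cx with cx 1ℚ (ℚ.positive⁻¹ 1ℚ)
  ... | N , h = ∣ x N ∣ + 1ℚ , ℚ.+-mono-≤-< (ℚ.0≤∣p∣ (x N)) (ℚ.positive⁻¹ 1ℚ) , N , λ n N≤n → begin
    ∣ x n ∣                  ≡⟨ cong ∣_∣ (solve 2 (λ p q → p := q :+ (p :- q)) refl (x n) (x N)) ⟩
    ∣ x N + (x n - x N) ∣    ≤⟨ ℚ.∣p+q∣≤∣p∣+∣q∣ (x N) (x n - x N) ⟩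
    ∣ x N ∣ + ∣ x n - x N ∣  ≤⟨ ℚ.+-monoʳ-≤ ∣ x N ∣ (h n N N≤n ℕ.≤-refl) ⟩
    ∣ x N ∣ + 1ℚ             ∎

  const-cauchy : ∀ q → IsCauchy (λ _ → q)
  const-cauchy q ε 0<ε = 0 , λ _ _ _ _ → begin
    ∣ q - q ∣  ≡⟨ cong ∣_∣ (ℚ.+-inverseʳ q) ⟩
    0ℚ         ≤⟨ ℚ.<⇒≤ 0<ε ⟩
    ε          ∎

  +-cauchy : ∀ {x y} → IsCauchy x → IsCauchy y → IsCauchy (λ n → x n + y n)
  +-cauchy {x} {y} cx cy ε 0<ε with cx (ε * ½) (0<half 0<ε) | cy (ε * ½) (0<half 0<ε)
  ... | M , hx | N , hy = M ℕ.⊔ N , λ m n m≥ n≥ → begin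
    ∣ (x m + y m) - (x n + y n) ∣    ≡⟨ cong ∣_∣ (solve 4 (λ a b c d → (a :+ b) :- (c :+ d) := (a :- c) :+ (b :- d)) refl (x m) (y m) (x n) (y n)) ⟩
    ∣ (x m - x n) + (y m - y n) ∣    ≤⟨ ℚ.∣p+q∣≤∣p∣+∣q∣ (x m - x n) (y m - y n) ⟩
    ∣ x m - x n ∣ + ∣ y m - y n ∣    ≤⟨ ℚ.+-mono-≤ (hx m n (ℕ.m⊔n≤o⇒m≤o M N m≥) (ℕ.m⊔n≤o⇒m≤o M N n≥)) (hy m n (ℕ.m⊔n≤o⇒n≤o M N m≥) (ℕ.m⊔n≤o⇒n≤o M N n≥)) ⟩
    ε * ½ + ε * ½                    ≡⟨ half+half ε ⟩
    ε                                ∎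

  neg-cauchy : ∀ {x} → IsCauchy x → IsCauchy (λ n → - x n)
  neg-cauchy {x} cx ε 0<ε with cx ε 0<ε
  ... | N , h = N , λ m n m≥ n≥ → subst (_≤ ε)
    (trans (abs-sym (x m) (x n)) (cong ∣_∣ (solve 2 (λ p q → q :- p := (:- p) :- (:- q)) refl (x m) (x n)))) (h m n m≥ n≥)

  abs-cauchy : ∀ {x} → IsCauchy x → IsCauchy (λ n → ∣ x n ∣)
  abs-cauchy {x} cx ε 0<ε with cx ε 0<ε
  ... | N , h = N , λ m n m≥ n≥ → ≤⇒close (half-tri (x m) (x n) (h m n m≥ n≥)) (half-tri (x n) (x m) (h n m n≥ m≥))
    where
    half-tri : ∀ p q → ∣ p - q ∣ ≤ ε → ∣ p ∣ ≤ ∣ q ∣ + ε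
    half-tri p q h′ = begin
      ∣ p ∣              ≡⟨ cong ∣_∣ (solve 2 (λ p q → p := q :+ (p :- q)) refl p q) ⟩
      ∣ q + (p - q) ∣    ≤⟨ ℚ.∣p+q∣≤∣p∣+∣q∣ q (p - q) ⟩
      ∣ q ∣ + ∣ p - q ∣  ≤⟨ ℚ.+-monoʳ-≤ ∣ q ∣ h′ ⟩
      ∣ q ∣ + ε          ∎

  *-close : ∀ a b c d M N δ η → ∣ a ∣ ≤ M → ∣ d ∣ ≤ N → ∣ b - d ∣ ≤ δ → ∣ a - c ∣ ≤ η →
            ∣ a * b - c * d ∣ ≤ M * δ + N * η
  *-close a b c d M N δ η a≤M d≤N b≈d a≈c = begin
    ∣ a * b - c * d ∣                      ≡⟨ cong ∣_∣ (solve 4 (λ a b c d → a :* b :- c :* d := a :* (b :- d) :+ d :* (a :- c)) refl a b c d) ⟩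
    ∣ a * (b - d) + d * (a - c) ∣          ≤⟨ ℚ.∣p+q∣≤∣p∣+∣q∣ (a * (b - d)) (d * (a - c)) ⟩
    ∣ a * (b - d) ∣ + ∣ d * (a - c) ∣      ≡⟨ cong₂ _+_ (ℚ.∣p*q∣≡∣p∣*∣q∣ a (b - d)) (ℚ.∣p*q∣≡∣p∣*∣q∣ d (a - c)) ⟩
    ∣ a ∣ * ∣ b - d ∣ + ∣ d ∣ * ∣ a - c ∣  ≤⟨ ℚ.+-mono-≤
        (*-mono-≤ {∣ a ∣} {M} {∣ b - d ∣} {δ} (ℚ.0≤∣p∣ a) a≤M (ℚ.0≤∣p∣ (b - d)) b≈d)
        (*-mono-≤ {∣ d ∣} {N} {∣ a - c ∣} {η} (ℚ.0≤∣p∣ d) d≤N (ℚ.0≤∣p∣ (a - c)) a≈c) ⟩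
    M * δ + N * η                          ∎

  *-cauchy : ∀ {x y} → IsCauchy x → IsCauchy y → IsCauchy (λ n → x n * y n)
  *-cauchy {x} {y} cx cy ε 0<ε =
    let (M₁ , 0<M₁ , N₁ , b₁) = bounded cx
        (M₂ , 0<M₂ , N₂ , b₂) = bounded cy
        (δ , 0<δ , eq₁) = scale {M₁} (ε * ½) 0<M₁ (0<half 0<ε)
        (η , 0<η , eq₂) = scale {M₂} (ε * ½) 0<M₂ (0<half 0<ε)
        (N₃ , hx) = cx η 0<η
        (N₄ , hy) = cy δ 0<δ
    in (N₁ ℕ.⊔ N₂) ℕ.⊔ (N₃ ℕ.⊔ N₄) , λ m n m≥ n≥ →
      let m₃₄ = ℕ.m⊔n≤o⇒n≤o (N₁ ℕ.⊔ N₂) (N₃ ℕ.⊔ N₄) m≥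
          n₃₄ = ℕ.m⊔n≤o⇒n≤o (N₁ ℕ.⊔ N₂) (N₃ ℕ.⊔ N₄) n≥
      in ℚ.≤-trans
        (*-close (x m) (y m) (x n) (y n) M₁ M₂ δ η
          (b₁ m (ℕ.m⊔n≤o⇒m≤o N₁ N₂ (ℕ.m⊔n≤o⇒m≤o (N₁ ℕ.⊔ N₂) (N₃ ℕ.⊔ N₄) m≥)))
          (b₂ n (ℕ.m⊔n≤o⇒n≤o N₁ N₂ (ℕ.m⊔n≤o⇒m≤o (N₁ ℕ.⊔ N₂) (N₃ ℕ.⊔ N₄) n≥)))
          (hy m n (ℕ.m⊔n≤o⇒n≤o N₃ N₄ m₃₄) (ℕ.m⊔n≤o⇒n≤o N₃ N₄ n₃₄))
          (hx m n (ℕ.m⊔n≤o⇒m≤o N₃ N₄ m₃₄) (ℕ.m⊔n≤o⇒m≤o N₃ N₄ n₃₄)))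
        (ℚ.≤-reflexive (trans (cong₂ _+_ eq₁ eq₂) (half+half ε)))

  module _ (δ : ℚ) (0<δ : 0ℚ < δ) where
    0<⊔ : ∀ q → 0ℚ < q ⊔ δ
    0<⊔ q = ℚ.<-≤-trans 0<δ (ℚ.p≤q⊔p q δ)

    -- 1 / max(q , δ)
    recip⊔ : ℚ → ℚ
    recip⊔ q = (1/ (q ⊔ δ)) {{ℚ.pos⇒nonZero (q ⊔ δ) {{ℚ.positive (0<⊔ q)}}}}

    recip⊔-inverse : ∀ q → (q ⊔ δ) * recip⊔ q ≡ 1ℚ
    recip⊔-inverse q = ℚ.*-inverseʳ (q ⊔ δ) {{ℚ.pos⇒nonZero (q ⊔ δ) {{ℚ.positive (0<⊔ q)}}}}

    0<recip⊔ : ∀ q → 0ℚ < recip⊔ q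
    0<recip⊔ q = ℚ.positive⁻¹ (recip⊔ q) {{ℚ.1/pos⇒pos (q ⊔ δ) {{ℚ.positive (0<⊔ q)}}}}

    δ*recip⊔≤1 : ∀ q → δ * recip⊔ q ≤ 1ℚ
    δ*recip⊔≤1 q = begin
      δ * recip⊔ q        ≤⟨ ℚ.*-monoʳ-≤-nonNeg (recip⊔ q) {{ℚ.nonNegative (ℚ.<⇒≤ (0<recip⊔ q))}} (ℚ.p≤q⊔p q δ) ⟩
      (q ⊔ δ) * recip⊔ q  ≡⟨ recip⊔-inverse q ⟩
      1ℚ                  ∎

    recip⊔-≤ : ∀ p q e → 0ℚ ≤ e → q ≤ p + δ * δ * e → recip⊔ p ≤ recip⊔ q + e
    recip⊔-≤ p q e 0≤e h = p-q≤e⇒p≤q+e (begin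
      r - s                                  ≡⟨ solve 2 (λ r s → r :- s := con 1ℚ :* r :- con 1ℚ :* s) refl r s ⟩
      1ℚ * r - 1ℚ * s                        ≡⟨ cong₂ (λ u v → u * r - v * s) (recip⊔-inverse q) (recip⊔-inverse p) ⟨
      (q ⊔ δ) * s * r - (p ⊔ δ) * r * s      ≡⟨ solve 4 (λ a b r s → b :* s :* r :- a :* r :* s := (b :- a) :* (r :* s)) refl (p ⊔ δ) (q ⊔ δ) r s ⟩
      ((q ⊔ δ) - (p ⊔ δ)) * (r * s)          ≤⟨ ℚ.*-monoʳ-≤-nonNeg (r * s) {{ℚ.nonNegative (ℚ.<⇒≤ 0<rs)}} (p≤q+e⇒p-q≤e {q ⊔ δ} {p ⊔ δ} {δ * δ * e} (⊔-close δ {q} {p} {δ * δ * e} 0≤δδe h)) ⟩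
      δ * δ * e * (r * s)                    ≡⟨ solve 4 (λ d e r s → d :* d :* e :* (r :* s) := (d :* r) :* (d :* s) :* e) refl δ e r s ⟩
      (δ * r) * (δ * s) * e                  ≤⟨ ℚ.*-monoʳ-≤-nonNeg e {{ℚ.nonNegative 0≤e}} (*-mono-≤ (ℚ.<⇒≤ (0<* 0<δ (0<recip⊔ p))) (δ*recip⊔≤1 p) (ℚ.<⇒≤ (0<* 0<δ (0<recip⊔ q))) (δ*recip⊔≤1 q)) ⟩
      1ℚ * 1ℚ * e                            ≡⟨ solve 1 (λ e → con 1ℚ :* con 1ℚ :* e := e) refl e ⟩
      e                                      ∎)
      where
      r = recip⊔ p
      s = recip⊔ q
      0<rs : 0ℚ < r * s
      0<rs = 0<* (0<recip⊔ p) (0<recip⊔ q)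
      0≤δδe : 0ℚ ≤ δ * δ * e
      0≤δδe = subst (_≤ δ * δ * e) (ℚ.*-zeroʳ (δ * δ)) (ℚ.*-monoˡ-≤-nonNeg (δ * δ) {{ℚ.nonNegative (ℚ.<⇒≤ (0<* 0<δ 0<δ))}} 0≤e)

    recip-cauchy : ∀ {x} → IsCauchy x → IsCauchy (λ n → recip⊔ (x n))
    recip-cauchy {x} cx ε 0<ε with cx (δ * δ * ε) (0<* (0<* 0<δ 0<δ) 0<ε)
    ... | N , h = N , λ m n m≥ n≥ → ≤⇒close
      (recip⊔-≤ (x m) (x n) ε (ℚ.<⇒≤ 0<ε) (close⇒≤ (h n m n≥ m≥)))
      (recip⊔-≤ (x n) (x m) ε (ℚ.<⇒≤ 0<ε) (close⇒≤ (h m n m≥ n≥)))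

  -- Bisection for the square root of q ≥ 0, which lies in [ lo q n , lo q n + width q n ).
  width : ℚ → ℕ → ℚ
  width q zero    = q + 1ℚ
  width q (suc n) = width q n * ½

  lo : ℚ → ℕ → ℚ
  lo q zero    = 0ℚ
  lo q (suc n) with (lo q n + width q (suc n)) * (lo q n + width q (suc n)) ≤? q
  ... | yes _ = lo q n + width q (suc n)
  ... | no  _ = lo q n

  0<width : ∀ {q} n → 0ℚ ≤ q → 0ℚ < width q n
  0<width zero    0≤q = ℚ.+-mono-≤-< 0≤q (ℚ.positive⁻¹ 1ℚ)
  0<width (suc n) 0≤q = 0<half (0<width n 0≤q)

  0≤lo : ∀ {q} n → 0ℚ ≤ q → 0ℚ ≤ lo q n
  0≤lo zero 0≤q = ℚ.≤-refl
  0≤lo {q} (suc n) 0≤q with (lo q n + width q (suc n)) * (lo q n + width q (suc n)) ≤? q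
  ... | yes _ = ℚ.+-mono-≤ (0≤lo n 0≤q) (ℚ.<⇒≤ (0<width (suc n) 0≤q))
  ... | no  _ = 0≤lo n 0≤q

  lo²≤ : ∀ {q} n → 0ℚ ≤ q → lo q n * lo q n ≤ q
  lo²≤ zero 0≤q = 0≤q
  lo²≤ {q} (suc n) 0≤q with (lo q n + width q (suc n)) * (lo q n + width q (suc n)) ≤? q
  ... | yes p = p
  ... | no  _ = lo²≤ n 0≤q

  <hi² : ∀ {q} n → 0ℚ ≤ q → q < (lo q n + width q n) * (lo q n + width q n)
  <hi² {q} zero 0≤q = begin-strict
    q                              <⟨ subst (_< q + 1ℚ) (ℚ.+-identityʳ q) (ℚ.+-monoʳ-< q (ℚ.positive⁻¹ 1ℚ)) ⟩
    q + 1ℚ                         ≡⟨ ℚ.+-identityʳ (q + 1ℚ) ⟨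
    q + 1ℚ + 0ℚ                    ≤⟨ ℚ.+-monoʳ-≤ (q + 1ℚ) (ℚ.+-mono-≤ 0≤q (subst (_≤ q * q) (ℚ.*-zeroˡ q) (ℚ.*-monoʳ-≤-nonNeg q {{ℚ.nonNegative 0≤q}} 0≤q))) ⟩
    q + 1ℚ + (q + q * q)           ≡⟨ solve 1 (λ q → q :+ con 1ℚ :+ (q :+ q :* q) := (con 0ℚ :+ (q :+ con 1ℚ)) :* (con 0ℚ :+ (q :+ con 1ℚ))) refl q ⟩
    (0ℚ + (q + 1ℚ)) * (0ℚ + (q + 1ℚ)) ∎
  <hi² {q} (suc n) 0≤q with (lo q n + width q (suc n)) * (lo q n + width q (suc n)) ≤? q
  ... | yes _ = subst (λ h → q < h * h) (trans (cong (λ t → lo q n + t) (sym (half+half (width q n)))) (sym (ℚ.+-assoc (lo q n) (width q (suc n)) (width q (suc n))))) (<hi² n 0≤q)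
  ... | no ¬p = ℚ.≰⇒> ¬p

  ½^ : ℕ → ℚ
  ½^ zero    = 1ℚ
  ½^ (suc n) = ½^ n * ½

  width≡ : ∀ q n → width q n ≡ (q + 1ℚ) * ½^ n
  width≡ q zero = sym (ℚ.*-identityʳ (q + 1ℚ))
  width≡ q (suc n) = trans (cong (_* ½) (width≡ q n)) (ℚ.*-assoc (q + 1ℚ) (½^ n) ½)

  0≤½^ : ∀ n → 0ℚ ≤ ½^ n
  0≤½^ zero    = ℚ.nonNegative⁻¹ 1ℚ
  0≤½^ (suc n) = subst (_≤ ½^ n * ½) (ℚ.*-zeroˡ ½) (ℚ.*-monoʳ-≤-nonNeg ½ (0≤½^ n))

  nat : ℕ → ℚ
  nat zero    = 0ℚ
  nat (suc n) = 1ℚ + nat n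

  toℚᵘ-nat : ∀ n → toℚᵘ (nat n) ℚᵘ.≃ ℚᵘ.mkℚᵘ (+ n) 0
  toℚᵘ-nat zero    = ℚᵘ.*≡* refl
  toℚᵘ-nat (suc n) = ℚᵘ.≃-trans (ℚ.toℚᵘ-homo-+ 1ℚ (nat n)) (ℚᵘ.≃-trans (ℚᵘ.+-congʳ ℚᵘ.1ℚᵘ (toℚᵘ-nat n))
    (ℚᵘ.*≡* (cong (λ z → (+ 1 ℤ.+ z) ℤ.* + 1) (ℤ.*-identityʳ (+ n)))))

  archimedean : ∀ q → ∃ λ n → q ≤ nat n
  archimedean q@(mkℚ z d _) = ℤ.∣ z ∣ , ℚ.toℚᵘ-cancel-≤
    (ℚᵘ.≤-trans (ℚᵘ.*≤* (le z)) (ℚᵘ.≤-reflexive (ℚᵘ.≃-sym (toℚᵘ-nat ℤ.∣ z ∣))))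
    where
    le : ∀ z → z ℤ.* + 1 ℤ.≤ + ℤ.∣ z ∣ ℤ.* + suc d
    le (+ n)    = subst₂ ℤ._≤_ (ℤ.pos-* n 1) (ℤ.pos-* n (suc d)) (ℤ.+≤+ (ℕ.*-monoʳ-≤ n (ℕ.s≤s ℕ.z≤n)))
    le -[1+ n ] = ℤ.-≤+

  0≤nat : ∀ n → 0ℚ ≤ nat n
  0≤nat zero    = ℚ.≤-refl
  0≤nat (suc n) = ℚ.+-mono-≤ (ℚ.nonNegative⁻¹ 1ℚ) (0≤nat n)

  nat*½^≤1 : ∀ n → (1ℚ + nat n) * ½^ n ≤ 1ℚ
  nat*½^≤1 zero    = ℚ.≤-refl
  nat*½^≤1 (suc n) = begin
    (1ℚ + (1ℚ + t)) * (h * ½)    ≤⟨ ℚ.*-monoʳ-≤-nonNeg (h * ½) {{ℚ.nonNegative (0≤½^ (suc n))}} le ⟩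
    ((1ℚ + t) + (1ℚ + t)) * (h * ½) ≡⟨ solve 3 (λ t h k → ((con 1ℚ :+ t) :+ (con 1ℚ :+ t)) :* (h :* k) := ((con 1ℚ :+ t) :* h) :* k :+ ((con 1ℚ :+ t) :* h) :* k) refl t h ½ ⟩
    ((1ℚ + t) * h) * ½ + ((1ℚ + t) * h) * ½  ≡⟨ half+half ((1ℚ + t) * h) ⟩
    (1ℚ + t) * h                 ≤⟨ nat*½^≤1 n ⟩
    1ℚ                           ∎
    where
    t = nat n
    h = ½^ n
    le : 1ℚ + (1ℚ + t) ≤ (1ℚ + t) + (1ℚ + t)
    le = ℚ.+-monoˡ-≤ (1ℚ + t) (subst (_≤ 1ℚ + t) (ℚ.+-identityʳ 1ℚ) (ℚ.+-monoʳ-≤ 1ℚ (0≤nat n)))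

  ½^-mono : ∀ k n → ½^ (k ℕ.+ n) ≤ ½^ n
  ½^-mono zero n = ℚ.≤-refl
  ½^-mono (suc k) n = begin
    ½^ (k ℕ.+ n) * ½   ≤⟨ ℚ.*-monoˡ-≤-nonNeg (½^ (k ℕ.+ n)) {{ℚ.nonNegative (0≤½^ (k ℕ.+ n))}} (ℚ.toℚᵘ-cancel-≤ (ℚᵘ.*≤* (ℤ.+≤+ (ℕ.s≤s ℕ.z≤n)))) ⟩
    ½^ (k ℕ.+ n) * 1ℚ  ≡⟨ ℚ.*-identityʳ (½^ (k ℕ.+ n)) ⟩
    ½^ (k ℕ.+ n)       ≤⟨ ½^-mono k n ⟩
    ½^ n               ∎

  ½^-small : ∀ {C} ε → 0ℚ < C → 0ℚ < ε → ∃ λ N → ∀ n → N ℕ.≤ n → C * ½^ n ≤ ε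
  ½^-small {C} ε 0<C 0<ε with scale C 0<ε 0<C
  ... | D , 0<D , εD≡C with archimedean D
  ... | N , D≤N = N , λ n N≤n → begin
    C * ½^ n        ≤⟨ ℚ.*-monoˡ-≤-nonNeg C {{ℚ.nonNegative (ℚ.<⇒≤ 0<C)}} (subst (λ k → ½^ k ≤ ½^ N) (ℕ.m∸n+n≡m N≤n) (½^-mono (n ℕ.∸ N) N)) ⟩
    C * ½^ N        ≡⟨ trans (cong (_* ½^ N) (sym εD≡C)) (ℚ.*-assoc ε D (½^ N)) ⟩
    ε * (D * ½^ N)  ≤⟨ ℚ.*-monoˡ-≤-nonNeg ε {{ℚ.nonNegative (ℚ.<⇒≤ 0<ε)}} (ℚ.≤-trans
                         (ℚ.*-monoʳ-≤-nonNeg (½^ N) {{ℚ.nonNegative (0≤½^ N)}} (ℚ.≤-trans D≤N (subst (_≤ 1ℚ + nat N) (ℚ.+-identityˡ (nat N)) (ℚ.+-monoˡ-≤ (nat N) (ℚ.nonNegative⁻¹ 1ℚ)))))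
                         (nat*½^≤1 N)) ⟩
    ε * 1ℚ          ≡⟨ ℚ.*-identityʳ ε ⟩
    ε               ∎

  lo-≤ : ∀ p q m n ε → 0ℚ ≤ p → 0ℚ ≤ q → 0ℚ < ε → width q n ≤ ε * ½ →
         p ≤ q + ε * ½ * (ε * ½) → lo p m ≤ lo q n + ε
  lo-≤ p q m n ε 0≤p 0≤q 0<ε w≤ p≤ with lo p m ≤? lo q n + ε
  ... | yes h = h
  ... | no ¬h = contradiction refl (ℚ.<⇒≢ (ℚ.≤-<-trans p≤ (begin-strict
    q + e * e                                    <⟨ ℚ.+-monoˡ-< (e * e) (<hi² n 0≤q) ⟩
    (s + width q n) * (s + width q n) + e * e    ≤⟨ ℚ.+-monoˡ-≤ (e * e) (*-mono-≤ 0≤s+w (ℚ.+-monoʳ-≤ s w≤) 0≤s+w (ℚ.+-monoʳ-≤ s w≤)) ⟩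
    (s + e) * (s + e) + e * e                    ≡⟨ ℚ.+-identityʳ _ ⟨
    (s + e) * (s + e) + e * e + 0ℚ               ≤⟨ ℚ.+-monoʳ-≤ ((s + e) * (s + e) + e * e) 0≤rest ⟩
    (s + e) * (s + e) + e * e + ((s * e + s * e) + (e * e + e * e)) ≡⟨ solve 2 (λ s e → (s :+ e) :* (s :+ e) :+ e :* e :+ ((s :* e :+ s :* e) :+ (e :* e :+ e :* e)) := (s :+ (e :+ e)) :* (s :+ (e :+ e))) refl s e ⟩
    (s + (e + e)) * (s + (e + e))                ≡⟨ cong (λ t → (s + t) * (s + t)) (half+half ε) ⟩
    (s + ε) * (s + ε)                            ≤⟨ *-mono-≤ 0≤s+ε (ℚ.<⇒≤ (ℚ.≰⇒> ¬h)) 0≤s+ε (ℚ.<⇒≤ (ℚ.≰⇒> ¬h)) ⟩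
    lo p m * lo p m                              ≤⟨ lo²≤ m 0≤p ⟩
    p                                            ∎)))
    where
    s = lo q n
    e = ε * ½
    0≤s : 0ℚ ≤ s
    0≤s = 0≤lo n 0≤q
    0≤e : 0ℚ ≤ e
    0≤e = ℚ.<⇒≤ (0<half 0<ε)
    0≤s+w : 0ℚ ≤ s + width q n
    0≤s+w = ℚ.+-mono-≤ 0≤s (ℚ.<⇒≤ (0<width n 0≤q))
    0≤s+ε : 0ℚ ≤ s + ε
    0≤s+ε = ℚ.+-mono-≤ 0≤s (ℚ.<⇒≤ 0<ε)
    0≤* : ∀ {a} → 0ℚ ≤ a → 0ℚ ≤ a * e
    0≤* {a} 0≤a = subst (_≤ a * e) (ℚ.*-zeroˡ e) (ℚ.*-monoʳ-≤-nonNeg e {{ℚ.nonNegative 0≤e}} 0≤a)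
    0≤rest : 0ℚ ≤ (s * e + s * e) + (e * e + e * e)
    0≤rest = ℚ.+-mono-≤ (ℚ.+-mono-≤ (0≤* 0≤s) (0≤* 0≤s)) (ℚ.+-mono-≤ (0≤* 0≤e) (0≤* 0≤e))

  width-small : ∀ q C ε n → q ≤ C → 0ℚ ≤ C → (C + 1ℚ) * ½^ n ≤ ε → width (q ⊔ 0ℚ) n ≤ ε
  width-small q C ε n q≤C 0≤C h = begin
    width (q ⊔ 0ℚ) n       ≡⟨ width≡ (q ⊔ 0ℚ) n ⟩
    (q ⊔ 0ℚ + 1ℚ) * ½^ n   ≤⟨ ℚ.*-monoʳ-≤-nonNeg (½^ n) {{ℚ.nonNegative (0≤½^ n)}} (ℚ.+-monoˡ-≤ 1ℚ (ℚ.⊔-lub q≤C 0≤C)) ⟩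
    (C + 1ℚ) * ½^ n        ≤⟨ h ⟩
    ε                      ∎

  sqrt-cauchy : ∀ {x} → IsCauchy x → IsCauchy (λ n → lo (x n ⊔ 0ℚ) n)
  sqrt-cauchy {x} cx ε 0<ε =
    let 0<e = 0<half 0<ε
        0<ee = 0<* 0<e 0<e
        (C , 0<C , N₁ , b) = bounded cx
        (N₂ , h) = cx (ε * ½ * (ε * ½)) 0<ee
        (N₃ , small) = ½^-small {C + 1ℚ} (ε * ½) (ℚ.+-mono-< 0<C (ℚ.positive⁻¹ 1ℚ)) 0<e
        half-close : ∀ m n → N₁ ℕ.⊔ (N₂ ℕ.⊔ N₃) ℕ.≤ m → N₁ ℕ.⊔ (N₂ ℕ.⊔ N₃) ℕ.≤ n →
                     lo (x m ⊔ 0ℚ) m ≤ lo (x n ⊔ 0ℚ) n + ε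
        half-close m n m≥ n≥ =
          let m₂₃ = ℕ.m⊔n≤o⇒n≤o N₁ (N₂ ℕ.⊔ N₃) m≥
              n₂₃ = ℕ.m⊔n≤o⇒n≤o N₁ (N₂ ℕ.⊔ N₃) n≥
          in lo-≤ (x m ⊔ 0ℚ) (x n ⊔ 0ℚ) m n ε (0≤⊔ (x m)) (0≤⊔ (x n)) 0<ε
            (width-small (x n) C (ε * ½) n
              (ℚ.≤-trans (≤-abs (x n)) (b n (ℕ.m⊔n≤o⇒m≤o N₁ (N₂ ℕ.⊔ N₃) n≥)))
              (ℚ.<⇒≤ 0<C)
              (small n (ℕ.m⊔n≤o⇒n≤o N₂ N₃ n₂₃)))
            (⊔-close 0ℚ {x m} {x n} (ℚ.<⇒≤ 0<ee)
              (close⇒≤ {x m} {x n} (h m n (ℕ.m⊔n≤o⇒m≤o N₂ N₃ m₂₃) (ℕ.m⊔n≤o⇒m≤o N₂ N₃ n₂₃))))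
    in N₁ ℕ.⊔ (N₂ ℕ.⊔ N₃) , λ m n m≥ n≥ → ≤⇒close (half-close m n m≥ n≥) (half-close n m n≥ m≥)

record ℝ : Set where
  constructor mkℝ
  field
    seq    : ℕ → ℚ
    cauchy : IsCauchy seq

open ℝ public

infix  4 _≈_ _<_ _≤_ _⟶_ _=o_
infixl 6 _+_ _-_
infixl 7 _*_ _÷_⟨_⟩
infix  8 -_
infixr 9 _^_

_≈_ _≤_ _<_ : ℝ → ℝ → Set
x ≈ y = ∀ ε → 0ℚ ℚ.< ε → ∃[ N ] ∀ n → N ℕ.≤ n → ℚ.∣ seq x n ℚ.- seq y n ∣ ℚ.≤ ε
x ≤ y = ∀ ε → 0ℚ ℚ.< ε → ∃[ N ] ∀ n → N ℕ.≤ n → seq x n ℚ.≤ seq y n ℚ.+ ε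
x < y = ∃[ δ ] 0ℚ ℚ.< δ × ∃[ N ] ∀ n → N ℕ.≤ n → seq x n ℚ.+ δ ℚ.≤ seq y n

fromℚ : ℚ → ℝ
fromℚ q = mkℝ (λ _ → q) (Sequences.const-cauchy q)

fromℤ : ℤ → ℝ
fromℤ i = fromℚ (i ℚ./ 1)

fromℕ : ℕ → ℝ
fromℕ n = fromℤ (+ n)

0ℝ 1ℝ : ℝ
0ℝ = fromℚ 0ℚ
1ℝ = fromℚ 1ℚ

_+_ _*_ : ℝ → ℝ → ℝ
x + y = mkℝ (λ n → seq x n ℚ.+ seq y n) (Sequences.+-cauchy {seq x} {seq y} (cauchy x) (cauchy y))
x * y = mkℝ (λ n → seq x n ℚ.* seq y n) (Sequences.*-cauchy {seq x} {seq y} (cauchy x) (cauchy y))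

-_ ∣_∣ : ℝ → ℝ
- x   = mkℝ (λ n → ℚ.- seq x n) (Sequences.neg-cauchy {seq x} (cauchy x))
∣ x ∣ = mkℝ (λ n → ℚ.∣ seq x n ∣) (Sequences.abs-cauchy {seq x} (cauchy x))

_-_ : ℝ → ℝ → ℝ
x - y = x + (- y)

_^_ : ℝ → ℕ → ℝ
x ^ zero  = 1ℝ
x ^ suc n = x * x ^ n

-- The sequence of y is eventually at least the δ in 0<y, so that max(y , δ) ≈ y.
_÷_⟨_⟩ : (x y : ℝ) → 0ℝ < y → ℝ
x ÷ y ⟨ δ , 0<δ , _ ⟩ =
  x * mkℝ (λ n → Sequences.recip⊔ δ 0<δ (seq y n)) (Sequences.recip-cauchy δ 0<δ {seq y} (cauchy y))

-- For x < 0 this is 0.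
√_ : ℝ → ℝ
√ x = mkℝ (λ n → Sequences.lo (seq x n ℚ.⊔ 0ℚ) n) (Sequences.sqrt-cauchy {seq x} (cauchy x))

0<1 : 0ℝ < 1ℝ
0<1 = 1ℚ , ℚ.positive⁻¹ 1ℚ , 0 , λ _ _ → ℚ.≤-refl

0<* : ∀ x y → 0ℝ < x → 0ℝ < y → 0ℝ < x * y
0<* x y (δ , 0<δ , M , h) (ε , 0<ε , N , k) =
  δ ℚ.* ε , Sequences.0<* {δ} {ε} 0<δ 0<ε , M ℕ.⊔ N , λ n n≥ →
    subst (ℚ._≤ seq x n ℚ.* seq y n) (sym (ℚ.+-identityˡ (δ ℚ.* ε)))
      (Sequences.*-mono-≤ {δ} {seq x n} {ε} {seq y n} (ℚ.<⇒≤ 0<δ)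
        (subst (ℚ._≤ seq x n) (ℚ.+-identityˡ δ) (h n (ℕ.m⊔n≤o⇒m≤o M N n≥)))
        (ℚ.<⇒≤ 0<ε)
        (subst (ℚ._≤ seq y n) (ℚ.+-identityˡ ε) (k n (ℕ.m⊔n≤o⇒n≤o M N n≥))))

0<^ : ∀ x → 0ℝ < x → ∀ n → 0ℝ < x ^ n
0<^ x 0<x zero    = 0<1
0<^ x 0<x (suc n) = 0<* x (x ^ n) 0<x (0<^ x 0<x n)

_⟶_ : (ℕ → ℝ) → ℝ → Set
u ⟶ ℓ = ∀ ε → 0ℝ < ε → ∃[ N ] ∀ n → N ℕ.≤ n → ∣ u n - ℓ ∣ < ε

_=o_ : (ℕ → ℝ) → (ℕ → ℝ) → Set
f =o g = ∀ ε → 0ℝ < ε → ∃[ N ] ∀ n → N ℕ.≤ n → ∣ f n ∣ ≤ ε * ∣ g n ∣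

Continuous : (ℝ → ℝ) → Set
Continuous f = ∀ x ε → 0ℝ < ε → ∃[ δ ] 0ℝ < δ × (∀ y → ∣ y - x ∣ < δ → ∣ f y - f x ∣ < ε)

Periodic : ℝ → (ℝ → ℝ) → Set
Periodic p f = ∀ x → f (x + p) ≈ f x

IsFloor : ℝ → ℕ → Set
IsFloor x k = fromℕ k ≤ x × x < fromℕ (suc k)

expSum : ℝ → ℕ → ℝ
expSum x zero    = 1ℝ
expSum x (suc n) = expSum x n + fromℚ ((+ 1 ℚ./ suc n !) {{suc n ℕ.!≢0}}) * x ^ suc n

IsExp : ℝ → ℝ → Set
IsExp x y = expSum x ⟶ y

-- f is x ↦ b ^ x, that is, x ↦ exp (x ln b).
IsPower : ℝ → (ℝ → ℝ) → Set
IsPower b f = ∃[ ln-b ] IsExp ln-b b × (∀ x → IsExp (x * ln-b) (f x))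

record ℂ : Set where
  constructor _+i_
  field
    re im : ℝ

open ℂ public

infix  4 _≈ᶜ_
infix  5 _+i_
infixl 6 _+ᶜ_ _-ᶜ_
infixl 7 _*ᶜ_

_≈ᶜ_ : ℂ → ℂ → Set
z ≈ᶜ w = re z ≈ re w × im z ≈ im w

_+ᶜ_ _-ᶜ_ _*ᶜ_ : ℂ → ℂ → ℂ
z +ᶜ w = (re z + re w) +i (im z + im w)
z -ᶜ w = (re z - re w) +i (im z - im w)
z *ᶜ w = (re z * re w - im z * im w) +i (re z * im w + im z * re w)

ofℝ : ℝ → ℂ
ofℝ x = x +i 0ℝ

modulus : ℂ → ℝ
modulus z = √ (re z * re z + im z * im z)

-- z is a root of X³ - 2X² - X + 1.
IsRoot : ℂ → Set
IsRoot z = z *ᶜ z *ᶜ z -ᶜ ofℝ (fromℕ 2) *ᶜ (z *ᶜ z) -ᶜ z +ᶜ ofℝ 1ℝ ≈ᶜ ofℝ 0ℝ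

IsDominantRoot : ℝ → Set
IsDominantRoot β = IsRoot (ofℝ β) × (∀ z → IsRoot z → modulus z ≤ modulus (ofℝ β))

B : ℕ → ℤ
B 0                   = + 1
B 1                   = + 3
B 2                   = + 6
B (suc (suc (suc n))) = + 2 ℤ.* B (suc (suc n)) ℤ.+ B (suc n) ℤ.- B n

φ : ℝ
φ = (1ℝ + √ fromℕ 5) * fromℚ ½

0<φ : 0ℝ < φ
0<φ = ½ , ℚ.positive⁻¹ ½ , 0 , λ n _ → ℚ.*-monoʳ-≤-nonNeg ½
  {1ℚ} {1ℚ ℚ.+ Sequences.lo 5/1 n} (ℚ.+-monoʳ-≤ 1ℚ {0ℚ} {Sequences.lo 5/1 n} (Sequences.0≤lo {5/1} n (ℚ.nonNegative⁻¹ 5/1)))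
  where
  5/1 : ℚ
  5/1 = + 5 ℚ./ 1

-- Σ rᵢ / φ ^ (k + i), where r = r₁ r₂ ⋯
φ-sum : ℕ → Word → ℝ
φ-sum k []      = 0ℝ
φ-sum k (r ∷ w) = fromℕ (toℕ r) ÷ φ ^ suc k ⟨ 0<^ φ 0<φ (suc k) ⟩ + φ-sum (suc k) w

-- rep n has length at least 3 exactly when n ≥ 3, and it then starts with 10;
-- the value 0 for n < 3 is arbitrary.
relpos : ℕ → ℝ
relpos n with rep n
... | 1F ∷ 0F ∷ r = φ-sum 0 r
... | _           = 0ℝ

logF : ℕ → ℝ
logF n = fromℕ (length (rep n) ℕ.∸ 1) + relpos n

-- Counting subwords in rep(ℕ) letter by letter gives sF (value 1u) = x u, where the pair (x u, y u) is obtained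
-- from (2, 1) by applying one of the matrices M₀ = (1 1; 0 1), M₁ = (1 0; 1 0) for each letter of u.  Hence, for
-- N = value 10r with |r| = k, the sum of sF over n < N is B (k + 1) plus the entries of the vector V r with
-- V ε = 0, V (0r) = M₀ V r and V (1r) = M₀ (sum over all words of length |r|) + M₁ V r.  B differs from c β^n by a
-- bounded sequence, the products of matrices grow at most like 2^k, and 2 < β: up to O(2^k), V r is
-- c β^k H (relpos N), where H solves the refinement equation
--   H α = β⁻¹ M₀ H (φ α) + β⁻² M₁ M₀ H (φ² α - φ),   H = 0 on (-∞, 0],   H = (β² - β - 1, 1) on [1, ∞).
-- In this form of the equation no digit of α has to be decided, so that H is constructed on all of ℝ by iterating
-- a contraction.  For ℓ = k + 1 and α ∈ [0, 1], β^(ℓ + α) G (ℓ + α) is β^ℓ (1 + u α), where β u is the sum of the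
-- entries of H; the values at α = 1 and at ℓ + 1, α = 0 agree because 1 + β⁻¹ (β² - β) = β.
module Submission where

-- Order and equality of Cauchy reals are undecidable, so no function may be defined by comparing
-- reals, and a root cannot be located by testing signs. Hence `β` and `ln-β` are limits of
-- contractions on explicit rational intervals, the refinement iteration starts from a clamp written
-- with absolute values, and `G` reduces its argument by an integer that is only approximately a
-- floor. Proofs of inequalities may still distinguish cases, because a weak inequality amounts to
-- the negation of a strict one. This is what saves the contraction: with `β⁻¹` at most 5/11, the
-- two terms of the refinement equation have norms at most 10/11 and 50/121, whose sum exceeds 1;
-- but at every α at least one of the two arguments lies where all iterates agree. The same 10/11
-- bounds 2/β and makes the error 2^k negligible. Inverses and the other two roots are polynomials
-- in `β`, so that algebra in ℚ(β) becomes polynomial identities modulo the cubic.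

module Words where
  open import Data.Bool using (Bool; true; false; if_then_else_; _∧_)
  open import Data.Bool.Properties using (∧-zeroʳ)
  open import Data.Fin.Patterns using (0F; 1F)
  import Data.Fin.Properties as Fin
  open import Data.Integer as ℤ using (ℤ) renaming (+_ to pos)
  import Data.Integer.Properties as ℤ
  import Data.Integer.Solver as ℤSolver
  open import Data.List using (List; []; _∷_; _++_; length; filter; map; upTo; applyUpTo; concatMap; _∷ʳ_)
  import Data.List.Properties as List
  open import Data.List.Relation.Unary.Linked using (Linked; []; [-]; _∷_)
  import Data.List.Relation.Unary.Linked as Linked
  open import Data.Nat as ℕ using (ℕ; zero; suc; _+_; _*_; _≤_; _<_; z≤n; s≤s; _^_)
  open import Data.Nat.ListAction using (sum)
  open import Data.Nat.ListAction.Properties using (sum-++)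
  open import Data.Nat.Properties
  import Data.Nat.Solver as ℕSolver
  open import Data.Product using (∃-syntax; _×_; _,_; proj₂)
  open import Data.Unit using (tt)
  open import Function using (_∘_; id)
  open import Relation.Binary.PropositionalEquality
  open import Relation.Nullary using (Dec; yes; no; does; contradiction)
  open import Relation.Unary using (Decidable)
  open import Defs using (Word; F; value; greedy; rep; NotBothOne; IsNormal; _∈rep[ℕ]?; binom; wordsOfLength; sF; B;
    F-mono; zero-∷; length-greedy; value-greedy; one-∷; linked-greedy; tail-value<; rep-normal; value-rep; rep-unique)

  -- Counting subwords in rep(ℕ) letter by letter

  𝟙 : Bool → ℕ
  𝟙 b = if b then 1 else 0

  count : (Word → Bool) → List Word → ℕ
  count f []       = 0
  count f (v ∷ vs) = 𝟙 (f v) + count f vs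

  length-filter : ∀ {P : Word → Set} (P? : Decidable P) {f} → (∀ v → does (P? v) ≡ f v) → ∀ vs → length (filter P? vs) ≡ count f vs
  length-filter P? e []       = refl
  length-filter P? {f} e (v ∷ vs) with does (P? v) | e v
  ... | true  | fv rewrite sym fv = cong suc (length-filter P? e vs)
  ... | false | fv rewrite sym fv = length-filter P? e vs

  count-cong : ∀ {f g} → (∀ v → f v ≡ g v) → ∀ vs → count f vs ≡ count g vs
  count-cong e []       = refl
  count-cong e (v ∷ vs) = cong₂ _+_ (cong 𝟙 (e v)) (count-cong e vs)

  count-++ : ∀ f us vs → count f (us ++ vs) ≡ count f us + count f vs
  count-++ f []       vs = refl
  count-++ f (u ∷ us) vs = trans (cong (λ t → _ + t) (count-++ f us vs)) (sym (+-assoc (𝟙 (f u)) _ _))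

  count-map : ∀ f (g : Word → Word) vs → count f (map g vs) ≡ count (f ∘ g) vs
  count-map f g []       = refl
  count-map f g (v ∷ vs) = cong (λ t → _ + t) (count-map f g vs)

  count-wordsOfLength : ∀ f n → count f (wordsOfLength (suc n)) ≡ count (f ∘ (0F ∷_)) (wordsOfLength n) + count (f ∘ (1F ∷_)) (wordsOfLength n)
  count-wordsOfLength f n = trans (count-++ f (map (0F ∷_) W) _) (cong₂ _+_ (count-map f (0F ∷_) W)
    (trans (count-++ f (map (1F ∷_) W) []) (trans (+-identityʳ _) (count-map f (1F ∷_) W))))
    where
    W = wordsOfLength n

  countBelow : (Word → Bool) → ℕ → ℕ
  countBelow f m = count f (concatMap wordsOfLength (upTo m))

  -- A word of length at most `m` is empty or a letter followed by a word of length below `m`.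
  countBelow-suc : ∀ f m → countBelow f (suc m) ≡ 𝟙 (f []) + (countBelow (f ∘ (0F ∷_)) m + countBelow (f ∘ (1F ∷_)) m)
  countBelow-suc f m = cong (𝟙 (f []) +_) (shift id m)
    where
    C : (Word → Bool) → (ℕ → ℕ) → ℕ → ℕ
    C f g m = count f (concatMap wordsOfLength (applyUpTo g m))
    -- Generalised from `upTo`, whose tail is an `applyUpTo` with a shifted function.
    shift : ∀ g m → C f (suc ∘ g) m ≡ C (f ∘ (0F ∷_)) g m + C (f ∘ (1F ∷_)) g m
    shift g zero    = refl
    shift g (suc m) = begin
      C f (suc ∘ g) (suc m)  ≡⟨ count-++ f (wordsOfLength (suc (g 0))) _ ⟩
      count f (wordsOfLength (suc (g 0))) + C f (suc ∘ g ∘ suc) m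
        ≡⟨ cong₂ _+_ (count-wordsOfLength f (g 0)) (shift (g ∘ suc) m) ⟩
      (a + b) + (c + d)  ≡⟨ solve 4 (λ a b c d → (a :+ b) :+ (c :+ d) := (a :+ c) :+ (b :+ d)) refl a b c d ⟩
      (a + c) + (b + d)
        ≡⟨ cong₂ _+_ (count-++ (f ∘ (0F ∷_)) (wordsOfLength (g 0)) _) (count-++ (f ∘ (1F ∷_)) (wordsOfLength (g 0)) _) ⟨
      C (f ∘ (0F ∷_)) g (suc m) + C (f ∘ (1F ∷_)) g (suc m) ∎
      where
      open ≡-Reasoning
      open ℕSolver.+-*-Solver
      a = count (f ∘ (0F ∷_)) (wordsOfLength (g 0))
      b = count (f ∘ (1F ∷_)) (wordsOfLength (g 0))
      c = C (f ∘ (0F ∷_)) (g ∘ suc) m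
      d = C (f ∘ (1F ∷_)) (g ∘ suc) m

  countBelow-cong : ∀ {f g} → (∀ v → f v ≡ g v) → ∀ m → countBelow f m ≡ countBelow g m
  countBelow-cong e m = count-cong e (concatMap wordsOfLength (upTo m))

  countBelow-false : ∀ {f} → (∀ v → f v ≡ false) → ∀ m → countBelow f m ≡ 0
  countBelow-false {f} e m = none (concatMap wordsOfLength (upTo m))
    where
    none : ∀ vs → count f vs ≡ 0
    none []       = refl
    none (v ∷ vs) = cong₂ _+_ (cong 𝟙 (e v)) (none vs)

  -- Greedy matching: each letter of the second word takes its earliest occurrence, so that there is
  -- no branching as in `binom`.
  subword : Word → Word → Bool
  subword u        []       = true
  subword []       (b ∷ v)  = false
  subword (0F ∷ u) (0F ∷ v) = subword u v
  subword (0F ∷ u) (1F ∷ v) = subword u (1F ∷ v)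
  subword (1F ∷ u) (0F ∷ v) = subword u (0F ∷ v)
  subword (1F ∷ u) (1F ∷ v) = subword u v

  startsNot1 no11 leading1 : Word → Bool
  startsNot1 []       = true
  startsNot1 (0F ∷ v) = true
  startsNot1 (1F ∷ v) = false
  no11 []       = true
  no11 (0F ∷ v) = no11 v
  no11 (1F ∷ v) = startsNot1 v ∧ no11 v
  leading1 []       = true
  leading1 (0F ∷ v) = false
  leading1 (1F ∷ v) = true

  after1 nonempty : Word → Word → Bool
  after1 u v   = (startsNot1 v ∧ no11 v) ∧ subword u v
  nonempty u v = no11 (1F ∷ v) ∧ subword u (1F ∷ v)

  -- x u - 1 counts the words v with 1v ∈ rep(ℕ) that are subwords of u, and y u - 1 the nonempty words of
  -- rep(ℕ) that are subwords of u; the shift by 1 makes the recursion homogeneous.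
  x y : Word → ℕ
  x []       = 2
  x (0F ∷ u) = x u + y u
  x (1F ∷ u) = x u
  y []       = 1
  y (0F ∷ u) = y u
  y (1F ∷ u) = x u

  -- The words not beginning with 1 are those of `after1`; stripping the 1 from the others gives
  -- those of `nonempty`, with one letter less to spend.
  no11-count : ∀ u m → countBelow (λ v → no11 v ∧ subword u v) (suc m) ≡ countBelow (after1 u) (suc m) + countBelow (nonempty u) m
  no11-count u m = trans (countBelow-suc (λ v → no11 v ∧ subword u v) m) (trans
    (sym (+-assoc (𝟙 true) (countBelow (λ v → no11 v ∧ subword u (0F ∷ v)) m) _))
    (cong (_+ countBelow (nonempty u) m) (sym (trans (countBelow-suc (after1 u) m)
      (cong suc (trans (cong (countBelow (λ v → no11 v ∧ subword u (0F ∷ v)) m +_) (countBelow-false (λ _ → refl) m)) (+-identityʳ _)))))))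

  -- By induction on `u`, jointly with `nonempty-count`. A first letter 0 of `u` matches the leading
  -- 0 of a word of `after1`, after which anything without 11 may follow; it cannot serve as a
  -- leading 1. A first letter 1 cannot be used by `after1`, and in `nonempty` it matches the
  -- leading 1, leaving exactly a word of `after1`.
  after1-count : ∀ u m → length u < m → suc (countBelow (after1 u) m) ≡ x u
  nonempty-count : ∀ u m → length u ≤ m → suc (countBelow (nonempty u) m) ≡ y u

  after1-count []       (suc m) _ = cong suc (trans (countBelow-suc (after1 []) m)
    (cong suc (cong₂ _+_ (countBelow-false (λ v → ∧-zeroʳ (no11 v)) m) (countBelow-false (λ _ → refl) m))))
  after1-count (0F ∷ u) (suc (suc m)) (s≤s (s≤s u≤m)) = begin
    suc (countBelow (after1 (0F ∷ u)) (2 + m))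
      ≡⟨ cong suc (countBelow-suc (after1 (0F ∷ u)) (suc m)) ⟩
    2 + (countBelow (λ v → no11 v ∧ subword u v) (suc m) + countBelow (after1 (0F ∷ u) ∘ (1F ∷_)) (suc m))
      ≡⟨ cong (2 +_) (cong₂ _+_ (no11-count u m) (countBelow-false (λ _ → refl) (suc m))) ⟩
    2 + (countBelow (after1 u) (suc m) + countBelow (nonempty u) m + 0)
      ≡⟨ solve 2 (λ a b → con 2 :+ (a :+ b :+ con 0) := (con 1 :+ a) :+ (con 1 :+ b)) refl (countBelow (after1 u) (suc m)) (countBelow (nonempty u) m) ⟩
    suc (countBelow (after1 u) (suc m)) + suc (countBelow (nonempty u) m)
      ≡⟨ cong₂ _+_ (after1-count u (suc m) (s≤s u≤m)) (nonempty-count u m u≤m) ⟩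
    x u + y u ∎
    where
    open ≡-Reasoning
    open ℕSolver.+-*-Solver
  after1-count (1F ∷ u) m u<m = trans (cong suc (countBelow-cong same m)) (after1-count u m (<-trans (n<1+n _) u<m))
    where
    same : ∀ v → after1 (1F ∷ u) v ≡ after1 u v
    same []       = refl
    same (0F ∷ v) = refl
    same (1F ∷ v) = refl

  nonempty-count []       m _   = cong suc (countBelow-false (λ v → ∧-zeroʳ (no11 (1F ∷ v))) m)
  nonempty-count (0F ∷ u) m u≤m = nonempty-count u m (≤-trans (n≤1+n _) u≤m)
  nonempty-count (1F ∷ u) m u≤m = after1-count u m u≤m

  does-≡ : ∀ {P : Set} (P? : Dec P) {b} → (P → b ≡ true) → (b ≡ true → P) → does P? ≡ b
  does-≡ (yes p) f _ = sym (f p)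
  does-≡ (no ¬p) {true}  _ g = contradiction (g refl) ¬p
  does-≡ (no ¬p) {false} _ _ = refl

  -- This makes greedy matching complete: if an occurrence skips a usable letter, there is also an
  -- occurrence of the rest of the word after that letter.
  binom-tail : ∀ u b v → 0 < binom u (b ∷ v) → 0 < binom u v
  binom-tail (a ∷ u) b []       _ = s≤s z≤n
  binom-tail (a ∷ u) b (c ∷ v) h = ≤-trans (go (does (a Fin.≟ b)) h) (m≤m+n _ _)
    where
    go : ∀ d → 0 < binom u (b ∷ c ∷ v) + (if d then binom u (c ∷ v) else 0) → 0 < binom u (c ∷ v)
    go d h with binom u (b ∷ c ∷ v) in eq
    go d     h | suc _ = binom-tail u b (c ∷ v) (subst (0 <_) (sym eq) (s≤s z≤n))
    go true  h | zero  = h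
    go false h | zero  = contradiction h (λ ())

  positive-sum : ∀ {m n} → (0 < m → 0 < n) → 0 < m + n → 0 < n
  positive-sum {zero}  f h = h
  positive-sum {suc m} f h = f (s≤s z≤n)

  binom⇒subword : ∀ u v → 0 < binom u v → subword u v ≡ true
  binom⇒subword u        []       _ = refl
  binom⇒subword (0F ∷ u) (0F ∷ v) h = binom⇒subword u v (positive-sum (binom-tail u 0F v) h)
  binom⇒subword (0F ∷ u) (1F ∷ v) h = binom⇒subword u (1F ∷ v) (subst (0 <_) (+-identityʳ _) h)
  binom⇒subword (1F ∷ u) (0F ∷ v) h = binom⇒subword u (0F ∷ v) (subst (0 <_) (+-identityʳ _) h)
  binom⇒subword (1F ∷ u) (1F ∷ v) h = binom⇒subword u v (positive-sum (binom-tail u 1F v) h)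

  subword⇒binom : ∀ u v → subword u v ≡ true → 0 < binom u v
  subword⇒binom u        []       _ = s≤s z≤n
  subword⇒binom (0F ∷ u) (0F ∷ v) h = ≤-trans (subword⇒binom u v h) (m≤n+m _ _)
  subword⇒binom (0F ∷ u) (1F ∷ v) h = ≤-trans (subword⇒binom u (1F ∷ v) h) (m≤m+n _ _)
  subword⇒binom (1F ∷ u) (0F ∷ v) h = ≤-trans (subword⇒binom u (0F ∷ v) h) (m≤m+n _ _)
  subword⇒binom (1F ∷ u) (1F ∷ v) h = ≤-trans (subword⇒binom u v h) (m≤n+m _ _)

  linked⇒no11 : ∀ v → Linked NotBothOne v → no11 v ≡ true
  linked⇒no11 []            _ = refl
  linked⇒no11 (0F ∷ v)      h = linked⇒no11 v (Linked.tail h)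
  linked⇒no11 (1F ∷ [])     _ = refl
  linked⇒no11 (1F ∷ 0F ∷ v) h = linked⇒no11 v (Linked.tail (Linked.tail h))
  linked⇒no11 (1F ∷ 1F ∷ v) (¬11 ∷ _) = contradiction (refl , refl) ¬11

  no11⇒linked : ∀ v → no11 v ≡ true → Linked NotBothOne v
  no11⇒linked []            _ = []
  no11⇒linked (0F ∷ v)      h = zero-∷ v (no11⇒linked v h)
  no11⇒linked (1F ∷ [])     _ = [-]
  no11⇒linked (1F ∷ 0F ∷ v) h = (λ ()) ∷ zero-∷ v (no11⇒linked v h)
  no11⇒linked (1F ∷ 1F ∷ v) ()

  ∈rep≡ : ∀ v → does (v ∈rep[ℕ]?) ≡ leading1 v ∧ no11 v
  ∈rep≡ v = does-≡ (v ∈rep[ℕ]?) (λ (n , e) → normal⇒ v (subst IsNormal e (rep-normal n)))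
    (λ h → value v , rep-unique v (⇒normal v h))
    where
    normal⇒ : ∀ v → IsNormal v → leading1 v ∧ no11 v ≡ true
    normal⇒ []       _       = refl
    normal⇒ (1F ∷ v) (_ , l) = linked⇒no11 (1F ∷ v) l
    ⇒normal : ∀ v → leading1 v ∧ no11 v ≡ true → IsNormal v
    ⇒normal []       _ = tt , []
    ⇒normal (1F ∷ v) h = refl , no11⇒linked (1F ∷ v) h

  -- The extra 1 in `x u` is the empty word, which belongs to rep(ℕ); words with a leading 0
  -- contribute nothing.
  sF≡ : ∀ n u → rep n ≡ 1F ∷ u → sF n ≡ x u
  sF≡ n u e rewrite e = begin
    _  ≡⟨ length-filter _ {f} (λ v → cong₂ _∧_ (∈rep≡ v) (does-≡ (0 <? binom (1F ∷ u) v) (binom⇒subword (1F ∷ u) v) (subword⇒binom (1F ∷ u) v)))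
                                            (concatMap wordsOfLength (upTo (2 + length u))) ⟩
    countBelow f (2 + length u)  ≡⟨ countBelow-suc f (suc (length u)) ⟩
    suc (countBelow (f ∘ (0F ∷_)) (suc (length u)) + countBelow (after1 u) (suc (length u)))
      ≡⟨ cong (λ n → suc (n + countBelow (after1 u) (suc (length u)))) (countBelow-false (λ _ → refl) (suc (length u))) ⟩
    suc (countBelow (after1 u) (suc (length u)))  ≡⟨ after1-count u (suc (length u)) ≤-refl ⟩
    x u  ∎
    where
    open ≡-Reasoning
    f : Word → Bool
    f v = (leading1 v ∧ no11 v) ∧ subword (1F ∷ u) v

  -- Partial sums over Zeckendorf words and the sequence B

  Σ< : (ℕ → ℕ) → ℕ → ℕ
  Σ< f zero    = 0
  Σ< f (suc m) = Σ< f m + f m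

  sum-upTo : ∀ f m → sum (map f (upTo m)) ≡ Σ< f m
  sum-upTo f zero    = refl
  sum-upTo f (suc m) = begin
    sum (map f (upTo (suc m)))  ≡⟨ cong (sum ∘ map f) (List.upTo-∷ʳ m) ⟨
    sum (map f (upTo m ∷ʳ m))  ≡⟨ cong sum (List.map-++ f (upTo m) (m ∷ [])) ⟩
    sum (map f (upTo m) ++ f m ∷ [])  ≡⟨ sum-++ (map f (upTo m)) (f m ∷ []) ⟩
    sum (map f (upTo m)) + (f m + 0)  ≡⟨ cong₂ _+_ (sum-upTo f m) (+-identityʳ (f m)) ⟩
    Σ< f m + f m  ∎
    where open ≡-Reasoning

  Σ<-cong : ∀ {f g} m → (∀ n → n < m → f n ≡ g n) → Σ< f m ≡ Σ< g m
  Σ<-cong zero    e = refl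
  Σ<-cong (suc m) e = cong₂ _+_ (Σ<-cong m (λ n n<m → e n (<-trans n<m (n<1+n m)))) (e m (n<1+n m))

  Σ<-+ : ∀ f g m → Σ< (λ n → f n + g n) m ≡ Σ< f m + Σ< g m
  Σ<-+ f g zero    = refl
  Σ<-+ f g (suc m) = trans (cong (_+ (f m + g m)) (Σ<-+ f g m))
    (solve 4 (λ a b c d → (a :+ b) :+ (c :+ d) := (a :+ c) :+ (b :+ d)) refl (Σ< f m) (Σ< g m) (f m) (g m))
    where open ℕSolver.+-*-Solver

  Σ<-split : ∀ f a m → Σ< f (a + m) ≡ Σ< f a + Σ< (λ n → f (a + n)) m
  Σ<-split f a zero    = trans (cong (Σ< f) (+-identityʳ a)) (sym (+-identityʳ _))
  Σ<-split f a (suc m) = trans (cong (Σ< f) (+-suc a m)) (trans (cong (_+ f (a + m)) (Σ<-split f a m)) (+-assoc (Σ< f a) _ _))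

  greedy-0 : ∀ k n → n < F k → greedy (suc k) n ≡ 0F ∷ greedy k n
  greedy-0 k n n<F with F k ≤? n
  ... | yes F≤n = contradiction n<F (≤⇒≯ F≤n)
  ... | no  _   = refl

  greedy-1 : ∀ k n → greedy (suc k) (F k + n) ≡ 1F ∷ greedy k n
  greedy-1 k n with F k ≤? F k + n
  ... | yes _  = cong (λ m → 1F ∷ greedy k m) (m+n∸m≡n (F k) n)
  ... | no F≰  = contradiction (m≤m+n (F k) n) F≰

  -- For n below F k, `greedy k n` runs through the words of length k without 11 in lexicographic
  -- order. At m = `value r` the pair is the vector V r of the overview, and `Sx-0`, `Sy-0`, `Sx-1`,
  -- `Sy-1` are its recursion.
  Sx Sy : ℕ → ℕ → ℕ
  Sx k = Σ< (λ n → x (greedy k n))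
  Sy k = Σ< (λ n → y (greedy k n))

  Sx-0 : ∀ k m → m ≤ F k → Sx (suc k) m ≡ Sx k m + Sy k m
  Sx-0 k m m≤F = trans (Σ<-cong m (λ n n<m → cong x (greedy-0 k n (<-≤-trans n<m m≤F)))) (Σ<-+ (λ n → x (greedy k n)) (λ n → y (greedy k n)) m)

  Sy-0 : ∀ k m → m ≤ F k → Sy (suc k) m ≡ Sy k m
  Sy-0 k m m≤F = Σ<-cong m (λ n n<m → cong y (greedy-0 k n (<-≤-trans n<m m≤F)))

  Sx-1 : ∀ k m → Sx (suc k) (F k + m) ≡ Sx k (F k) + Sy k (F k) + Sx k m
  Sx-1 k m = trans (Σ<-split _ (F k) m) (cong₂ _+_ (Sx-0 k (F k) ≤-refl) (Σ<-cong m (λ n _ → cong x (greedy-1 k n))))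

  Sy-1 : ∀ k m → Sy (suc k) (F k + m) ≡ Sy k (F k) + Sx k m
  Sy-1 k m = trans (Σ<-split _ (F k) m) (cong₂ _+_ (Sy-0 k (F k) ≤-refl) (Σ<-cong m (λ n _ → cong y (greedy-1 k n))))

  X Y : ℕ → ℕ
  X k = Sx k (F k)
  Y k = Sy k (F k)

  X-rec : ∀ k → X (2 + k) ≡ X (1 + k) + Y (1 + k) + (X k + Y k)
  X-rec k = trans (Sx-1 (suc k) (F k)) (cong (X (1 + k) + Y (1 + k) +_) (Sx-0 k (F k) ≤-refl))

  Y-rec : ∀ k → Y (2 + k) ≡ Y (1 + k) + (X k + Y k)
  Y-rec k = trans (Sy-1 (suc k) (F k)) (cong (Y (1 + k) +_) (Sx-0 k (F k) ≤-refl))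

  -- The second equation eliminates `X` from the two-dimensional system and so carries the
  -- induction: applied at k and k + 1 it turns the third-order recurrence of `B` into `X-rec` and
  -- `Y-rec`.
  Y≡B : ∀ k → pos (Y k) ≡ B k × B (2 + k) ≡ B (1 + k) ℤ.+ pos (X k + Y k)
  Y≡B zero          = refl , refl
  Y≡B (suc zero)    = refl , refl
  Y≡B (suc (suc k)) =
    let (Yk≡ , B₂≡) = Y≡B k
        (Yk₁≡ , B₃≡) = Y≡B (suc k)
        Y₂≡ = begin
          pos (Y (2 + k))  ≡⟨ cong pos (Y-rec k) ⟩
          pos (Y (1 + k) + (X k + Y k))  ≡⟨ cong (ℤ._+ pos (X k + Y k)) Yk₁≡ ⟩
          B (1 + k) ℤ.+ pos (X k + Y k)  ≡⟨ B₂≡ ⟨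
          B (2 + k)  ∎
    in Y₂≡ , (begin
      pos 2 ℤ.* B (3 + k) ℤ.+ B (2 + k) ℤ.- B (1 + k)
        ≡⟨ cong₂ (λ a b → pos 2 ℤ.* a ℤ.+ b ℤ.- B (1 + k)) B₃≡ B₂≡ ⟩
      pos 2 ℤ.* (B (2 + k) ℤ.+ Z₁) ℤ.+ (B (1 + k) ℤ.+ Z₀) ℤ.- B (1 + k)
        ≡⟨ solve 4 (λ b c z w → con (pos 2) :* (b :+ z) :+ (c :+ w) :- c := (b :+ z) :+ ((z :+ w) :+ b)) refl (B (2 + k)) (B (1 + k)) Z₁ Z₀ ⟩
      (B (2 + k) ℤ.+ Z₁) ℤ.+ ((Z₁ ℤ.+ Z₀) ℤ.+ B (2 + k))
        ≡⟨ cong₂ ℤ._+_ B₃≡ (cong₂ ℤ._+_ (cong pos (X-rec k)) Y₂≡) ⟨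
      B (3 + k) ℤ.+ pos (X (2 + k) + Y (2 + k)) ∎)
    where
    open ≡-Reasoning
    open ℤSolver.+-*-Solver
    Z₀ Z₁ : ℤ
    Z₀ = pos (X k + Y k)
    Z₁ = pos (X (1 + k) + Y (1 + k))

  rep-from : ∀ k m → m < F k → rep (F (suc k) + m) ≡ 1F ∷ greedy (suc k) m
  rep-from k m m<F = subst (λ n → rep n ≡ w) value≡ (rep-unique w (refl , one-∷ (suc k) m m+F<F (linked-greedy (suc k) m m<F′)))
    where
    w = 1F ∷ greedy (suc k) m
    m<F′ : m < F (suc k)
    m<F′ = <-≤-trans m<F (F-mono k)
    m+F<F : m + F (suc k) < F (2 + k)
    m+F<F = subst (m + F (suc k) <_) (+-comm (F k) (F (suc k))) (+-monoˡ-< (F (suc k)) m<F)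
    value≡ : value w ≡ F (suc k) + m
    value≡ = cong₂ _+_ (trans (*-identityˡ _) (cong F (length-greedy (suc k) m))) (value-greedy (suc k) m m<F′)

  sF-from : ∀ k m → m < F k → sF (F (suc k) + m) ≡ x (greedy (suc k) m)
  sF-from k m m<F = sF≡ (F (suc k) + m) (greedy (suc k) m) (rep-from k m m<F)

  ΣsF-from : ∀ k m → m ≤ F k → Σ< sF (F (suc k) + m) ≡ Σ< sF (F (suc k)) + (Sx k m + Sy k m)
  ΣsF-from k m m≤F = trans (Σ<-split sF (F (suc k)) m) (cong (Σ< sF (F (suc k)) +_)
    (trans (Σ<-cong m (λ n n<m → sF-from k n (<-≤-trans n<m m≤F))) (Sx-0 k m m≤F)))

  -- The block from F (k + 1) up to F (k + 2) contributes `X k + Y k`, which by `Y≡B` is the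
  -- increment of `B`.
  ΣsF≡B : ∀ k → pos (Σ< sF (F (suc k))) ≡ B (suc k)
  ΣsF≡B zero    = refl
  ΣsF≡B (suc k) = trans (cong pos (ΣsF-from k (F k) ≤-refl))
    (trans (cong (ℤ._+ pos (X k + Y k)) (ΣsF≡B k)) (sym (proj₂ (Y≡B k))))

  -- Either matrix at most doubles the sum of the entries. This disposes of the last term `sF n`:
  -- the block decomposition sums below n, the theorem up to n.
  x+y≤ : ∀ w → x w + y w ≤ 3 * 2 ^ length w
  x+y≤ []       = ≤-refl
  x+y≤ (0F ∷ w) = ≤-trans (≤-trans (m≤m+n _ (x w)) (≤-reflexive (solve 2 (λ a b → a :+ b :+ b :+ a := con 2 :* (a :+ b)) refl (x w) (y w))))
    (≤-trans (*-monoʳ-≤ 2 (x+y≤ w)) (≤-reflexive (solve 1 (λ p → con 2 :* (con 3 :* p) := con 3 :* (con 2 :* p)) refl (2 ^ length w))))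
    where open ℕSolver.+-*-Solver
  x+y≤ (1F ∷ w) = ≤-trans (≤-trans (m≤m+n _ (y w + y w)) (≤-reflexive (solve 2 (λ a b → a :+ a :+ (b :+ b) := con 2 :* (a :+ b)) refl (x w) (y w))))
    (≤-trans (*-monoʳ-≤ 2 (x+y≤ w)) (≤-reflexive (solve 1 (λ p → con 2 :* (con 3 :* p) := con 3 :* (con 2 :* p)) refl (2 ^ length w))))
    where open ℕSolver.+-*-Solver

  rep-10 : ∀ n → 3 ≤ n → ∃[ r ] rep n ≡ 1F ∷ 0F ∷ r
  rep-10 n 3≤n = go (rep n) (rep-normal n) (subst (3 ≤_) (sym (value-rep n)) 3≤n) refl
    where
    go : ∀ w → IsNormal w → 3 ≤ value w → rep n ≡ w → ∃[ r ] rep n ≡ 1F ∷ 0F ∷ r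
    go []            _ ()
    go (0F ∷ w)      (() , _)
    go (1F ∷ [])     _ (s≤s ())
    go (1F ∷ 0F ∷ r) _ _ e = r , e
    go (1F ∷ 1F ∷ r) (_ , ¬11 ∷ _) = contradiction (refl , refl) ¬11

  value-10 : ∀ n r → rep n ≡ 1F ∷ 0F ∷ r → n ≡ F (suc (length r)) + value r
  value-10 n r e = trans (sym (value-rep n)) (trans (cong value e) (cong (_+ value r) (*-identityˡ (F (suc (length r))))))

  linked-10 : ∀ n r → rep n ≡ 1F ∷ 0F ∷ r → Linked NotBothOne r
  linked-10 n r e = Linked.tail (Linked.tail (proj₂ (subst IsNormal e (rep-normal n))))

  summatory : ∀ n r → rep n ≡ 1F ∷ 0F ∷ r → let k = length r in
    ∃[ s ] pos (sum (map sF (upTo (suc n)))) ≡ B (suc k) ℤ.+ pos (Sx k (value r) + Sy k (value r)) ℤ.+ pos s × s ≤ 6 * 2 ^ k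
  summatory n r e = s , total , small
    where
    k = length r
    s = sF n
    r<F : value r < F k
    r<F = tail-value< r (linked-10 n r e)
    total : pos (sum (map sF (upTo (suc n)))) ≡ B (suc k) ℤ.+ pos (Sx k (value r) + Sy k (value r)) ℤ.+ pos s
    total = begin
      pos (sum (map sF (upTo (suc n))))                          ≡⟨ cong pos (sum-upTo sF (suc n)) ⟩
      pos (Σ< sF n) ℤ.+ pos s                                    ≡⟨ cong (λ m → pos (Σ< sF m) ℤ.+ pos s) (value-10 n r e) ⟩
      pos (Σ< sF (F (suc k) + value r)) ℤ.+ pos s                ≡⟨ cong (λ m → pos m ℤ.+ pos s) (ΣsF-from k (value r) (<⇒≤ r<F)) ⟩
      pos (Σ< sF (F (suc k))) ℤ.+ pos (Sx k (value r) + Sy k (value r)) ℤ.+ pos s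
        ≡⟨ cong (λ i → i ℤ.+ pos (Sx k (value r) + Sy k (value r)) ℤ.+ pos s) (ΣsF≡B k) ⟩
      B (suc k) ℤ.+ pos (Sx k (value r) + Sy k (value r)) ℤ.+ pos s ∎
      where open ≡-Reasoning
    small : s ≤ 6 * 2 ^ k
    small = ≤-trans (≤-reflexive (sF≡ n (0F ∷ r) e)) (≤-trans (m≤m+n (x (0F ∷ r)) (y (0F ∷ r))) (≤-trans (x+y≤ (0F ∷ r))
      (≤-reflexive (solve 1 (λ p → con 3 :* (con 2 :* p) := con 6 :* p) refl (2 ^ k)))))
      where open ℕSolver.+-*-Solver

open import Algebra.Bundles using (CommutativeRing)
import Algebra.Solver.Ring as RingSolver
open import Algebra.Solver.Ring.AlmostCommutativeRing using (fromCommutativeRing; _-Raw-AlmostCommutative⟶_)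
open import Algebra.Structures using (IsCommutativeRing)
open import Data.Fin using (toℕ)
open import Data.Fin.Patterns using (0F; 1F)
open import Data.Integer as ℤ using (ℤ; +_; -[1+_])
import Data.Integer.DivMod as ℤ
import Data.Integer.Properties as ℤ
open import Data.List using ([]; _∷_; length; map; sum; upTo)
open import Data.List.Relation.Unary.Linked using (Linked; _∷_)
import Data.List.Relation.Unary.Linked as Linked
open import Data.Maybe using (Maybe; just; nothing)
open import Data.Nat as ℕ using (ℕ; zero; suc; _!)
import Data.Nat.Coprimality as Coprimality
import Data.Nat.ListAction as ℕ
import Data.Nat.Properties as ℕ
open import Data.Product using (Σ-syntax; ∃-syntax; _×_; _,_; proj₁; proj₂)
open import Data.Rational as ℚ using (ℚ; 0ℚ; 1ℚ; ½; mkℚ)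
import Data.Rational.Properties as ℚ
open import Data.Rational.Solver renaming (module +-*-Solver to ℚSolver)
import Data.Rational.Unnormalised as ℚᵘ
import Data.Rational.Unnormalised.Properties as ℚᵘ
open import Function using (_∘_)
open import Level using (0ℓ)
open import Relation.Binary.PropositionalEquality as ≡ using (_≡_)
open import Relation.Binary.Structures using (IsPreorder)
open import Relation.Nullary using (¬_; yes; no; contradiction)
open import Relation.Nullary.Decidable using (True; toWitness)
open import Defs using (Word; F; F-mono; B; value; rep; rep-normal; value-rep; sF; NotBothOne; tail-value<; module Sequences)
open Sequences using (nat; 0≤nat)

-- Rational constants

infixl 7 _∕_

_∕_ : ℕ → (d : ℕ) .{{_ : ℕ.NonZero d}} → ℚ
n ∕ d = + n ℚ./ d

-- The gcd computation inside `ℚ._/_` is stuck on a variable `i`; the explicit `mkℚ` computes, so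
-- the homomorphism laws are proved through it.
fromℤ-mkℚ : ∀ i → i ℚ./ 1 ≡ mkℚ i 0 (Coprimality.sym (Coprimality.1-coprimeTo ℤ.∣ i ∣))
fromℤ-mkℚ i = ℚ.↥p/↧p≡p (mkℚ i 0 (Coprimality.sym (Coprimality.1-coprimeTo ℤ.∣ i ∣)))

fromℤ-+ : ∀ i j → (i ℤ.+ j) ℚ./ 1 ≡ (i ℚ./ 1) ℚ.+ (j ℚ./ 1)
fromℤ-+ i j = ≡.sym (≡.trans (≡.cong₂ ℚ._+_ (fromℤ-mkℚ i) (fromℤ-mkℚ j))
  (≡.cong (ℚ._/ 1) (≡.cong₂ ℤ._+_ (ℤ.*-identityʳ i) (ℤ.*-identityʳ j))))

fromℤ-* : ∀ i j → (i ℤ.* j) ℚ./ 1 ≡ (i ℚ./ 1) ℚ.* (j ℚ./ 1)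
fromℤ-* i j = ≡.sym (≡.cong₂ ℚ._*_ (fromℤ-mkℚ i) (fromℤ-mkℚ j))

fromℤ-neg : ∀ i → (ℤ.- i) ℚ./ 1 ≡ ℚ.- (i ℚ./ 1)
fromℤ-neg i = ≡.trans (fromℤ-mkℚ (ℤ.- i)) (≡.trans (neg i) (≡.sym (≡.cong ℚ.-_ (fromℤ-mkℚ i))))
  where
  neg : ∀ i → mkℚ (ℤ.- i) 0 (Coprimality.sym (Coprimality.1-coprimeTo ℤ.∣ ℤ.- i ∣)) ≡ ℚ.- mkℚ i 0 (Coprimality.sym (Coprimality.1-coprimeTo ℤ.∣ i ∣))
  neg (+ zero)  = ≡.refl
  neg (+ suc n) = ≡.refl
  neg -[1+ n ]  = ≡.refl

fromℕ≡nat : ∀ n → + n ℚ./ 1 ≡ nat n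
fromℕ≡nat zero    = ≡.refl
fromℕ≡nat (suc n) = ≡.trans (fromℤ-+ (+ 1) (+ n)) (≡.cong (1ℚ ℚ.+_) (fromℕ≡nat n))

fromℤ-mono-≤ : ∀ {i j} → i ℤ.≤ j → i ℚ./ 1 ℚ.≤ j ℚ./ 1
fromℤ-mono-≤ {i} {j} i≤j = ≡.subst₂ ℚ._≤_ (≡.sym (fromℤ-mkℚ i)) (≡.sym (fromℤ-mkℚ j))
  (ℚ.*≤* (≡.subst₂ ℤ._≤_ (≡.sym (ℤ.*-identityʳ i)) (≡.sym (ℤ.*-identityʳ j)) i≤j))

1/ℕ : (m : ℕ) .{{_ : ℕ.NonZero m}} → ℚ
1/ℕ m = + 1 ℚ./ m

m*1/m : ∀ m .{{_ : ℕ.NonZero m}} → (+ m ℚ./ 1) ℚ.* 1/ℕ m ≡ 1ℚ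
m*1/m (suc m) = ℚ.toℚᵘ-injective (ℚᵘ.≃-trans (ℚ.toℚᵘ-homo-* (+ suc m ℚ./ 1) (+ 1 ℚ./ suc m))
  (ℚᵘ.≃-trans (ℚᵘ.*-cong (ℚ.toℚᵘ-fromℚᵘ (ℚᵘ.mkℚᵘ (+ suc m) 0)) (ℚ.toℚᵘ-fromℚᵘ (ℚᵘ.mkℚᵘ (+ 1) m)))
    (ℚᵘ.*≡* (≡.trans (ℤ.*-identityʳ _) (≡.trans (ℤ.*-identityʳ (+ suc m)) (≡.trans (≡.cong +_ (≡.sym (ℕ.+-identityʳ (suc m)))) (≡.sym (ℤ.*-identityˡ _))))))))

inverse-unique : ∀ a {b c} → a ℚ.* b ≡ 1ℚ → a ℚ.* c ≡ 1ℚ → b ≡ c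
inverse-unique a {b} {c} ab≡1 ac≡1 = begin
  b  ≡⟨ ℚ.*-identityʳ b ⟨
  b ℚ.* 1ℚ  ≡⟨ ≡.cong (b ℚ.*_) ac≡1 ⟨
  b ℚ.* (a ℚ.* c)  ≡⟨ ℚSolver.solve 3 (λ a b c → b ℚSolver.:* (a ℚSolver.:* c) ℚSolver.:= (a ℚSolver.:* b) ℚSolver.:* c) ≡.refl a b c ⟩
  (a ℚ.* b) ℚ.* c  ≡⟨ ≡.cong (ℚ._* c) ab≡1 ⟩
  1ℚ ℚ.* c  ≡⟨ ℚ.*-identityˡ c ⟩
  c  ∎
  where
  open ≡.≡-Reasoning

-- A complete Archimedean ordered ring containing ℚ.  The analysis is carried out over such a
-- structure, whose operations do not compute, and is instantiated to Cauchy sequences only at the end.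
record RealField : Set₁ where
  infix  4 _≈_ _≤_ _<_
  infixl 6 _+_
  infixl 7 _*_
  infix  8 -_
  field
    R           : Set
    _≈_ _≤_ _<_ : R → R → Set
    _+_ _*_     : R → R → R
    -_ ∣_∣      : R → R
    ι           : ℚ → R
    isCommutativeRing : IsCommutativeRing _≈_ _+_ _*_ -_ (ι 0ℚ) (ι 1ℚ)
    ι-+         : ∀ p q → ι (p ℚ.+ q) ≈ ι p + ι q
    ι-*         : ∀ p q → ι (p ℚ.* q) ≈ ι p * ι q
    ι-neg       : ∀ p → ι (ℚ.- p) ≈ - ι p
    ι-≤         : ∀ {p q} → p ℚ.≤ q → ι p ≤ ι q
    ι-<         : ∀ {p q} → p ℚ.< q → ι p < ι q
    ≤-reflexive : ∀ {x y} → x ≈ y → x ≤ y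
    ≤-trans     : ∀ {x y z} → x ≤ y → y ≤ z → x ≤ z
    ≤-antisym   : ∀ {x y} → x ≤ y → y ≤ x → x ≈ y
    <⇒≤         : ∀ {x y} → x < y → x ≤ y
    <-≤-trans   : ∀ {x y z} → x < y → y ≤ z → x < z
    ≤-<-trans   : ∀ {x y z} → x ≤ y → y < z → x < z
    <-irrefl    : ∀ {x} → ¬ x < x
    -- The only classical-looking principle: weak inequalities may be proved by contradiction.
    ≮⇒≥         : ∀ {x y} → ¬ x < y → y ≤ x
    +-monoʳ-≤   : ∀ z {x y} → x ≤ y → z + x ≤ z + y
    +-monoʳ-<   : ∀ z {x y} → x < y → z + x < z + y
    *-nonNeg    : ∀ {x y} → ι 0ℚ ≤ x → ι 0ℚ ≤ y → ι 0ℚ ≤ x * y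
    *-pos       : ∀ {x y} → ι 0ℚ < x → ι 0ℚ < y → ι 0ℚ < x * y
    x≤∣x∣       : ∀ x → x ≤ ∣ x ∣
    -x≤∣x∣      : ∀ x → - x ≤ ∣ x ∣
    ∣∣-lub      : ∀ {x y} → x ≤ y → - x ≤ y → ∣ x ∣ ≤ y
    archimedean : ∀ x {ε} → ι 0ℚ < ε → ∃[ n ] x ≤ ι (nat n) * ε
    -- A substitute for the floor. The admissible intervals have length 3/2 and overlap, so that a
    -- sufficiently good approximation of `x` determines a choice.
    nearby-integer : ∀ x → ∃[ m ] ι (m ℚ./ 1) + ι (1 ∕ 4) ≤ x × x ≤ ι (m ℚ./ 1) + ι (7 ∕ 4)
    complete    : (u : ℕ → R) →
      (∀ ε → ι 0ℚ < ε → ∃[ N ] ∀ m n → N ℕ.≤ m → N ℕ.≤ n → ∣ u m + - u n ∣ ≤ ε) →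
      Σ[ ℓ ∈ R ] ∀ ε → ι 0ℚ < ε → ∃[ N ] ∀ n → N ℕ.≤ n → ∣ u n + - ℓ ∣ ≤ ε

module Basics (𝓡 : RealField) where
  open RealField 𝓡 public
  open IsCommutativeRing isCommutativeRing public
    using (isEquivalence; +-cong; *-cong; -‿cong; refl; sym; trans; setoid)

  infixl 6 _-_

  0# 1# 2# : R
  0# = ι 0ℚ
  1# = ι 1ℚ
  2# = ι (2 ∕ 1)

  _-_ : R → R → R
  x - y = x + - y

  commutativeRing : CommutativeRing 0ℓ 0ℓ
  commutativeRing = record { isCommutativeRing = isCommutativeRing }

  coefficients : ℚ.+-*-rawRing -Raw-AlmostCommutative⟶ fromCommutativeRing commutativeRing
  coefficients = record
    { ⟦_⟧ = ι ; +-homo = ι-+ ; *-homo = ι-* ; -‿homo = ι-neg ; 0-homo = refl ; 1-homo = refl }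

  _coeff≟_ : (p q : ℚ) → Maybe (ι p ≈ ι q)
  p coeff≟ q with p ℚ.≟ q
  ... | yes ≡.refl = just refl
  ... | no  _      = nothing

  open RingSolver ℚ.+-*-rawRing (fromCommutativeRing commutativeRing) coefficients _coeff≟_ public
    using (solve; _:=_; _:+_; _:*_; _:-_; :-_; con; Polynomial)

  ≤-isPreorder : IsPreorder _≈_ _≤_
  ≤-isPreorder = record { isEquivalence = isEquivalence ; reflexive = ≤-reflexive ; trans = ≤-trans }

  ≤-refl : ∀ {x} → x ≤ x
  ≤-refl = ≤-reflexive refl

  <-trans : ∀ {x y z} → x < y → y < z → x < z
  <-trans x<y y<z = <-≤-trans x<y (<⇒≤ y<z)

  <-asym : ∀ {x y} → x < y → ¬ y < x
  <-asym x<y y<x = <-irrefl (<-trans x<y y<x)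

  open import Relation.Binary.Reasoning.Base.Triple ≤-isPreorder <-asym <-trans
    ((λ y≈z x<y → <-≤-trans x<y (≤-reflexive y≈z)) , (λ x≈z x<y → ≤-<-trans (≤-reflexive (sym x≈z)) x<y))
    <⇒≤ <-≤-trans ≤-<-trans public

 

-- Order, absolute value, null sequences and limits with explicit rates

module Ordered (𝓡 : RealField) where
  open Basics 𝓡 public

  infixr 9 _^_

  ι≤ : ∀ p q {_ : True (p ℚ.≤? q)} → ι p ≤ ι q
  ι≤ _ _ {w} = ι-≤ (toWitness w)

  ι< : ∀ p q {_ : True (p ℚ.<? q)} → ι p < ι q
  ι< _ _ {w} = ι-< (toWitness w)

  0≤1 : 0# ≤ 1#
  0≤1 = ι≤ _ _

  ≤-respˡ : ∀ {x y z} → x ≈ y → x ≤ z → y ≤ z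
  ≤-respˡ x≈y = ≤-trans (≤-reflexive (sym x≈y))

  ≤-respʳ : ∀ {x y z} → y ≈ z → x ≤ y → x ≤ z
  ≤-respʳ y≈z x≤y = ≤-trans x≤y (≤-reflexive y≈z)

  -- The two cases are not decided. Assuming b < a refutes x < y by the first branch, hence y ≤ x,
  -- which the second branch refutes.
  ≤-cases : ∀ x y {a b} → (x ≤ y → a ≤ b) → (y ≤ x → a ≤ b) → a ≤ b
  ≤-cases x y f g = ≮⇒≥ λ b<a →
    <-irrefl (<-≤-trans b<a (g (≮⇒≥ λ x<y → <-irrefl (<-≤-trans b<a (f (<⇒≤ x<y))))))

  +-mono-≤ : ∀ {x x′ y y′} → x ≤ x′ → y ≤ y′ → x + y ≤ x′ + y′
  +-mono-≤ {x} {x′} {y} {y′} x≤ y≤ = begin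
    x + y  ≤⟨ +-monoʳ-≤ x y≤ ⟩
    x + y′  ≈⟨ solve 2 (λ a b → a :+ b := b :+ a) refl x y′ ⟩
    y′ + x  ≤⟨ +-monoʳ-≤ y′ x≤ ⟩
    y′ + x′  ≈⟨ solve 2 (λ a b → a :+ b := b :+ a) refl y′ x′ ⟩
    x′ + y′  ∎

  +-nonNeg : ∀ {x y} → 0# ≤ x → 0# ≤ y → 0# ≤ x + y
  +-nonNeg {x} {y} 0≤x 0≤y = ≤-respˡ (solve 0 (con 0ℚ :+ con 0ℚ := con 0ℚ) refl) (+-mono-≤ 0≤x 0≤y)

  -- The standard way of proving an inequality here: exhibit the nonnegative difference and leave an
  -- identity to the ring solver.
  ≤-by : ∀ {x y} e → 0# ≤ e → y ≈ x + e → x ≤ y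
  ≤-by {x} {y} e 0≤e y≈ = begin
    x  ≈⟨ solve 1 (λ x → x := x :+ con 0ℚ) refl x ⟩
    x + 0#  ≤⟨ +-monoʳ-≤ x 0≤e ⟩
    x + e  ≈⟨ y≈ ⟨
    y  ∎

  <-by : ∀ {x y} e → 0# < e → y ≈ x + e → x < y
  <-by {x} {y} e 0<e y≈ = begin-strict
    x  ≈⟨ solve 1 (λ x → x := x :+ con 0ℚ) refl x ⟩
    x + 0#  <⟨ +-monoʳ-< x 0<e ⟩
    x + e  ≈⟨ y≈ ⟨
    y  ∎

  diff-nonNeg : ∀ {x y} → x ≤ y → 0# ≤ y - x
  diff-nonNeg {x} {y} x≤y = begin
    0#  ≈⟨ solve 1 (λ x → con 0ℚ := :- x :+ x) refl x ⟩
    - x + x  ≤⟨ +-monoʳ-≤ (- x) x≤y ⟩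
    - x + y  ≈⟨ solve 2 (λ x y → :- x :+ y := y :- x) refl x y ⟩
    y - x  ∎

  diff-pos : ∀ {x y} → x < y → 0# < y - x
  diff-pos {x} {y} x<y = begin-strict
    0#  ≈⟨ solve 1 (λ x → con 0ℚ := :- x :+ x) refl x ⟩
    - x + x  <⟨ +-monoʳ-< (- x) x<y ⟩
    - x + y  ≈⟨ solve 2 (λ x y → :- x :+ y := y :- x) refl x y ⟩
    y - x  ∎

  diff-≤ : ∀ {x y} → 0# ≤ y - x → x ≤ y
  diff-≤ {x} {y} h = ≤-by (y - x) h (solve 2 (λ x y → y := x :+ (y :- x)) refl x y)

  neg-mono-≤ : ∀ {x y} → x ≤ y → - y ≤ - x
  neg-mono-≤ {x} {y} x≤y = ≤-by (y - x) (diff-nonNeg x≤y) (solve 2 (λ x y → :- x := :- y :+ (y :- x)) refl x y)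

  *-monoʳ-≤ : ∀ {z x y} → 0# ≤ z → x ≤ y → z * x ≤ z * y
  *-monoʳ-≤ {z} {x} {y} 0≤z x≤y = ≤-by (z * (y - x)) (*-nonNeg 0≤z (diff-nonNeg x≤y))
    (solve 3 (λ x y z → z :* y := z :* x :+ z :* (y :- x)) refl x y z)

  *-monoˡ-≤ : ∀ {z x y} → 0# ≤ z → x ≤ y → x * z ≤ y * z
  *-monoˡ-≤ {z} {x} {y} 0≤z x≤y = ≤-by ((y - x) * z) (*-nonNeg (diff-nonNeg x≤y) 0≤z)
    (solve 3 (λ x y z → y :* z := x :* z :+ (y :- x) :* z) refl x y z)

  *-monoʳ-< : ∀ {z x y} → 0# < z → x < y → z * x < z * y
  *-monoʳ-< {z} {x} {y} 0<z x<y = <-by (z * (y - x)) (*-pos 0<z (diff-pos x<y))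
    (solve 3 (λ x y z → z :* y := z :* x :+ z :* (y :- x)) refl x y z)

  *-mono-≤ : ∀ {x x′ y y′} → 0# ≤ x → 0# ≤ y′ → x ≤ x′ → y ≤ y′ → x * y ≤ x′ * y′
  *-mono-≤ 0≤x 0≤y′ x≤ y≤ = ≤-trans (*-monoʳ-≤ 0≤x y≤) (*-monoˡ-≤ 0≤y′ x≤)

  half-nonNeg : ∀ {x} → 0# ≤ x + x → 0# ≤ x
  half-nonNeg {x} h = ≤-respʳ (solve 1 (λ x → con ½ :* (x :+ x) := x) refl x) (*-nonNeg (ι≤ 0ℚ ½) h)

  square-nonNeg : ∀ x → 0# ≤ x * x
  square-nonNeg x = ≤-cases 0# x (λ h → *-nonNeg h h)
    (λ h → let 0≤-x = ≤-respˡ (solve 0 (:- con 0ℚ := con 0ℚ) refl) (neg-mono-≤ h) in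
      ≤-respʳ (solve 1 (λ x → :- x :* :- x := x :* x) refl x) (*-nonNeg 0≤-x 0≤-x))

  0≤∣∣ : ∀ x → 0# ≤ ∣ x ∣
  0≤∣∣ x = half-nonNeg (≤-respˡ (solve 1 (λ x → x :+ :- x := con 0ℚ) refl x) (+-mono-≤ (x≤∣x∣ x) (-x≤∣x∣ x)))

  ∣∣-nonNeg : ∀ {x} → 0# ≤ x → ∣ x ∣ ≈ x
  ∣∣-nonNeg {x} 0≤x = ≤-antisym (∣∣-lub ≤-refl (≤-trans (≤-by x 0≤x (solve 1 (λ x → con 0ℚ := :- x :+ x) refl x)) 0≤x)) (x≤∣x∣ x)

  ∣∣-mono : ∀ {x y} → x ≈ y → ∣ x ∣ ≤ ∣ y ∣
  ∣∣-mono {x} {y} x≈y = ∣∣-lub (≤-respˡ (sym x≈y) (x≤∣x∣ y)) (≤-respˡ (-‿cong (sym x≈y)) (-x≤∣x∣ y))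

  ∣∣-cong : ∀ {x y} → x ≈ y → ∣ x ∣ ≈ ∣ y ∣
  ∣∣-cong x≈y = ≤-antisym (∣∣-mono x≈y) (∣∣-mono (sym x≈y))

  ∣∣≤⇒≤ : ∀ {x e} → ∣ x ∣ ≤ e → x ≤ e
  ∣∣≤⇒≤ {x} = ≤-trans (x≤∣x∣ x)

  ∣∣≤⇒-≤ : ∀ {x e} → ∣ x ∣ ≤ e → - x ≤ e
  ∣∣≤⇒-≤ {x} = ≤-trans (-x≤∣x∣ x)

  ∣-x∣≤ : ∀ x → ∣ - x ∣ ≤ ∣ x ∣
  ∣-x∣≤ x = ∣∣-lub (-x≤∣x∣ x) (≤-respˡ (solve 1 (λ x → x := :- :- x) refl x) (x≤∣x∣ x))

  ∣∣-swap : ∀ x y {e} → ∣ x - y ∣ ≤ e → ∣ y - x ∣ ≤ e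
  ∣∣-swap x y h = ≤-trans (≤-trans (∣∣-mono (solve 2 (λ x y → y :- x := :- (x :- y)) refl x y)) (∣-x∣≤ (x - y))) h

  ∣+∣≤ : ∀ {x y a b} → ∣ x ∣ ≤ a → ∣ y ∣ ≤ b → ∣ x + y ∣ ≤ a + b
  ∣+∣≤ {x} {y} x≤ y≤ = ∣∣-lub (+-mono-≤ (∣∣≤⇒≤ x≤) (∣∣≤⇒≤ y≤))
    (≤-respˡ (solve 2 (λ x y → :- x :+ :- y := :- (x :+ y)) refl x y) (+-mono-≤ (∣∣≤⇒-≤ x≤) (∣∣≤⇒-≤ y≤)))

  ∣-∣≤ : ∀ {x y a b} → ∣ x ∣ ≤ a → ∣ y ∣ ≤ b → ∣ x - y ∣ ≤ a + b
  ∣-∣≤ {x} {y} x≤ y≤ = ∣+∣≤ x≤ (≤-trans (∣-x∣≤ y) y≤)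

  -- 2 (∣x∣ ∣y∣ ∓ x y) is a sum of two products of nonnegative factors.
  ∣*∣≤ : ∀ {x y a b} → ∣ x ∣ ≤ a → ∣ y ∣ ≤ b → ∣ x * y ∣ ≤ a * b
  ∣*∣≤ {x} {y} {a} {b} x≤ y≤ = ≤-trans (∣∣-lub
      (diff-≤ (half-nonNeg (≤-respʳ
        (solve 4 (λ x y p q → (p :- x) :* (q :+ y) :+ (p :+ x) :* (q :- y) := (p :* q :- x :* y) :+ (p :* q :- x :* y)) refl x y p q)
        (+-nonNeg (*-nonNeg (diff-nonNeg (x≤∣x∣ x)) (plus (-x≤∣x∣ y))) (*-nonNeg (plus (-x≤∣x∣ x)) (diff-nonNeg (x≤∣x∣ y)))))))
      (diff-≤ (half-nonNeg (≤-respʳ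
        (solve 4 (λ x y p q → (p :- x) :* (q :- y) :+ (p :+ x) :* (q :+ y) := (p :* q :- :- (x :* y)) :+ (p :* q :- :- (x :* y))) refl x y p q)
        (+-nonNeg (*-nonNeg (diff-nonNeg (x≤∣x∣ x)) (diff-nonNeg (x≤∣x∣ y))) (*-nonNeg (plus (-x≤∣x∣ x)) (plus (-x≤∣x∣ y))))))))
    (*-mono-≤ (0≤∣∣ x) (≤-trans (0≤∣∣ y) y≤) x≤ y≤)
    where
    p = ∣ x ∣
    q = ∣ y ∣
    plus : ∀ {x p} → - x ≤ p → 0# ≤ p + x
    plus {x} {p} h = ≤-respʳ (solve 2 (λ x p → p :- :- x := p :+ x) refl x p) (diff-nonNeg h)

  ∣c*∣≤ : ∀ {c x a} → 0# ≤ c → ∣ x ∣ ≤ a → ∣ c * x ∣ ≤ c * a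
  ∣c*∣≤ 0≤c = ∣*∣≤ (≤-reflexive (∣∣-nonNeg 0≤c))

  ∣∣≤-resp : ∀ {x y e} → x ≈ y → ∣ x ∣ ≤ e → ∣ y ∣ ≤ e
  ∣∣≤-resp x≈y = ≤-trans (∣∣-mono (sym x≈y))

  ∣∣-chain : ∀ x y z {a b} → ∣ x - y ∣ ≤ a → ∣ y - z ∣ ≤ b → ∣ x - z ∣ ≤ a + b
  ∣∣-chain x y z h k = ∣∣≤-resp (solve 3 (λ x y z → (x :- y) :+ (y :- z) := x :- z) refl x y z) (∣+∣≤ h k)

  ∣x-y∣≤⇒ : ∀ {x y e} → ∣ x - y ∣ ≤ e → x ≤ y + e
  ∣x-y∣≤⇒ {x} {y} {e} h = begin
    x  ≈⟨ solve 2 (λ x y → x := y :+ (x :- y)) refl x y ⟩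
    y + (x - y)  ≤⟨ +-monoʳ-≤ y (∣∣≤⇒≤ h) ⟩
    y + e  ∎

  ∣x-x∣≤0 : ∀ x → ∣ x - x ∣ ≤ 0#
  ∣x-x∣≤0 x = ∣∣≤-resp (solve 1 (λ x → con 0ℚ := x :- x) refl x) (≤-reflexive (∣∣-nonNeg ≤-refl))

  ≈⇒∣-∣≤0 : ∀ {x y} → x ≈ y → ∣ x - y ∣ ≤ 0#
  ≈⇒∣-∣≤0 {x} {y} x≈y = ∣∣≤-resp (+-cong refl (-‿cong x≈y)) (∣x-x∣≤0 x)

  _^_ : R → ℕ → R
  x ^ zero  = 1#
  x ^ suc n = x * x ^ n

  ^-nonNeg : ∀ {x} → 0# ≤ x → ∀ n → 0# ≤ x ^ n
  ^-nonNeg 0≤x zero    = 0≤1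
  ^-nonNeg 0≤x (suc n) = *-nonNeg 0≤x (^-nonNeg 0≤x n)

  ^-mono-≤ : ∀ {x y} → 0# ≤ x → x ≤ y → ∀ n → x ^ n ≤ y ^ n
  ^-mono-≤ 0≤x x≤y zero    = ≤-refl
  ^-mono-≤ 0≤x x≤y (suc n) = *-mono-≤ 0≤x (^-nonNeg (≤-trans 0≤x x≤y) n) x≤y (^-mono-≤ 0≤x x≤y n)

  ^-distrib-* : ∀ x y n → (x * y) ^ n ≈ x ^ n * y ^ n
  ^-distrib-* x y zero    = solve 0 (con 1ℚ := con 1ℚ :* con 1ℚ) refl
  ^-distrib-* x y (suc n) = trans (*-cong refl (^-distrib-* x y n))
    (solve 4 (λ x y a b → (x :* y) :* (a :* b) := (x :* a) :* (y :* b)) refl x y (x ^ n) (y ^ n))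

  natR : ℕ → R
  natR n = ι (nat n)

  natR-suc : ∀ n → natR (suc n) ≈ 1# + natR n
  natR-suc n = ι-+ 1ℚ (nat n)

  0≤natR : ∀ n → 0# ≤ natR n
  0≤natR n = ι-≤ (0≤nat n)

  nat-mono : ∀ {m n} → m ℕ.≤ n → nat m ℚ.≤ nat n
  nat-mono {n = n} ℕ.z≤n = 0≤nat n
  nat-mono (ℕ.s≤s h)     = ℚ.+-monoʳ-≤ 1ℚ (nat-mono h)

  unit : ℕ → ℚ
  unit n = (ℚ.1/ nat (suc n)) {{ℚ.pos⇒nonZero (nat (suc n)) {{ℚ.positive (ℚ.+-mono-<-≤ (ℚ.positive⁻¹ 1ℚ) (0≤nat n))}}}}

  0<nat-suc : ∀ n → 0ℚ ℚ.< nat (suc n)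
  0<nat-suc n = ℚ.+-mono-<-≤ (ℚ.positive⁻¹ 1ℚ) (0≤nat n)

  nat*unit : ∀ n → nat (suc n) ℚ.* unit n ≡ 1ℚ
  nat*unit n = ℚ.*-inverseʳ (nat (suc n)) {{ℚ.pos⇒nonZero (nat (suc n)) {{ℚ.positive (0<nat-suc n)}}}}

  0<unit : ∀ n → 0ℚ ℚ.< unit n
  0<unit n = ℚ.positive⁻¹ (unit n) {{ℚ.1/pos⇒pos (nat (suc n)) {{ℚ.positive (0<nat-suc n)}}}}

  unitR : ℕ → R
  unitR n = ι (unit n)

  natR*unitR : ∀ n → natR (suc n) * unitR n ≈ 1#
  natR*unitR n = trans (sym (ι-* (nat (suc n)) (unit n))) (≡.subst (λ q → ι (nat (suc n) ℚ.* unit n) ≈ ι q) (nat*unit n) refl)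

  0≤unitR : ∀ n → 0# ≤ unitR n
  0≤unitR n = ι-≤ (ℚ.<⇒≤ (0<unit n))

  -- Stands in for δ = ε / K when the sign of `K` and its distance from 0 are unknown: δ = 1 / (n +
  -- 1) with K ≤ n ε.
  small-factor : ∀ K {ε} → 0# < ε → Σ[ δ ∈ R ] 0# < δ × K * δ ≤ ε
  small-factor K {ε} 0<ε with archimedean K 0<ε
  ... | n , K≤ = δ , ι-< (0<unit n) , (begin
    K * δ  ≤⟨ *-monoˡ-≤ 0≤δ K≤ ⟩
    natR n * ε * δ  ≤⟨ ≤-by (ε * δ) (*-nonNeg (<⇒≤ 0<ε) 0≤δ) (solve 3 (λ n e d → (con 1ℚ :+ n) :* d :* e := n :* e :* d :+ e :* d) refl (natR n) ε δ) ⟩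
    (1# + natR n) * δ * ε ≈⟨ *-cong (*-cong (natR-suc n) refl) refl ⟨
    natR (suc n) * δ * ε  ≈⟨ *-cong (natR*unitR n) refl ⟩
    1# * ε  ≈⟨ solve 1 (λ e → con 1ℚ :* e := e) refl ε ⟩
    ε  ∎)
    where
    δ = unitR n
    0≤δ = 0≤unitR n

  half : ∀ {ε} → 0# < ε → 0# < ι ½ * ε
  half 0<ε = *-pos (ι< 0ℚ ½) 0<ε

  half+half : ∀ ε → ι ½ * ε + ι ½ * ε ≈ ε
  half+half = solve 1 (λ e → con ½ :* e :+ con ½ :* e := e) refl

  -- One-sided, since such sequences serve as bounds for absolute values.
  Null : (ℕ → R) → Set
  Null w = ∀ ε → 0# < ε → ∃[ N ] ∀ n → N ℕ.≤ n → w n ≤ ε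

  null-scale : ∀ {w} K → 0# ≤ K → Null w → Null (λ n → K * w n)
  null-scale K 0≤K null ε 0<ε =
    let (δ , 0<δ , Kδ≤ε) = small-factor K 0<ε
        (N , h) = null δ 0<δ
    in N , λ n N≤n → ≤-trans (*-monoʳ-≤ 0≤K (h n N≤n)) Kδ≤ε

  null-+ : ∀ {v w} → Null v → Null w → Null (λ n → v n + w n)
  null-+ nv nw ε 0<ε =
    let (M , h) = nv (ι ½ * ε) (half 0<ε)
        (N , k) = nw (ι ½ * ε) (half 0<ε)
    in M ℕ.⊔ N , λ n n≥ → ≤-respʳ (half+half ε)
         (+-mono-≤ (h n (ℕ.m⊔n≤o⇒m≤o M N n≥)) (k n (ℕ.m⊔n≤o⇒n≤o M N n≥)))

  null-mono : ∀ {v w} → (∀ n → v n ≤ w n) → Null w → Null v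
  null-mono v≤w nw ε 0<ε = let (N , h) = nw ε 0<ε in N , λ n N≤n → ≤-trans (v≤w n) (h n N≤n)

  null-suc : ∀ {w} → Null w → Null (λ n → w (suc n))
  null-suc nw ε 0<ε = let (N , h) = nw ε 0<ε in N , λ n N≤n → h (suc n) (ℕ.m≤n⇒m≤1+n N≤n)

  -- Bernoulli's inequality for (1 + t) ^ n, with `q` in the role of 1 / (1 + t).
  bernoulli : ∀ {q t} → 0# ≤ q → 0# ≤ t → q * (1# + t) ≤ 1# → ∀ n → q ^ n * (1# + natR n * t) ≤ 1#
  bernoulli {q} {t} 0≤q 0≤t q≤ zero = ≤-reflexive (solve 1 (λ t → con 1ℚ :* (con 1ℚ :+ con 0ℚ :* t) := con 1ℚ) refl t)
  bernoulli {q} {t} 0≤q 0≤t q≤ (suc n) = begin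
    q * q ^ n * (1# + natR (suc n) * t)  ≈⟨ *-cong refl (+-cong refl (*-cong (natR-suc n) refl)) ⟩
    q * q ^ n * (1# + (1# + natR n) * t)  ≤⟨ ≤-by (q * q ^ n * (t * (natR n * t))) (*-nonNeg (^-nonNeg 0≤q (suc n)) (*-nonNeg 0≤t (*-nonNeg (0≤natR n) 0≤t)))
                                                        (solve 4 (λ q p n t → (q :* (con 1ℚ :+ t)) :* (p :* (con 1ℚ :+ n :* t)) := q :* p :* (con 1ℚ :+ (con 1ℚ :+ n) :* t) :+ q :* p :* (t :* (n :* t))) refl q (q ^ n) (natR n) t) ⟩
    (q * (1# + t)) * (q ^ n * (1# + natR n * t))  ≤⟨ *-mono-≤ (*-nonNeg 0≤q (+-nonNeg 0≤1 0≤t)) 0≤1 q≤ (bernoulli 0≤q 0≤t q≤ n) ⟩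
    1# * 1#  ≈⟨ solve 0 (con 1ℚ :* con 1ℚ := con 1ℚ) refl ⟩
    1#  ∎

  null-geometric : ∀ {q t} → 0# ≤ q → 0# < t → q * (1# + t) ≤ 1# → Null (q ^_)
  null-geometric {q} {t} 0≤q 0<t q≤ ε 0<ε with archimedean 1# (*-pos 0<ε 0<t)
  ... | N , 1≤ = N , λ n N≤n → begin
    q ^ n  ≈⟨ solve 1 (λ p → p := p :* con 1ℚ) refl (q ^ n) ⟩
    q ^ n * 1#  ≤⟨ *-monoʳ-≤ (^-nonNeg 0≤q n) 1≤ ⟩
    q ^ n * (natR N * (ε * t))  ≤⟨ *-monoʳ-≤ (^-nonNeg 0≤q n) (*-monoˡ-≤ (<⇒≤ (*-pos 0<ε 0<t)) (ι-≤ (nat-mono N≤n))) ⟩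
    q ^ n * (natR n * (ε * t))  ≤⟨ ≤-by (q ^ n * ε) (*-nonNeg (^-nonNeg 0≤q n) (<⇒≤ 0<ε))
                                       (solve 4 (λ p n e t → e :* (p :* (con 1ℚ :+ n :* t)) := p :* (n :* (e :* t)) :+ p :* e) refl (q ^ n) (natR n) ε t) ⟩
    ε * (q ^ n * (1# + natR n * t)) ≤⟨ *-monoʳ-≤ (<⇒≤ 0<ε) (bernoulli 0≤q (<⇒≤ 0<t) q≤ n) ⟩
    ε * 1#  ≈⟨ solve 1 (λ p → p :* con 1ℚ := p) refl ε ⟩
    ε  ∎

  ≤-limit : ∀ {x y w} M → (∀ n → M ℕ.≤ n → x ≤ y + w n) → Null w → x ≤ y
  ≤-limit {x} {y} {w} M h null = ≮⇒≥ λ y<x →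
    let (N , k) = null (ι ½ * (x - y)) (half (diff-pos y<x))
    in <-irrefl (begin-strict
      x  ≤⟨ h (M ℕ.⊔ N) (ℕ.m≤m⊔n M N) ⟩
      y + w (M ℕ.⊔ N)  ≤⟨ +-monoʳ-≤ y (k (M ℕ.⊔ N) (ℕ.m≤n⊔m M N)) ⟩
      y + ι ½ * (x - y)  <⟨ <-by (ι ½ * (x - y)) (half (diff-pos y<x)) (solve 2 (λ x y → x := y :+ con ½ :* (x :- y) :+ con ½ :* (x :- y)) refl x y) ⟩
      x  ∎)

  ≈-limit : ∀ {x y w} → (∀ n → ∣ x - y ∣ ≤ w n) → Null w → x ≈ y
  ≈-limit {x} {y} h null = ≤-antisym
    (≤-limit 0 (λ n _ → ∣x-y∣≤⇒ (h n)) null)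
    (≤-limit 0 (λ n _ → ∣x-y∣≤⇒ (∣∣-swap x y (h n))) null)

  telescope : ∀ (u w : ℕ → R) → (∀ n → ∣ u (suc n) - u n ∣ ≤ w n - w (suc n)) → ∀ k n → ∣ u (k ℕ.+ n) - u n ∣ ≤ w n - w (k ℕ.+ n)
  telescope u w step zero    n = ≤-respʳ (solve 1 (λ x → con 0ℚ := x :- x) refl (w n)) (∣x-x∣≤0 (u n))
  telescope u w step (suc k) n = ≤-respʳ
    (solve 3 (λ a b c → (b :- a) :+ (c :- b) := c :- a) refl (w (suc k ℕ.+ n)) (w (k ℕ.+ n)) (w n))
    (∣∣-chain (u (suc k ℕ.+ n)) (u (k ℕ.+ n)) (u n) (step (k ℕ.+ n)) (telescope u w step k n))

  -- Steps bounded by the decrements of `w` telescope, so the limit comes with the explicit error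
  -- `w n`; all later limits rely on such a rate.
  limit : ∀ u w → (∀ n → ∣ u (suc n) - u n ∣ ≤ w n - w (suc n)) → (∀ n → 0# ≤ w n) → Null w →
          Σ[ ℓ ∈ R ] ∀ n → ∣ u n - ℓ ∣ ≤ w n
  limit u w step 0≤w null = ℓ , rate
    where
    close : ∀ m n → m ℕ.≤ n → ∣ u n - u m ∣ ≤ w m
    close m n m≤n = ≤-trans
      (≡.subst (λ k → ∣ u k - u m ∣ ≤ w m - w k) (ℕ.m∸n+n≡m m≤n) (telescope u w step (n ℕ.∸ m) m))
      (≤-by (w n) (0≤w n) (solve 2 (λ a b → a := (a :- b) :+ b) refl (w m) (w n)))
    cauchy : ∀ ε → 0# < ε → ∃[ N ] ∀ m n → N ℕ.≤ m → N ℕ.≤ n → ∣ u m - u n ∣ ≤ ε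
    cauchy ε 0<ε = let (N , h) = null (ι ½ * ε) (half 0<ε) in N , λ m n N≤m N≤n →
      ≤-respʳ (half+half ε) (∣∣-chain (u m) (u N) (u n)
        (≤-trans (close N m N≤m) (h N ℕ.≤-refl)) (∣∣-swap (u n) (u N) (≤-trans (close N n N≤n) (h N ℕ.≤-refl))))
    lim = complete u cauchy
    ℓ = proj₁ lim
    -- `complete` yields bare convergence. The rate is recovered by contradiction, passing through
    -- an index beyond both n and the point where the remaining gap exceeds the error.
    rate : ∀ n → ∣ u n - ℓ ∣ ≤ w n
    rate n = ≮⇒≥ λ w<d →
      let e = ι ½ * (∣ u n - ℓ ∣ - w n)
          (N , h) = proj₂ lim e (half (diff-pos w<d))
          m = n ℕ.⊔ N
      in <-irrefl (begin-strict
        ∣ u n - ℓ ∣  ≤⟨ ∣∣-chain (u n) (u m) ℓ (∣∣-swap (u m) (u n) (close n m (ℕ.m≤m⊔n n N))) (h m (ℕ.m≤n⊔m n N)) ⟩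
        w n + e  <⟨ <-by e (half (diff-pos w<d)) (solve 2 (λ x y → x := y :+ con ½ :* (x :- y) :+ con ½ :* (x :- y)) refl ∣ u n - ℓ ∣ (w n)) ⟩
        ∣ u n - ℓ ∣  ∎)

-- The exponential function

module Exponential (𝓡 : RealField) where
  open Ordered 𝓡

  partialSum : (ℕ → R) → ℕ → R
  partialSum f zero    = f 0
  partialSum f (suc n) = partialSum f n + f (suc n)

  -- x ^ n / n! by its recursion in n; `term≈` reconciles it with the factorials of the statement.
  term : R → ℕ → R
  term x zero    = 1#
  term x (suc n) = unitR n * (x * term x n)

  expSum : R → ℕ → R
  expSum x = partialSum (term x)

  natR*term : ∀ x n → natR (suc n) * term x (suc n) ≈ x * term x n
  natR*term x n = begin-equality
    natR (suc n) * (unitR n * (x * term x n))  ≈⟨ solve 3 (λ a b c → a :* (b :* c) := (a :* b) :* c) refl (natR (suc n)) (unitR n) (x * term x n) ⟩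
    natR (suc n) * unitR n * (x * term x n)  ≈⟨ *-cong (natR*unitR n) refl ⟩
    1# * (x * term x n)  ≈⟨ solve 1 (λ a → con 1ℚ :* a := a) refl (x * term x n) ⟩
    x * term x n  ∎

  unitR-unique : ∀ n {a b} → natR (suc n) * a ≈ b → a ≈ unitR n * b
  unitR-unique n {a} {b} h = begin-equality
    a  ≈⟨ solve 1 (λ a → a := con 1ℚ :* a) refl a ⟩
    1# * a  ≈⟨ *-cong (natR*unitR n) refl ⟨
    natR (suc n) * unitR n * a  ≈⟨ solve 3 (λ m u a → m :* u :* a := u :* (m :* a)) refl (natR (suc n)) (unitR n) a ⟩
    unitR n * (natR (suc n) * a) ≈⟨ *-cong refl h ⟩
    unitR n * b  ∎

  unitR*≤1 : ∀ {m n} → m ℕ.≤ suc n → unitR n * natR m ≤ 1#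
  unitR*≤1 {m} {n} m≤ = begin
    unitR n * natR m  ≤⟨ *-monoʳ-≤ (0≤unitR n) (ι-≤ (nat-mono m≤)) ⟩
    unitR n * natR (suc n)  ≈⟨ solve 2 (λ a b → a :* b := b :* a) refl (unitR n) (natR (suc n)) ⟩
    natR (suc n) * unitR n  ≈⟨ natR*unitR n ⟩
    1#  ∎

  term-cong : ∀ {x y} → x ≈ y → ∀ n → term x n ≈ term y n
  term-cong x≈y zero    = refl
  term-cong x≈y (suc n) = *-cong refl (*-cong x≈y (term-cong x≈y n))

  partialSum-cong : ∀ {f g} → (∀ n → f n ≈ g n) → ∀ n → partialSum f n ≈ partialSum g n
  partialSum-cong h zero    = h 0
  partialSum-cong h (suc n) = +-cong (partialSum-cong h n) (h (suc n))

  -- The sum of the values up to index `M` bounds each of them, so that no maximum has to be chosen.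
  eventually-decreasing⇒bounded : ∀ M (b : ℕ → R) → (∀ n → 0# ≤ b n) → (∀ n → M ℕ.≤ n → b (suc n) ≤ b n) →
    Σ[ C ∈ R ] 0# ≤ C × (∀ n → b n ≤ C)
  eventually-decreasing⇒bounded zero b 0≤b dec = b 0 , 0≤b 0 , below
    where
    below : ∀ n → b n ≤ b 0
    below zero    = ≤-refl
    below (suc n) = ≤-trans (dec n ℕ.z≤n) (below n)
  eventually-decreasing⇒bounded (suc M) b 0≤b dec
    with eventually-decreasing⇒bounded M (b ∘ suc) (0≤b ∘ suc) (λ n M≤n → dec (suc n) (ℕ.s≤s M≤n))
  ... | C , 0≤C , b≤ = b 0 + C , +-nonNeg (0≤b 0) 0≤C , below
    where
    below : ∀ n → b n ≤ b 0 + C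
    below zero    = ≤-by C 0≤C refl
    below (suc n) = ≤-trans (b≤ n) (≤-by (b 0) (0≤b 0) (solve 2 (λ x c → x :+ c := c :+ x) refl (b 0) C))

  ¼ 4# : R
  ¼ = ι (1 ∕ 4)
  4# = ι (4 ∕ 1)

  4^*¼^ : ∀ n → 4# ^ n * ¼ ^ n ≈ 1#
  4^*¼^ zero    = solve 0 (con 1ℚ :* con 1ℚ := con 1ℚ) refl
  4^*¼^ (suc n) = trans
    (solve 2 (λ a b → (con (4 ∕ 1) :* a) :* (con (1 ∕ 4) :* b) := a :* b) refl (4# ^ n) (¼ ^ n)) (4^*¼^ n)

  0≤¼^ : ∀ n → 0# ≤ ¼ ^ n
  0≤¼^ = ^-nonNeg (ι≤ _ _)

  opaque
    -- 4 ^ n ∣x∣ ^ n / n! decreases once n ≥ 4 ∣x∣. The ratio 1/4 leaves room for the factor n + 1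
    -- of the Cauchy product: (n + 1) / 4 ^ n ≤ 1 / 2 ^ n.
    term-bound : ∀ x → Σ[ C ∈ R ] 0# ≤ C × (∀ n → ∣ term x n ∣ ≤ C * ¼ ^ n)
    term-bound x = C , proj₁ (proj₂ bounded) , λ n → begin
      ∣ term x n ∣  ≈⟨ solve 1 (λ t → t := t :* con 1ℚ) refl (∣ term x n ∣) ⟩
      ∣ term x n ∣ * 1#  ≈⟨ *-cong refl (4^*¼^ n) ⟨
      ∣ term x n ∣ * (4# ^ n * ¼ ^ n)  ≈⟨ solve 3 (λ t a b → t :* (a :* b) := (a :* t) :* b) refl (∣ term x n ∣) (4# ^ n) (¼ ^ n) ⟩
      4# ^ n * ∣ term x n ∣ * ¼ ^ n  ≤⟨ *-monoˡ-≤ (0≤¼^ n) (proj₂ (proj₂ bounded) n) ⟩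
      C * ¼ ^ n  ∎
      where
      M : ℕ
      M = proj₁ (archimedean (4# * ∣ x ∣) (ι< 0ℚ 1ℚ))
      4x≤M : 4# * ∣ x ∣ ≤ natR M * 1#
      4x≤M = proj₂ (archimedean (4# * ∣ x ∣) (ι< 0ℚ 1ℚ))
      0≤b : ∀ n → 0# ≤ 4# ^ n * ∣ term x n ∣
      0≤b n = *-nonNeg (^-nonNeg (ι≤ _ _) n) (0≤∣∣ _)
      decreasing : ∀ n → M ℕ.≤ n → 4# ^ suc n * ∣ term x (suc n) ∣ ≤ 4# ^ n * ∣ term x n ∣
      decreasing n M≤n = begin
        4# * 4# ^ n * ∣ unitR n * (x * term x n) ∣  ≤⟨ *-monoʳ-≤ (^-nonNeg (ι≤ _ _) (suc n)) (∣c*∣≤ (0≤unitR n) (∣*∣≤ ≤-refl ≤-refl)) ⟩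
        4# * 4# ^ n * (unitR n * (∣ x ∣ * ∣ term x n ∣))  ≈⟨ solve 5 (λ f p u x t → f :* p :* (u :* (x :* t)) := u :* (f :* x) :* (p :* t)) refl 4# (4# ^ n) (unitR n) (∣ x ∣) (∣ term x n ∣) ⟩
        unitR n * (4# * ∣ x ∣) * (4# ^ n * ∣ term x n ∣)  ≤⟨ *-monoˡ-≤ (0≤b n) (*-monoʳ-≤ (0≤unitR n) (≤-trans 4x≤M (≤-reflexive (solve 1 (λ m → m :* con 1ℚ := m) refl (natR M))))) ⟩
        unitR n * natR M * (4# ^ n * ∣ term x n ∣)  ≤⟨ *-monoˡ-≤ (0≤b n) (unitR*≤1 (ℕ.m≤n⇒m≤1+n M≤n)) ⟩
        1# * (4# ^ n * ∣ term x n ∣)  ≈⟨ solve 1 (λ a → con 1ℚ :* a := a) refl (4# ^ n * ∣ term x n ∣) ⟩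
        4# ^ n * ∣ term x n ∣  ∎
      bounded : Σ[ C ∈ R ] 0# ≤ C × (∀ n → 4# ^ n * ∣ term x n ∣ ≤ C)
      bounded = eventually-decreasing⇒bounded M (λ n → 4# ^ n * ∣ term x n ∣) 0≤b decreasing
      C : R
      C = proj₁ bounded

  null-½^ : Null (ι ½ ^_)
  null-½^ = null-geometric (ι≤ _ _) (ι< 0ℚ 1ℚ) (≤-reflexive (solve 0 (con ½ :* (con 1ℚ :+ con 1ℚ) := con 1ℚ) refl))

  ¼^≈½^*½^ : ∀ n → ¼ ^ n ≈ ι ½ ^ n * ι ½ ^ n
  ¼^≈½^*½^ zero    = solve 0 (con 1ℚ := con 1ℚ :* con 1ℚ) refl
  ¼^≈½^*½^ (suc n) = trans (*-cong refl (¼^≈½^*½^ n))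
    (solve 1 (λ a → con (1 ∕ 4) :* (a :* a) := (con ½ :* a) :* (con ½ :* a)) refl (ι ½ ^ n))

  natR*¼^≤½^ : ∀ n → natR (suc n) * ¼ ^ n ≤ ι ½ ^ n
  natR*¼^≤½^ n = begin
    natR (suc n) * ¼ ^ n  ≈⟨ *-cong (natR-suc n) (¼^≈½^*½^ n) ⟩
    (1# + natR n) * (ι ½ ^ n * ι ½ ^ n)  ≈⟨ solve 2 (λ n h → (con 1ℚ :+ n) :* (h :* h) := (h :* (con 1ℚ :+ n :* con 1ℚ)) :* h) refl (natR n) (ι ½ ^ n) ⟩
    (ι ½ ^ n * (1# + natR n * 1#)) * ι ½ ^ n  ≤⟨ *-monoˡ-≤ (^-nonNeg (ι≤ _ _) n) (bernoulli (ι≤ _ _) 0≤1 (≤-reflexive (solve 0 (con ½ :* (con 1ℚ :+ con 1ℚ) := con 1ℚ) refl)) n) ⟩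
    1# * ι ½ ^ n  ≈⟨ solve 1 (λ a → con 1ℚ :* a := a) refl (ι ½ ^ n) ⟩
    ι ½ ^ n  ∎

  null-¼^ : Null (¼ ^_)
  null-¼^ = null-mono (λ n → ≤-trans (≤-by (natR n * ¼ ^ n) (*-nonNeg (0≤natR n) (0≤¼^ n))
    (trans (*-cong (natR-suc n) refl) (solve 2 (λ n q → (con 1ℚ :+ n) :* q := q :+ n :* q) refl (natR n) (¼ ^ n)))) (natR*¼^≤½^ n)) null-½^

  opaque
    expLimit : ∀ x → Σ[ ℓ ∈ R ] ∀ n → ∣ expSum x n - ℓ ∣ ≤ proj₁ (term-bound x) * ¼ ^ n
    expLimit x = limit (expSum x) (λ n → C * ¼ ^ n) step (λ n → *-nonNeg 0≤C (0≤¼^ n)) (null-scale C 0≤C null-¼^)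
      where
      C : R
      C = proj₁ (term-bound x)
      0≤C : 0# ≤ C
      0≤C = proj₁ (proj₂ (term-bound x))
      bound : ∀ n → ∣ term x n ∣ ≤ C * ¼ ^ n
      bound = proj₂ (proj₂ (term-bound x))
      step : ∀ n → ∣ expSum x (suc n) - expSum x n ∣ ≤ C * ¼ ^ n - C * ¼ ^ suc n
      step n = begin
        ∣ expSum x n + term x (suc n) - expSum x n ∣  ≈⟨ ∣∣-cong (solve 2 (λ s t → s :+ t :- s := t) refl (expSum x n) (term x (suc n))) ⟩
        ∣ term x (suc n) ∣  ≤⟨ bound (suc n) ⟩
        C * (¼ * ¼ ^ n)  ≤⟨ ≤-by (ι ½ * (C * ¼ ^ n)) (*-nonNeg (ι≤ 0ℚ ½) (*-nonNeg 0≤C (0≤¼^ n)))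
                                                           (solve 2 (λ c q → c :* q :- c :* (con (1 ∕ 4) :* q) := c :* (con (1 ∕ 4) :* q) :+ con ½ :* (c :* q)) refl C (¼ ^ n)) ⟩
        C * ¼ ^ n - C * (¼ * ¼ ^ n)  ∎

  exp : R → R
  exp x = proj₁ (expLimit x)

  expRate : R → ℕ → R
  expRate x n = proj₁ (term-bound x) * ¼ ^ n

  exp-rate : ∀ x n → ∣ expSum x n - exp x ∣ ≤ expRate x n
  exp-rate x = proj₂ (expLimit x)

  null-expRate : ∀ x → Null (expRate x)
  null-expRate x = null-scale _ (proj₁ (proj₂ (term-bound x))) null-¼^

  exp-cong : ∀ {x y} → x ≈ y → exp x ≈ exp y
  exp-cong {x} {y} x≈y = ≈-limit
    (λ n → ∣∣-chain (exp x) (expSum x n) (exp y) (∣∣-swap (expSum x n) (exp x) (exp-rate x n))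
      (∣∣≤-resp (+-cong (sym (partialSum-cong (term-cong x≈y) n)) refl) (exp-rate y n)))
    (null-+ (null-expRate x) (null-expRate y))

  -- The Cauchy product Σ f i * g (n - i), recursing on a shift of `f` to avoid the subtraction.
  conv : (ℕ → R) → (ℕ → R) → ℕ → R
  conv f g zero    = f 0 * g 0
  conv f g (suc n) = f 0 * g (suc n) + conv (f ∘ suc) g n

  conv-+ˡ : ∀ {f f′ h : ℕ → R} g → (∀ k → h k ≈ f k + f′ k) → ∀ n → conv h g n ≈ conv f g n + conv f′ g n
  conv-+ˡ {f} {f′} g e zero    = trans (*-cong (e 0) refl) (solve 3 (λ a b c → (a :+ b) :* c := a :* c :+ b :* c) refl (f 0) (f′ 0) (g 0))
  conv-+ˡ {f} {f′} g e (suc n) = trans (+-cong (*-cong (e 0) refl) (conv-+ˡ g (e ∘ suc) n))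
    (solve 5 (λ a b c u v → (a :+ b) :* c :+ (u :+ v) := (a :* c :+ u) :+ (b :* c :+ v)) refl
      (f 0) (f′ 0) (g (suc n)) (conv (f ∘ suc) g n) (conv (f′ ∘ suc) g n))

  conv-scaleˡ : ∀ x {f h : ℕ → R} g → (∀ k → h k ≈ x * f k) → ∀ n → conv h g n ≈ x * conv f g n
  conv-scaleˡ x {f} g e zero    = trans (*-cong (e 0) refl) (solve 3 (λ x a b → x :* a :* b := x :* (a :* b)) refl x (f 0) (g 0))
  conv-scaleˡ x {f} g e (suc n) = trans (+-cong (*-cong (e 0) refl) (conv-scaleˡ x g (e ∘ suc) n))
    (solve 4 (λ x a b c → x :* a :* b :+ x :* c := x :* (a :* b :+ c)) refl x (f 0) (g (suc n)) (conv (f ∘ suc) g n))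

  conv-scaleʳ : ∀ x (f : ℕ → R) {g h : ℕ → R} → (∀ k → h k ≈ x * g k) → ∀ n → conv f h n ≈ x * conv f g n
  conv-scaleʳ x f {g} e zero    = trans (*-cong refl (e 0)) (solve 3 (λ x a b → a :* (x :* b) := x :* (a :* b)) refl x (f 0) (g 0))
  conv-scaleʳ x f {g} e (suc n) = trans (+-cong (*-cong refl (e (suc n))) (conv-scaleʳ x (f ∘ suc) e n))
    (solve 4 (λ x a b c → a :* (x :* b) :+ x :* c := x :* (a :* b :+ c)) refl x (f 0) (g (suc n)) (conv (f ∘ suc) g n))

  -- Coefficients of the formal derivative; `leibniz` is the product rule for power series.
  derivative : (ℕ → R) → ℕ → R
  derivative f k = natR (suc k) * f (suc k)

  leibniz : ∀ f g n → natR (suc n) * conv f g (suc n) ≈ conv (derivative f) g n + conv f (derivative g) n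
  leibniz f g zero = solve 5 (λ m a b c d → m :* (a :* d :+ b :* c) := (m :* b) :* c :+ a :* (m :* d)) refl (natR 1) (f 0) (f 1) (g 0) (g 1)
  leibniz f g (suc n) = begin-equality
    N₂ * (f 0 * g (2 ℕ.+ n) + Q)
      ≈⟨ solve 4 (λ m a b q → m :* (a :* b :+ q) := a :* (m :* b) :+ m :* q) refl N₂ (f 0) (g (2 ℕ.+ n)) Q ⟩
    f 0 * (N₂ * g (2 ℕ.+ n)) + N₂ * Q
      ≈⟨ +-cong refl (*-cong (natR-suc (suc n)) refl) ⟩
    f 0 * (N₂ * g (2 ℕ.+ n)) + (1# + natR (suc n)) * Q
      ≈⟨ +-cong refl (trans (solve 2 (λ m q → (con 1ℚ :+ m) :* q := q :+ m :* q) refl (natR (suc n)) Q) (+-cong refl (leibniz (f ∘ suc) g n))) ⟩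
    f 0 * (N₂ * g (2 ℕ.+ n)) + (Q + (conv (derivative (f ∘ suc)) g n + conv (f ∘ suc) (derivative g) n))
      ≈⟨ solve 6 (λ t a b p q r → t :+ ((a :* b :+ p) :+ (q :+ r)) := (con 1ℚ :* a :* b :+ (p :+ q)) :+ (t :+ r)) refl
           (f 0 * (N₂ * g (2 ℕ.+ n))) (f 1) (g (suc n)) (conv (f ∘ suc ∘ suc) g n) (conv (derivative (f ∘ suc)) g n) (conv (f ∘ suc) (derivative g) n) ⟩
    (1# * f 1 * g (suc n) + (conv (f ∘ suc ∘ suc) g n + conv (derivative (f ∘ suc)) g n)) + conv f (derivative g) (suc n)
      ≈⟨ +-cong (+-cong refl (conv-+ˡ g (λ k → trans (*-cong (natR-suc (suc k)) refl)
           (solve 2 (λ m a → (con 1ℚ :+ m) :* a := a :+ m :* a) refl (natR (suc k)) (f (2 ℕ.+ k)))) n)) refl ⟨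
    conv (derivative f) g (suc n) + conv f (derivative g) (suc n) ∎
    where
    N₂ = natR (2 ℕ.+ n)
    Q = conv (f ∘ suc) g (suc n)

  -- Both sides are the coefficients of the formal solution of f′ = (x + y) f with f(0) = 1; the
  -- product rule takes the place of binomial coefficients.
  binomial : ∀ x y n → conv (term x) (term y) n ≈ term (x + y) n
  binomial x y zero    = solve 0 (con 1ℚ :* con 1ℚ := con 1ℚ) refl
  binomial x y (suc n) = unitR-unique n (begin-equality
    natR (suc n) * conv (term x) (term y) (suc n)  ≈⟨ leibniz (term x) (term y) n ⟩
    conv (derivative (term x)) (term y) n + conv (term x) (derivative (term y)) n
      ≈⟨ +-cong (conv-scaleˡ x (term y) (natR*term x) n) (conv-scaleʳ y (term x) (natR*term y) n) ⟩
    x * conv (term x) (term y) n + y * conv (term x) (term y) n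
      ≈⟨ solve 3 (λ x y c → x :* c :+ y :* c := (x :+ y) :* c) refl x y (conv (term x) (term y) n) ⟩
    (x + y) * conv (term x) (term y) n  ≈⟨ *-cong refl (binomial x y n) ⟩
    (x + y) * term (x + y) n  ∎)

  conv-partialSum : ∀ f g n → conv f (partialSum g) (suc n) ≈ conv f (partialSum g) n + conv f g (suc n)
  conv-partialSum f g zero = solve 4 (λ a b c d → a :* (c :+ d) :+ b :* c := a :* c :+ (a :* d :+ b :* c)) refl (f 0) (f 1) (g 0) (g 1)
  conv-partialSum f g (suc n) = trans (+-cong refl (conv-partialSum (f ∘ suc) g n))
    (solve 5 (λ a s b p q → a :* (s :+ b) :+ (p :+ q) := (a :* s :+ p) :+ (a :* b :+ q)) refl
      (f 0) (partialSum g (suc n)) (g (2 ℕ.+ n)) (conv (f ∘ suc) (partialSum g) n) (conv (f ∘ suc) g (suc n)))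

  conv-const : ∀ f E n → conv f (λ _ → E) n ≈ partialSum f n * E
  conv-const f E zero    = refl
  conv-const f E (suc n) = trans (last f n)
    (trans (+-cong (conv-const f E n) refl) (solve 3 (λ s a e → s :* e :+ a :* e := (s :+ a) :* e) refl (partialSum f n) (f (suc n)) E))
    where
    last : ∀ f n → conv f (λ _ → E) (suc n) ≈ conv f (λ _ → E) n + f (suc n) * E
    last f zero    = refl
    last f (suc n) = trans (+-cong refl (last (f ∘ suc) n))
      (solve 3 (λ a b c → a :+ (b :+ c) := (a :+ b) :+ c) refl (f 0 * E) (conv (f ∘ suc) (λ _ → E) n) (f (2 ℕ.+ n) * E))

  expSum-+ : ∀ x y n → conv (term x) (expSum y) n ≈ expSum (x + y) n
  expSum-+ x y zero    = binomial x y zero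
  expSum-+ x y (suc n) = trans (conv-partialSum (term x) (term y) n) (+-cong (expSum-+ x y n) (binomial x y (suc n)))

  -- Each of the n + 1 summands is off by at most C / 4 ^ i times D / 4 ^ (n - i), that is C D / 4 ^
  -- n.
  conv-close : ∀ {C D} (f g h : ℕ → R) → 0# ≤ C → 0# ≤ D → (∀ k → ∣ f k ∣ ≤ C * ¼ ^ k) → (∀ k → ∣ g k - h k ∣ ≤ D * ¼ ^ k) →
    ∀ n → ∣ conv f g n - conv f h n ∣ ≤ natR (suc n) * (C * D * ¼ ^ n)
  conv-close {C} {D} f g h 0≤C 0≤D f≤ gh≤ zero = begin
    ∣ f 0 * g 0 - f 0 * h 0 ∣  ≈⟨ ∣∣-cong (solve 3 (λ a b c → a :* b :- a :* c := a :* (b :- c)) refl (f 0) (g 0) (h 0)) ⟩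
    ∣ f 0 * (g 0 - h 0) ∣  ≤⟨ ∣*∣≤ (f≤ 0) (gh≤ 0) ⟩
    C * 1# * (D * 1#)  ≈⟨ solve 2 (λ c d → c :* con 1ℚ :* (d :* con 1ℚ) := con 1ℚ :* (c :* d :* con 1ℚ)) refl C D ⟩
    1# * (C * D * 1#)  ∎
  conv-close {C} {D} f g h 0≤C 0≤D f≤ gh≤ (suc n) = begin
    ∣ f 0 * g (suc n) + G - (f 0 * h (suc n) + H) ∣  ≈⟨ ∣∣-cong (solve 5 (λ a b c d e → a :* b :+ d :- (a :* c :+ e) := a :* (b :- c) :+ (d :- e)) refl (f 0) (g (suc n)) (h (suc n)) G H) ⟩
    ∣ f 0 * (g (suc n) - h (suc n)) + (G - H) ∣  ≤⟨ ∣+∣≤ (∣*∣≤ (f≤ 0) (gh≤ (suc n))) (conv-close (f ∘ suc) g h (*-nonNeg 0≤C (ι≤ _ _)) 0≤D (λ k → ≤-respʳ (solve 2 (λ c p → c :* (con (1 ∕ 4) :* p) := c :* con (1 ∕ 4) :* p) refl C (¼ ^ k)) (f≤ (suc k))) gh≤ n) ⟩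
    C * 1# * (D * (¼ * ¼ ^ n)) + natR (suc n) * (C * ¼ * D * ¼ ^ n)
      ≈⟨ solve 4 (λ c d p m → c :* con 1ℚ :* (d :* (con (1 ∕ 4) :* p)) :+ m :* (c :* con (1 ∕ 4) :* d :* p) := (con 1ℚ :+ m) :* (c :* d :* (con (1 ∕ 4) :* p))) refl C D (¼ ^ n) (natR (suc n)) ⟩
    (1# + natR (suc n)) * (C * D * (¼ * ¼ ^ n))  ≈⟨ *-cong (natR-suc (suc n)) refl ⟨
    natR (2 ℕ.+ n) * (C * D * ¼ ^ suc n)  ∎
    where
    G = conv (f ∘ suc) g n
    H = conv (f ∘ suc) h n

  -- The partial sums of the product series are `conv (term x) (expSum y)`. Only the inner partial
  -- sums are replaced by their limit, after which `exp y` factors out.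
  exp-+ : ∀ x y → exp (x + y) ≈ exp x * exp y
  exp-+ x y = ≈-limit bound (null-+ (null-expRate (x + y)) (null-+
      (null-mono (λ n → ≤-respˡ (solve 4 (λ m c d q → c :* d :* (m :* q) := m :* (c :* d :* q)) refl (natR (suc n)) C D (¼ ^ n)) (*-monoʳ-≤ 0≤CD (natR*¼^≤½^ n))) (null-scale (C * D) 0≤CD null-½^))
      (null-mono (λ n → ≤-reflexive (solve 2 (λ a b → a :* b := b :* a) refl (expRate x n) ∣ exp y ∣)) (null-scale ∣ exp y ∣ (0≤∣∣ _) (null-expRate x)))))
    where
    C = proj₁ (term-bound x)
    D = proj₁ (term-bound y)
    0≤C = proj₁ (proj₂ (term-bound x))
    0≤D = proj₁ (proj₂ (term-bound y))
    0≤CD = *-nonNeg 0≤C 0≤D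
    bound : ∀ n → ∣ exp (x + y) - exp x * exp y ∣ ≤ expRate (x + y) n + (natR (suc n) * (C * D * ¼ ^ n) + expRate x n * ∣ exp y ∣)
    bound n = ∣∣-chain (exp (x + y)) (expSum (x + y) n) (exp x * exp y)
      (∣∣-swap (expSum (x + y) n) (exp (x + y)) (exp-rate (x + y) n))
      (∣∣-chain (expSum (x + y) n) (expSum x n * exp y) (exp x * exp y)
        (∣∣≤-resp (+-cong (expSum-+ x y n) (-‿cong (conv-const (term x) (exp y) n)))
          (conv-close (term x) (expSum y) (λ _ → exp y) 0≤C 0≤D (proj₂ (proj₂ (term-bound x))) (exp-rate y) n))
        (∣∣≤-resp (solve 3 (λ a b e → (a :- b) :* e := a :* e :- b :* e) refl (expSum x n) (exp x) (exp y)) (∣*∣≤ (exp-rate x n) ≤-refl)))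

  unitR-suc≤½ : ∀ n → unitR (suc n) ≤ ι ½
  unitR-suc≤½ n = begin
    unitR (suc n)  ≈⟨ solve 1 (λ u → u := u :* (con 1ℚ :+ (con 1ℚ :+ con 0ℚ)) :* con ½) refl (unitR (suc n)) ⟩
    unitR (suc n) * (1# + (1# + 0#)) * ι ½  ≈⟨ *-cong (*-cong refl (trans (natR-suc 1) (+-cong refl (natR-suc 0)))) refl ⟨
    unitR (suc n) * natR 2 * ι ½  ≤⟨ *-monoˡ-≤ (ι≤ 0ℚ ½) (unitR*≤1 {2} {suc n} (ℕ.s≤s (ℕ.s≤s ℕ.z≤n))) ⟩
    1# * ι ½  ≈⟨ solve 0 (con 1ℚ :* con ½ := con ½) refl ⟩
    ι ½  ∎

  term-1 : ∀ x → term x 1 ≈ x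
  term-1 x = trans (sym (unitR-unique 0 (trans (*-cong (natR-suc 0) refl) (solve 1 (λ x → (con 1ℚ :+ con 0ℚ) :* x := x :* con 1ℚ) refl x)))) refl

  term-small : ∀ {x} → ∣ x ∣ ≤ 1# → ∀ n → ∣ term x (suc n) ∣ ≤ ∣ x ∣ * ι ½ ^ n
  term-small {x} x≤1 zero    = ∣∣≤-resp (sym (term-1 x)) (≤-reflexive (solve 1 (λ x → x := x :* con 1ℚ) refl ∣ x ∣))
  term-small {x} x≤1 (suc n) = begin
    ∣ unitR (suc n) * (x * term x (suc n)) ∣  ≤⟨ ∣c*∣≤ (0≤unitR (suc n)) (∣*∣≤ x≤1 (term-small x≤1 n)) ⟩
    unitR (suc n) * (1# * (∣ x ∣ * ι ½ ^ n))  ≤⟨ *-monoˡ-≤ (*-nonNeg 0≤1 (*-nonNeg (0≤∣∣ x) (^-nonNeg (ι≤ _ _) n))) (unitR-suc≤½ n) ⟩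
    ι ½ * (1# * (∣ x ∣ * ι ½ ^ n))  ≈⟨ solve 2 (λ x h → con ½ :* (con 1ℚ :* (x :* h)) := x :* (con ½ :* h)) refl ∣ x ∣ (ι ½ ^ n) ⟩
    ∣ x ∣ * (ι ½ * ι ½ ^ n)  ∎

  -- By `term-small` the series without its first term is dominated by ∣x∣ (1 + 1/2 + 1/4 + ...).
  ∣exp-1∣≤ : ∀ {x} → ∣ x ∣ ≤ 1# → ∣ exp x - 1# ∣ ≤ 2# * ∣ x ∣
  ∣exp-1∣≤ {x} x≤1 = ≤-limit 0 (λ n _ → ≤-respʳ (solve 2 (λ a b → a :+ b := b :+ a) refl (expRate x n) (2# * ∣ x ∣))
      (∣∣-chain (exp x) (expSum x n) 1# (∣∣-swap (expSum x n) (exp x) (exp-rate x n))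
        (≤-trans (partial n) (≤-by (2# * ∣ x ∣ * ι ½ ^ n) (*-nonNeg (*-nonNeg (ι≤ _ _) (0≤∣∣ x)) (^-nonNeg (ι≤ _ _) n))
          (solve 2 (λ a b → a := a :- b :+ b) refl (2# * ∣ x ∣) (2# * ∣ x ∣ * ι ½ ^ n))))))
    (null-expRate x)
    where
    partial : ∀ n → ∣ expSum x n - 1# ∣ ≤ 2# * ∣ x ∣ - 2# * ∣ x ∣ * ι ½ ^ n
    partial zero    = ≤-respʳ (solve 1 (λ a → con 0ℚ := a :- a :* con 1ℚ) refl (2# * ∣ x ∣)) (∣x-x∣≤0 1#)
    partial (suc n) = begin
      ∣ expSum x n + term x (suc n) - 1# ∣  ≈⟨ ∣∣-cong (solve 2 (λ s t → s :+ t :- con 1ℚ := (s :- con 1ℚ) :+ t) refl (expSum x n) (term x (suc n))) ⟩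
      ∣ expSum x n - 1# + term x (suc n) ∣  ≤⟨ ∣+∣≤ (partial n) (term-small x≤1 n) ⟩
      2# * ∣ x ∣ - 2# * ∣ x ∣ * ι ½ ^ n + ∣ x ∣ * ι ½ ^ n
        ≈⟨ solve 2 (λ x h → con (2 ∕ 1) :* x :- con (2 ∕ 1) :* x :* h :+ x :* h := con (2 ∕ 1) :* x :- con (2 ∕ 1) :* x :* (con ½ :* h)) refl ∣ x ∣ (ι ½ ^ n) ⟩
      2# * ∣ x ∣ - 2# * ∣ x ∣ * (ι ½ * ι ½ ^ n) ∎

  exp-0 : ∀ {x} → x ≈ 0# → exp x ≈ 1#
  exp-0 {x} x≈0 = ≈-limit {w = λ _ → 0#} (λ _ → ≤-trans (∣exp-1∣≤ (≤-trans (≤-reflexive ∣x∣≈0) 0≤1))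
    (≤-reflexive (trans (*-cong refl ∣x∣≈0) (solve 0 (con (2 ∕ 1) :* con 0ℚ := con 0ℚ) refl)))) (λ ε 0<ε → 0 , λ _ _ → <⇒≤ 0<ε)
    where
    ∣x∣≈0 : ∣ x ∣ ≈ 0#
    ∣x∣≈0 = trans (∣∣-cong x≈0) (∣∣-nonNeg ≤-refl)

  exp-inverse : ∀ x → exp x * exp (- x) ≈ 1#
  exp-inverse x = trans (sym (exp-+ x (- x))) (exp-0 (solve 1 (λ x → x :- x := con 0ℚ) refl x))

  exp-natR : ∀ n x → exp (natR n * x) ≈ exp x ^ n
  exp-natR zero    x = exp-0 (solve 1 (λ x → con 0ℚ :* x := con 0ℚ) refl x)
  exp-natR (suc n) x = begin-equality
    exp (natR (suc n) * x)  ≈⟨ exp-cong (trans (*-cong (natR-suc n) refl) (solve 2 (λ n x → (con 1ℚ :+ n) :* x := x :+ n :* x) refl (natR n) x)) ⟩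
    exp (x + natR n * x)  ≈⟨ exp-+ x (natR n * x) ⟩
    exp x * exp (natR n * x) ≈⟨ *-cong refl (exp-natR n x) ⟩
    exp x * exp x ^ n  ∎

  0≤term : ∀ {x} → 0# ≤ x → ∀ n → 0# ≤ term x n
  0≤term 0≤x zero    = 0≤1
  0≤term 0≤x (suc n) = *-nonNeg (0≤unitR n) (*-nonNeg 0≤x (0≤term 0≤x n))

  expSum≤exp : ∀ {x} → 0# ≤ x → ∀ n → expSum x n ≤ exp x
  expSum≤exp {x} 0≤x n = ≤-limit n (λ m n≤m → ≤-trans (≡.subst (λ k → expSum x n ≤ expSum x k) (ℕ.m∸n+n≡m n≤m) (increasing (m ℕ.∸ n)))
      (∣x-y∣≤⇒ (exp-rate x m))) (null-expRate x)
    where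
    increasing : ∀ k → expSum x n ≤ expSum x (k ℕ.+ n)
    increasing zero    = ≤-refl
    increasing (suc k) = ≤-trans (increasing k) (≤-by (term x (suc k ℕ.+ n)) (0≤term 0≤x (suc k ℕ.+ n)) refl)

  1+x≤exp : ∀ {x} → 0# ≤ x → 1# + x ≤ exp x
  1+x≤exp {x} 0≤x = ≤-trans (≤-reflexive (+-cong refl (sym (term-1 x)))) (expSum≤exp 0≤x 1)

-- The root β, its logarithm, and the growth of B

module DominantRoot (𝓡 : RealField) where
  open Ordered 𝓡
  open Exponential 𝓡 public

  ι-cong : ∀ {p q} → p ≡ q → ι p ≈ ι q
  ι-cong ≡.refl = refl

  -- Applied with a relaxed Newton map x - λ f x, once for `β` and once for `ln-β`. A slope between
  -- 0 and `q` makes `T` increasing, so the iterates from `a` rise and stay below `b`; b - a ≤ D (1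
  -- - q) lets the errors D q ^ n telescope.
  module FixedPoint (T : R → R) (a b q D : R) (0≤q : 0# ≤ q) (null : Null (q ^_)) (0≤D : 0# ≤ D) (a≤b : a ≤ b) (b-a≤ : b - a ≤ D - D * q)
    (T-slope : ∀ {x y} → a ≤ x → x ≤ y → y ≤ b → 0# ≤ T y - T x × T y - T x ≤ q * (y - x))
    (a≤Ta : a ≤ T a) (Tb≤b : T b ≤ b) where

    iterate : ℕ → R
    iterate zero    = a
    iterate (suc n) = T (iterate n)

    invariant : ∀ n → a ≤ iterate n × iterate n ≤ b × iterate n ≤ T (iterate n)
    invariant zero    = ≤-refl , a≤b , a≤Ta
    invariant (suc n) = let (a≤x , x≤b , x≤Tx) = invariant n
                            Tx≤b = ≤-trans (diff-≤ (proj₁ (T-slope a≤x x≤b ≤-refl))) Tb≤b in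
      ≤-trans a≤x x≤Tx , Tx≤b , diff-≤ (proj₁ (T-slope a≤x x≤Tx Tx≤b))

    increment : ∀ n → iterate (suc n) - iterate n ≤ D * q ^ n - D * q ^ suc n
    increment zero = begin
      T a - a  ≤⟨ +-mono-≤ (proj₁ (proj₂ (invariant 1))) ≤-refl ⟩
      b - a  ≤⟨ b-a≤ ⟩
      D - D * q  ≈⟨ solve 2 (λ d q → d :- d :* q := d :* con 1ℚ :- d :* (q :* con 1ℚ)) refl D q ⟩
      D * 1# - D * (q * 1#)  ∎
    increment (suc n) = let (a≤x , x≤b , x≤Tx) = invariant n in begin
      T (iterate (suc n)) - T (iterate n)  ≤⟨ proj₂ (T-slope a≤x x≤Tx (proj₁ (proj₂ (invariant (suc n))))) ⟩
      q * (iterate (suc n) - iterate n)  ≤⟨ *-monoʳ-≤ 0≤q (increment n) ⟩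
      q * (D * q ^ n - D * (q * q ^ n))  ≈⟨ solve 3 (λ d q p → q :* (d :* p :- d :* (q :* p)) := d :* (q :* p) :- d :* (q :* (q :* p))) refl D q (q ^ n) ⟩
      D * (q * q ^ n) - D * (q * (q * q ^ n))  ∎

    lim : Σ[ ℓ ∈ R ] ∀ n → ∣ iterate n - ℓ ∣ ≤ D * q ^ n
    lim = limit iterate (λ n → D * q ^ n)
      (λ n → ≤-respˡ (sym (∣∣-nonNeg (diff-nonNeg (proj₂ (proj₂ (invariant n)))))) (increment n))
      (λ n → *-nonNeg 0≤D (^-nonNeg 0≤q n)) (null-scale D 0≤D null)

    x* : R
    x* = proj₁ lim

    a≤x* : a ≤ x*
    a≤x* = ≤-limit 0 (λ n _ → ≤-trans (proj₁ (invariant n)) (∣x-y∣≤⇒ (proj₂ lim n))) (null-scale D 0≤D null)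

    x*≤b : x* ≤ b
    x*≤b = ≤-limit 0 (λ n _ → ≤-trans (∣x-y∣≤⇒ (∣∣-swap (iterate n) x* (proj₂ lim n))) (+-mono-≤ (proj₁ (proj₂ (invariant n))) ≤-refl))
      (null-scale D 0≤D null)

    T-lipschitz : ∀ {x y} → a ≤ x → x ≤ b → a ≤ y → y ≤ b → ∣ T x - T y ∣ ≤ q * ∣ x - y ∣
    T-lipschitz {x} {y} a≤x x≤b a≤y y≤b = ≤-cases x y
      (λ x≤y → ∣∣-swap (T y) (T x) (≤-trans (ordered a≤x x≤y y≤b) (*-monoʳ-≤ 0≤q (∣∣-swap x y ≤-refl))))
      (λ y≤x → ordered a≤y y≤x x≤b)
      where
      ordered : ∀ {x y} → a ≤ x → x ≤ y → y ≤ b → ∣ T y - T x ∣ ≤ q * ∣ y - x ∣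
      ordered {x} {y} a≤x x≤y y≤b = let (0≤ , ≤q) = T-slope a≤x x≤y y≤b in
        ≤-respˡ (sym (∣∣-nonNeg 0≤)) (≤-trans ≤q (*-monoʳ-≤ 0≤q (x≤∣x∣ (y - x))))

    fixed : T x* ≈ x*
    fixed = ≈-limit
      (λ n → let (a≤x , x≤b , _) = invariant n in
        ∣∣-chain (T x*) (iterate (suc n)) x*
          (≤-trans (T-lipschitz a≤x* x*≤b a≤x x≤b) (*-monoʳ-≤ 0≤q (∣∣-swap (iterate n) x* (proj₂ lim n))))
          (proj₂ lim (suc n)))
      (null-+ (null-scale q 0≤q (null-scale D 0≤D null)) (null-suc (null-scale D 0≤D null)))

  fP : ∀ {n} → Polynomial n → Polynomial n
  fP x = x :* x :* x :- con (2 ∕ 1) :* (x :* x) :- x :+ con 1ℚ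

  f : R → R
  f x = x * x * x - 2# * (x * x) - x + 1#

  lo hi : R
  lo = ι (11 ∕ 5)
  hi = ι (9 ∕ 4)

  private
    -- On [11/5, 9/4] the difference quotients of `f` lie between 7/2 and 7, so the factor 1/7 gives
    -- `T` slopes between 0 and 1/2.
    T : R → R
    T x = x - ι (1 ∕ 7) * f x

    -- The divided difference (f y - f x) / (y - x).
    slope : R → R → R
    slope x y = y * y + x * y + x * x - 2# * (x + y) - 1#

    slopeP : ∀ {n} → Polynomial n → Polynomial n → Polynomial n
    slopeP x y = y :* y :+ x :* y :+ x :* x :- con (2 ∕ 1) :* (x :+ y) :- con 1ℚ

    T-slope : ∀ {x y} → lo ≤ x → x ≤ y → y ≤ hi → 0# ≤ T y - T x × T y - T x ≤ ι ½ * (y - x)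
    T-slope {x} {y} lo≤x x≤y y≤hi =
      ≤-respʳ (solve 2 (λ x y → con (1 ∕ 7) :* ((y :- x) :* (con (7 ∕ 1) :- slopeP x y))
          := (y :- con (1 ∕ 7) :* fP y) :- (x :- con (1 ∕ 7) :* fP x)) refl x y)
        (*-nonNeg (ι≤ _ _) (*-nonNeg (diff-nonNeg x≤y) (diff-nonNeg slope≤7))) ,
      ≤-by (ι (1 ∕ 7) * ((y - x) * (slope x y - ι (7 ∕ 2)))) (*-nonNeg (ι≤ _ _) (*-nonNeg (diff-nonNeg x≤y) (diff-nonNeg 7/2≤slope)))
        (solve 2 (λ x y → con ½ :* (y :- x) := ((y :- con (1 ∕ 7) :* fP y) :- (x :- con (1 ∕ 7) :* fP x))
          :+ con (1 ∕ 7) :* ((y :- x) :* (slopeP x y :- con (7 ∕ 2)))) refl x y)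
      where
      lo≤y = ≤-trans lo≤x x≤y
      x≤hi = ≤-trans x≤y y≤hi
      0≤lo : 0# ≤ lo
      0≤lo = ι≤ _ _
      0≤hi : 0# ≤ hi
      0≤hi = ι≤ _ _
      0≤x = ≤-trans 0≤lo lo≤x
      0≤y = ≤-trans 0≤lo lo≤y
      above : ∀ {x y} → 0# ≤ x → x ≤ hi → y ≤ hi → x * y ≤ hi * hi
      above 0≤x x≤ y≤ = *-mono-≤ 0≤x 0≤hi x≤ y≤
      below : ∀ {x y} → 0# ≤ y → lo ≤ x → lo ≤ y → lo * lo ≤ x * y
      below 0≤y ≤x ≤y = *-mono-≤ 0≤lo 0≤y ≤x ≤y
      slope≤7 : slope x y ≤ ι (7 ∕ 1)
      slope≤7 = ≤-trans
        (+-mono-≤ (+-mono-≤ (+-mono-≤ (+-mono-≤ (above 0≤y y≤hi y≤hi) (above 0≤x x≤hi y≤hi)) (above 0≤x x≤hi x≤hi))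
          (neg-mono-≤ (*-monoʳ-≤ {2#} (ι≤ _ _) (+-mono-≤ lo≤x lo≤y)))) ≤-refl)
        (≤-by (ι (129 ∕ 80)) (ι≤ _ _) (solve 0 (con (7 ∕ 1) :=
          (con (9 ∕ 4) :* con (9 ∕ 4) :+ con (9 ∕ 4) :* con (9 ∕ 4) :+ con (9 ∕ 4) :* con (9 ∕ 4) :- con (2 ∕ 1) :* (con (11 ∕ 5) :+ con (11 ∕ 5)) :- con 1ℚ) :+ con (129 ∕ 80)) refl))
      7/2≤slope : ι (7 ∕ 2) ≤ slope x y
      7/2≤slope = ≤-trans
        (≤-by (ι (51 ∕ 50)) (ι≤ _ _) (solve 0 (
          (con (11 ∕ 5) :* con (11 ∕ 5) :+ con (11 ∕ 5) :* con (11 ∕ 5) :+ con (11 ∕ 5) :* con (11 ∕ 5) :- con (2 ∕ 1) :* (con (9 ∕ 4) :+ con (9 ∕ 4)) :- con 1ℚ) := con (7 ∕ 2) :+ con (51 ∕ 50)) refl))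
        (+-mono-≤ (+-mono-≤ (+-mono-≤ (+-mono-≤ (below 0≤y lo≤y lo≤y) (below 0≤y lo≤x lo≤y)) (below 0≤x lo≤x lo≤x))
          (neg-mono-≤ (*-monoʳ-≤ {2#} (ι≤ _ _) (+-mono-≤ x≤hi y≤hi)))) ≤-refl)

    hi-lo : hi - lo ≤ ι (1 ∕ 10) - ι (1 ∕ 10) * ι ½
    hi-lo = ≤-reflexive (solve 0 (con (9 ∕ 4) :- con (11 ∕ 5) := con (1 ∕ 10) :- con (1 ∕ 10) :* con ½) refl)

    lo≤T : lo ≤ T lo
    lo≤T = ≤-by (ι (29 ∕ 875)) (ι≤ _ _) (solve 0 (con (11 ∕ 5) :- con (1 ∕ 7) :* fP (con (11 ∕ 5)) := con (11 ∕ 5) :+ con (29 ∕ 875)) refl)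

    T≤hi : T hi ≤ hi
    T≤hi = ≤-by (ι (1 ∕ 448)) (ι≤ _ _) (solve 0 (con (9 ∕ 4) := con (9 ∕ 4) :- con (1 ∕ 7) :* fP (con (9 ∕ 4)) :+ con (1 ∕ 448)) refl)

    module β-FixedPoint = FixedPoint T lo hi (ι ½) (ι (1 ∕ 10)) (ι≤ _ _) null-½^ (ι≤ _ _) (ι≤ _ _) hi-lo T-slope lo≤T T≤hi

  opaque
    β : R
    β = β-FixedPoint.x*

    lo≤β : lo ≤ β
    lo≤β = β-FixedPoint.a≤x*

    β≤hi : β ≤ hi
    β≤hi = β-FixedPoint.x*≤b

    Tβ≈β : T β ≈ β
    Tβ≈β = β-FixedPoint.fixed

  fβ≈0 : f β ≈ 0#
  fβ≈0 = begin-equality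
    f β  ≈⟨ solve 2 (λ x y → y := con (7 ∕ 1) :* (x :- (x :- con (1 ∕ 7) :* y))) refl β (f β) ⟩
    ι (7 ∕ 1) * (β - T β)  ≈⟨ *-cong refl (+-cong refl (-‿cong Tβ≈β)) ⟩
    ι (7 ∕ 1) * (β - β)  ≈⟨ solve 1 (λ x → con (7 ∕ 1) :* (x :- x) := con 0ℚ) refl β ⟩
    0#  ∎

  -- Computation in ℚ[β]: `k` is the quotient on dividing the difference of two polynomials in `β`
  -- by `f`, and the solver checks the resulting polynomial identity.
  modulo-f : ∀ k {x y} → x ≈ y + k * f β → x ≈ y
  modulo-f k {x} {y} h = trans h (trans (+-cong refl (*-cong refl fβ≈0)) (solve 2 (λ y k → y :+ k :* con 0ℚ := y) refl y k))

  0≤β : 0# ≤ β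
  0≤β = ≤-trans (ι≤ _ _) lo≤β

  0<β : 0# < β
  0<β = <-≤-trans (ι< _ _) lo≤β

  1≤β : 1# ≤ β
  1≤β = ≤-trans (ι≤ _ _) lo≤β

  -- The cubic reads β (β² - 2β - 1) = -1, so the inverse is a polynomial in `β`.
  β⁻¹ : R
  β⁻¹ = 1# + 2# * β - β * β

  β⁻¹P : ∀ {n} → Polynomial n → Polynomial n
  β⁻¹P x = con 1ℚ :+ con (2 ∕ 1) :* x :- x :* x

  β⁻¹*β : β⁻¹ * β ≈ 1#
  β⁻¹*β = modulo-f (- 1#) (solve 1 (λ x → β⁻¹P x :* x := con 1ℚ :+ :- con 1ℚ :* fP x) refl β)

  0≤β⁻¹ : 0# ≤ β⁻¹
  0≤β⁻¹ = ≤-by (ι (7 ∕ 16) + (hi * ι (1 ∕ 4) - β * (β - 2#)))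
    (+-nonNeg (ι≤ _ _) (diff-nonNeg (*-mono-≤ 0≤β (ι≤ _ _) β≤hi
      (≤-by (hi - β) (diff-nonNeg β≤hi) (solve 1 (λ x → con (1 ∕ 4) := x :- con (2 ∕ 1) :+ (con (9 ∕ 4) :- x)) refl β)))))
    (solve 1 (λ x → β⁻¹P x := con 0ℚ :+ (con (7 ∕ 16) :+ (con (9 ∕ 4) :* con (1 ∕ 4) :- x :* (x :- con (2 ∕ 1))))) refl β)

  β⁻¹≤5/11 : β⁻¹ ≤ ι (5 ∕ 11)
  β⁻¹≤5/11 = ≤-by (ι (5 ∕ 11) * (β⁻¹ * (β - lo))) (*-nonNeg (ι≤ _ _) (*-nonNeg 0≤β⁻¹ (diff-nonNeg lo≤β))) (begin-equality
    ι (5 ∕ 11)  ≈⟨ solve 0 (con (5 ∕ 11) := con (5 ∕ 11) :* con 1ℚ) refl ⟩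
    ι (5 ∕ 11) * 1#  ≈⟨ *-cong refl β⁻¹*β ⟨
    ι (5 ∕ 11) * (β⁻¹ * β)  ≈⟨ solve 2 (λ b x → con (5 ∕ 11) :* (b :* x) := b :+ con (5 ∕ 11) :* (b :* (x :- con (11 ∕ 5)))) refl β⁻¹ β ⟩
    β⁻¹ + ι (5 ∕ 11) * (β⁻¹ * (β - lo))  ∎)

  intR : ℤ → R
  intR i = ι (i ℚ./ 1)

  intR-+ : ∀ i j → intR (i ℤ.+ j) ≈ intR i + intR j
  intR-+ i j = trans (ι-cong (fromℤ-+ i j)) (ι-+ _ _)

  intR-* : ∀ i j → intR (i ℤ.* j) ≈ intR i * intR j
  intR-* i j = trans (ι-cong (fromℤ-* i j)) (ι-* _ _)

  intR-neg : ∀ i → intR (ℤ.- i) ≈ - intR i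
  intR-neg i = trans (ι-cong (fromℤ-neg i)) (ι-neg _)

  Bᴿ : ℕ → R
  Bᴿ n = intR (B n)

  Bᴿ-rec : ∀ n → Bᴿ (3 ℕ.+ n) ≈ 2# * Bᴿ (2 ℕ.+ n) + Bᴿ (1 ℕ.+ n) - Bᴿ n
  Bᴿ-rec n = trans (intR-+ (+ 2 ℤ.* B (2 ℕ.+ n) ℤ.+ B (1 ℕ.+ n)) (ℤ.- B n))
    (+-cong (trans (intR-+ (+ 2 ℤ.* B (2 ℕ.+ n)) (B (1 ℕ.+ n))) (+-cong (intR-* (+ 2) (B (2 ℕ.+ n))) refl)) (intR-neg (B n)))

  -- X³ - 2X² - X + 1 = (X - β) (X² + (β - 2) X + (β² - 2β - 1)), so that the second factor,
  -- read as a recurrence operator, leaves only the component of B along β^n.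
  cofactor : R → R → R → R
  cofactor x₂ x₁ x₀ = x₂ + (β - 2#) * x₁ + (β * β - 2# * β - 1#) * x₀

  cofactor-B : ∀ n → cofactor (Bᴿ (2 ℕ.+ n)) (Bᴿ (1 ℕ.+ n)) (Bᴿ n) ≈ (β * β + β - 1#) * β ^ n
  cofactor-B zero = solve 1 (λ x → con (6 ∕ 1) :+ (x :- con (2 ∕ 1)) :* con (3 ∕ 1) :+ (x :* x :- con (2 ∕ 1) :* x :- con 1ℚ) :* con (1 ∕ 1)
      := (x :* x :+ x :- con 1ℚ) :* con 1ℚ) refl β
  cofactor-B (suc n) = begin-equality
    cofactor (Bᴿ (3 ℕ.+ n)) (Bᴿ (2 ℕ.+ n)) (Bᴿ (1 ℕ.+ n))
      ≈⟨ +-cong (+-cong (Bᴿ-rec n) refl) refl ⟩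
    cofactor (2# * Bᴿ (2 ℕ.+ n) + Bᴿ (1 ℕ.+ n) - Bᴿ n) (Bᴿ (2 ℕ.+ n)) (Bᴿ (1 ℕ.+ n))
      ≈⟨ modulo-f (- Bᴿ n) (solve 4 (λ x b₂ b₁ b₀ → let q = x :* x :- con (2 ∕ 1) :* x :- con 1ℚ in
          (con (2 ∕ 1) :* b₂ :+ b₁ :- b₀) :+ (x :- con (2 ∕ 1)) :* b₂ :+ q :* b₁
          := x :* (b₂ :+ (x :- con (2 ∕ 1)) :* b₁ :+ q :* b₀) :+ :- b₀ :* fP x) refl β (Bᴿ (2 ℕ.+ n)) (Bᴿ (1 ℕ.+ n)) (Bᴿ n)) ⟩
    β * cofactor (Bᴿ (2 ℕ.+ n)) (Bᴿ (1 ℕ.+ n)) (Bᴿ n)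
      ≈⟨ *-cong refl (cofactor-B n) ⟩
    β * ((β * β + β - 1#) * β ^ n)
      ≈⟨ solve 3 (λ x e p → x :* (e :* p) := e :* (x :* p)) refl β (β * β + β - 1#) (β ^ n) ⟩
    (β * β + β - 1#) * (β * β ^ n) ∎

  -- The cofactor takes the value f′(β) = 3β² - 4β - 1 on the sequence β ^ n, so `cofactor-B` forces
  -- c = (β² + β - 1) / f′(β). Reduced modulo `f`, this is the polynomial below.
  c : R
  c = ι (1 ∕ 7) * (β * β + 2# * β - 1#)

  0≤c : 0# ≤ c
  0≤c = *-nonNeg (ι≤ _ _) (≤-by (β * β + (β + (β - 1#))) (+-nonNeg (*-nonNeg 0≤β 0≤β) (+-nonNeg 0≤β (diff-nonNeg 1≤β)))
    (solve 1 (λ x → x :* x :+ con (2 ∕ 1) :* x :- con 1ℚ := con 0ℚ :+ (x :* x :+ (x :+ (x :- con 1ℚ)))) refl β))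

  error : ℕ → R
  error n = Bᴿ n - c * β ^ n

  -- The cofactor annihilates the error, and its last coefficient β² - 2β - 1 is -β⁻¹.
  error-rec : ∀ n → error (2 ℕ.+ n) ≈ β⁻¹ * error n - (β - 2#) * error (1 ℕ.+ n)
  error-rec n = begin-equality
    b₂ - c * (β * (β * p))
      ≈⟨ modulo-f (- ι (1 ∕ 7) * (ι (8 ∕ 1) + ι (3 ∕ 1) * β) * p) (solve 5 (λ x b₂ b₁ b₀ p → let q = x :* x :- con (2 ∕ 1) :* x :- con 1ℚ in let c = con (1 ∕ 7) :* (x :* x :+ con (2 ∕ 1) :* x :- con 1ℚ) in
          b₂ :- c :* (x :* (x :* p)) :=
          ((b₂ :+ (x :- con (2 ∕ 1)) :* b₁ :+ q :* b₀) :- (x :* x :+ x :- con 1ℚ) :* p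
            :+ (β⁻¹P x :* (b₀ :- c :* p) :- (x :- con (2 ∕ 1)) :* (b₁ :- c :* (x :* p)))) :+ :- con (1 ∕ 7) :* (con (8 ∕ 1) :+ con (3 ∕ 1) :* x) :* p :* fP x) refl β b₂ b₁ b₀ p) ⟩
    cofactor b₂ b₁ b₀ - (β * β + β - 1#) * p + (β⁻¹ * error n - (β - 2#) * error (1 ℕ.+ n))
      ≈⟨ +-cong (+-cong (cofactor-B n) refl) refl ⟩
    (β * β + β - 1#) * p - (β * β + β - 1#) * p + (β⁻¹ * error n - (β - 2#) * error (1 ℕ.+ n))
      ≈⟨ solve 2 (λ a b → a :- a :+ b := b) refl ((β * β + β - 1#) * p) (β⁻¹ * error n - (β - 2#) * error (1 ℕ.+ n)) ⟩
    β⁻¹ * error n - (β - 2#) * error (1 ℕ.+ n) ∎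
    where
    b₂ = Bᴿ (2 ℕ.+ n)
    b₁ = Bᴿ (1 ℕ.+ n)
    b₀ = Bᴿ n
    p = β ^ n

  errorBound : R
  errorBound = ∣ error 0 ∣ + ∣ error 1 ∣

  0≤errorBound : 0# ≤ errorBound
  0≤errorBound = +-nonNeg (0≤∣∣ _) (0≤∣∣ _)

  -- The other two roots have modulus less than 1.
  error-bounded : ∀ n → ∣ error n ∣ ≤ errorBound
  error-bounded n = proj₁ (both n)
    where
    K = errorBound
    both : ∀ n → ∣ error n ∣ ≤ K × ∣ error (suc n) ∣ ≤ K
    both zero = ≤-by _ (0≤∣∣ _) refl , ≤-by _ (0≤∣∣ _) (solve 2 (λ a b → a :+ b := b :+ a) refl (∣ error 0 ∣) (∣ error 1 ∣))
    both (suc n) = let (h₀ , h₁) = both n in h₁ , (begin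
      ∣ error (2 ℕ.+ n) ∣  ≈⟨ ∣∣-cong (error-rec n) ⟩
      ∣ β⁻¹ * error n - (β - 2#) * error (1 ℕ.+ n) ∣  ≤⟨ ∣-∣≤ (∣c*∣≤ 0≤β⁻¹ h₀) (∣c*∣≤ (diff-nonNeg (≤-trans (ι≤ _ _) lo≤β)) h₁) ⟩
      β⁻¹ * K + (β - 2#) * K  ≤⟨ +-mono-≤ (*-monoˡ-≤ 0≤errorBound β⁻¹≤5/11) (*-monoˡ-≤ 0≤errorBound (+-mono-≤ β≤hi ≤-refl)) ⟩
      ι (5 ∕ 11) * K + (hi - 2#) * K  ≤⟨ ≤-by (ι (13 ∕ 44) * K) (*-nonNeg (ι≤ _ _) 0≤errorBound)
        (solve 1 (λ k → k := con (5 ∕ 11) :* k :+ (con (9 ∕ 4) :- con (2 ∕ 1)) :* k :+ con (13 ∕ 44) :* k) refl K) ⟩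
      K  ∎)

  private
    -- On [0, 1] the bounds exp x ≤ 3 and exp h - 1 ≤ 2h keep the difference quotients of `exp`
    -- between 1 and 6; hence the factor 1/6 and the contraction rate 5/6.
    S : R → R
    S x = x - ι (1 ∕ 6) * (exp x - β)

    expm1-bounds : ∀ {h} → 0# ≤ h → h ≤ 1# → h ≤ exp h - 1# × exp h - 1# ≤ 2# * h
    expm1-bounds {h} 0≤h h≤1 = diff-≤ (≤-respʳ (solve 2 (λ e h → e :- (con 1ℚ :+ h) := e :- con 1ℚ :- h) refl (exp h) h) (diff-nonNeg (1+x≤exp 0≤h))) ,
      ≤-trans (∣∣≤⇒≤ (∣exp-1∣≤ (≤-respˡ (sym ∣h∣≈h) h≤1))) (≤-reflexive (*-cong refl ∣h∣≈h))
      where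
      ∣h∣≈h = ∣∣-nonNeg 0≤h

    S-slope : ∀ {x y} → 0# ≤ x → x ≤ y → y ≤ 1# → 0# ≤ S y - S x × S y - S x ≤ ι (5 ∕ 6) * (y - x)
    S-slope {x} {y} 0≤x x≤y y≤1 =
      ≤-respʳ (sym difference) (diff-nonNeg (≤-trans (*-monoʳ-≤ (ι≤ _ _) (*-mono-≤ 0≤expx (*-nonNeg (ι≤ _ _) 0≤h) expx≤3 (proj₂ bounds)))
        (≤-reflexive (solve 1 (λ h → con (1 ∕ 6) :* (con (3 ∕ 1) :* (con (2 ∕ 1) :* h)) := h) refl h)))) ,
      ≤-trans (≤-reflexive difference) (≤-trans (+-monoʳ-≤ h (neg-mono-≤ (*-monoʳ-≤ (ι≤ _ _) (*-mono-≤ 0≤1 (≤-trans 0≤h (proj₁ bounds)) 1≤expx (proj₁ bounds)))))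
        (≤-reflexive (solve 1 (λ h → h :- con (1 ∕ 6) :* (con 1ℚ :* h) := con (5 ∕ 6) :* h) refl h)))
      where
      h = y - x
      0≤h : 0# ≤ h
      0≤h = diff-nonNeg x≤y
      h≤1 : h ≤ 1#
      h≤1 = ≤-trans (≤-by x 0≤x (solve 2 (λ x y → y := (y :- x) :+ x) refl x y)) y≤1
      bounds = expm1-bounds 0≤h h≤1
      1≤expx : 1# ≤ exp x
      1≤expx = ≤-trans (≤-by x 0≤x refl) (1+x≤exp 0≤x)
      0≤expx : 0# ≤ exp x
      0≤expx = ≤-trans 0≤1 1≤expx
      expx≤3 : exp x ≤ ι (3 ∕ 1)
      expx≤3 = begin
        exp x  ≈⟨ solve 1 (λ e → e := con 1ℚ :+ (e :- con 1ℚ)) refl (exp x) ⟩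
        1# + (exp x - 1#)  ≤⟨ +-monoʳ-≤ 1# (proj₂ (expm1-bounds 0≤x (≤-trans x≤y y≤1))) ⟩
        1# + 2# * x  ≤⟨ +-monoʳ-≤ 1# (*-monoʳ-≤ (ι≤ _ _) (≤-trans x≤y y≤1)) ⟩
        1# + 2# * 1#  ≈⟨ solve 0 (con 1ℚ :+ con (2 ∕ 1) :* con 1ℚ := con (3 ∕ 1)) refl ⟩
        ι (3 ∕ 1)  ∎
      difference : S y - S x ≈ h - ι (1 ∕ 6) * (exp x * (exp h - 1#))
      difference = trans (+-cong (+-cong refl (-‿cong (*-cong refl (+-cong (trans (exp-cong (solve 2 (λ x y → y := x :+ (y :- x)) refl x y)) (exp-+ x h)) refl)))) refl)
        (solve 5 (λ x y b ex eh → (y :- con (1 ∕ 6) :* (ex :* eh :- b)) :- (x :- con (1 ∕ 6) :* (ex :- b)) := (y :- x) :- con (1 ∕ 6) :* (ex :* (eh :- con 1ℚ))) refl x y β (exp x) (exp h))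

    null-5/6^ : Null (ι (5 ∕ 6) ^_)
    null-5/6^ = null-geometric {t = ι (1 ∕ 5)} (ι≤ _ _) (ι< _ _) (≤-reflexive (solve 0 (con (5 ∕ 6) :* (con 1ℚ :+ con (1 ∕ 5)) := con 1ℚ) refl))

    -- exp 1 is the square of exp ½ ≥ 3/2, and (3/2)² = 9/4 is the upper end of the interval around
    -- `β`. So the logarithm lies in [0, 1].
    β≤exp1 : β ≤ exp 1#
    β≤exp1 = begin
      β  ≤⟨ β≤hi ⟩
      hi  ≈⟨ solve 0 (con (9 ∕ 4) := (con 1ℚ :+ con ½) :* (con 1ℚ :+ con ½)) refl ⟩
      (1# + ι ½) * (1# + ι ½)  ≤⟨ *-mono-≤ (+-nonNeg 0≤1 (ι≤ _ _)) (≤-trans (+-nonNeg 0≤1 (ι≤ _ _)) (1+x≤exp (ι≤ _ _))) (1+x≤exp (ι≤ _ _)) (1+x≤exp (ι≤ _ _)) ⟩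
      exp (ι ½) * exp (ι ½)  ≈⟨ exp-+ (ι ½) (ι ½) ⟨
      exp (ι ½ + ι ½)  ≈⟨ exp-cong (solve 0 (con ½ :+ con ½ := con 1ℚ) refl) ⟩
      exp 1#  ∎

    1-0 : 1# - 0# ≤ ι (6 ∕ 1) - ι (6 ∕ 1) * ι (5 ∕ 6)
    1-0 = ≤-reflexive (solve 0 (con 1ℚ :- con 0ℚ := con (6 ∕ 1) :- con (6 ∕ 1) :* con (5 ∕ 6)) refl)

    0≤S : 0# ≤ S 0#
    0≤S = ≤-by (ι (1 ∕ 6) * (β - 1#)) (*-nonNeg (ι≤ _ _) (diff-nonNeg 1≤β))
      (trans (+-cong refl (-‿cong (*-cong refl (+-cong (exp-0 refl) refl))))
        (solve 1 (λ b → con 0ℚ :- con (1 ∕ 6) :* (con 1ℚ :- b) := con 0ℚ :+ con (1 ∕ 6) :* (b :- con 1ℚ)) refl β))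

    S≤1 : S 1# ≤ 1#
    S≤1 = ≤-by (ι (1 ∕ 6) * (exp 1# - β)) (*-nonNeg (ι≤ _ _) (diff-nonNeg β≤exp1))
      (solve 1 (λ z → con 1ℚ := con 1ℚ :- z :+ z) refl (ι (1 ∕ 6) * (exp 1# - β)))

    module L-FixedPoint = FixedPoint S 0# 1# (ι (5 ∕ 6)) (ι (6 ∕ 1)) (ι≤ _ _) null-5/6^ (ι≤ _ _) 0≤1 1-0 S-slope 0≤S S≤1

  opaque
    ln-β : R
    ln-β = L-FixedPoint.x*

    S-ln-β : S ln-β ≈ ln-β
    S-ln-β = L-FixedPoint.fixed

  exp-ln-β : exp ln-β ≈ β
  exp-ln-β = begin-equality
    exp ln-β  ≈⟨ solve 3 (λ x b e → e := b :+ con (6 ∕ 1) :* (x :- (x :- con (1 ∕ 6) :* (e :- b)))) refl ln-β β (exp ln-β) ⟩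
    β + ι (6 ∕ 1) * (ln-β - S ln-β)  ≈⟨ +-cong refl (*-cong refl (+-cong refl (-‿cong S-ln-β))) ⟩
    β + ι (6 ∕ 1) * (ln-β - ln-β)  ≈⟨ solve 2 (λ b x → b :+ con (6 ∕ 1) :* (x :- x) := b) refl β ln-β ⟩
    β  ∎

-- No complex root exceeds β in modulus

module Dominance (𝓡 : RealField) where
  open Ordered 𝓡
  open DominantRoot 𝓡

  -- The other two roots, about 0.555 and -0.802. They are polynomials in `β` because the cubic has
  -- square discriminant 49; `e₂≈` and `e₃≈` are Vieta's relations.
  γ δ : R
  γ = β * β - 2# * β
  δ = 2# + β - β * β

  norm : R → R → R
  norm x y = x * x + y * y

  norm-* : ∀ a b c d → norm (a * c - b * d) (a * d + b * c) ≈ norm a b * norm c d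
  norm-* = solve 4 (λ a b c d → (a :* c :- b :* d) :* (a :* c :- b :* d) :+ (a :* d :+ b :* c) :* (a :* d :+ b :* c)
    := (a :* a :+ b :* b) :* (c :* c :+ d :* d)) refl

  -- |z - a|² |z + a|² = (|z|² - a²)² + 4 a² (im z)².
  norm-conjugate : ∀ {x y a} → 0# ≤ β → a * a ≤ β * β → β * β < norm x y → 0# < norm (x - a) y * norm (x + a) y
  norm-conjugate {x} {y} {a} 0≤β a²≤ β²<S = <-≤-trans (*-pos 0<d 0<d)
    (≤-by (ι (4 ∕ 1) * (a * a * (y * y))) (*-nonNeg (ι≤ _ _) (*-nonNeg (square-nonNeg a) (square-nonNeg y)))
      (solve 3 (λ x y a → ((x :- a) :* (x :- a) :+ y :* y) :* ((x :+ a) :* (x :+ a) :+ y :* y) :=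
        (x :* x :+ y :* y :- a :* a) :* (x :* x :+ y :* y :- a :* a) :+ con (4 ∕ 1) :* (a :* a :* (y :* y))) refl x y a))
    where
    0<d : 0# < norm x y - a * a
    0<d = diff-pos (≤-<-trans a²≤ β²<S)

  square-≤ : ∀ {a} → 0# ≤ a → a ≤ β → a * a ≤ β * β
  square-≤ 0≤a a≤β = *-mono-≤ 0≤a 0≤β a≤β a≤β

  0≤β-2 : 0# ≤ β - 2#
  0≤β-2 = diff-nonNeg (≤-trans (ι≤ _ _) lo≤β)

  β-2≤½ : β - 2# ≤ ι ½
  β-2≤½ = ≤-trans (+-mono-≤ β≤hi ≤-refl) (≤-by (ι (1 ∕ 4)) (ι≤ _ _) (solve 0 (con ½ := con (9 ∕ 4) :- con (2 ∕ 1) :+ con (1 ∕ 4)) refl))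

  γ²≤β² : γ * γ ≤ β * β
  γ²≤β² = square-≤ (≤-respʳ γ≈ (*-nonNeg 0≤β 0≤β-2))
    (≤-respˡ γ≈ (≤-trans (*-monoʳ-≤ 0≤β β-2≤½) (≤-by (ι ½ * β) (*-nonNeg (ι≤ _ _) 0≤β) (solve 1 (λ b → b := b :* con ½ :+ con ½ :* b) refl β))))
    where
    γ≈ : β * (β - 2#) ≈ γ
    γ≈ = solve 1 (λ b → b :* (b :- con (2 ∕ 1)) := b :* b :- con (2 ∕ 1) :* b) refl β

  δ²≤β² : δ * δ ≤ β * β
  δ²≤β² = ≤-respˡ (solve 1 (λ b → let e = (b :- con (2 ∕ 1)) :* (b :+ con 1ℚ) in let d = con (2 ∕ 1) :+ b :- b :* b in e :* e := d :* d) refl β)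
    (square-≤ (*-nonNeg 0≤β-2 (+-nonNeg 0≤β 0≤1))
      (≤-trans (*-monoˡ-≤ (+-nonNeg 0≤β 0≤1) β-2≤½) (≤-by (ι ½ * (β - 1#)) (*-nonNeg (ι≤ _ _) (diff-nonNeg 1≤β))
        (solve 1 (λ b → b := con ½ :* (b :+ con 1ℚ) :+ con ½ :* (b :- con 1ℚ)) refl β))))

  e₂≈ : β * γ + β * δ + γ * δ ≈ - 1#
  e₂≈ = modulo-f (1# - β) (solve 1 (λ b → let c = b :* b :- con (2 ∕ 1) :* b in let d = con (2 ∕ 1) :+ b :- b :* b in
    b :* c :+ b :* d :+ c :* d := :- con 1ℚ :+ (con 1ℚ :- b) :* fP b) refl β)

  e₃≈ : β * γ * δ ≈ - 1#
  e₃≈ = modulo-f (1# + β - β * β) (solve 1 (λ b → let c = b :* b :- con (2 ∕ 1) :* b in let d = con (2 ∕ 1) :+ b :- b :* b in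
    b :* c :* d := :- con 1ℚ :+ (con 1ℚ :+ b :- b :* b) :* fP b) refl β)

  -- The hypotheses are the real and imaginary parts of z³ - 2z² - z + 1 = 0 for z = x + i y.
  root-bound : ∀ x y →
    (x * x - y * y) * x - (x * y + y * x) * y - (2# * (x * x - y * y) - 0# * (x * y + y * x)) - x + 1# ≈ 0# →
    (x * x - y * y) * y + (x * y + y * x) * x - (2# * (x * y + y * x) + 0# * (x * x - y * y)) - y + 0# ≈ 0# →
    norm x y ≤ β * β
  root-bound x y re≈0 im≈0 = ≮⇒≥ λ β²<S → <-irrefl (begin-strict
    0#
      -- If ∣z∣ > β, no root can equal z. Pairing each factor ∣z - a∣² with ∣z + a∣² makes the
      -- positivity visible without square roots, whereas the factors ∣z - a∣² alone multiply to
      -- ∣f(z)∣² = 0.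
      <⟨ *-pos (*-pos (norm-conjugate 0≤β ≤-refl β²<S) (norm-conjugate 0≤β γ²≤β² β²<S)) (norm-conjugate 0≤β δ²≤β² β²<S) ⟩
    (Nβ * Nβ′) * (Nγ * Nγ′) * (Nδ * Nδ′)
      ≈⟨ solve 6 (λ a a′ b b′ c c′ → (a :* a′) :* (b :* b′) :* (c :* c′) := (a :* b :* c) :* (a′ :* b′ :* c′)) refl Nβ Nβ′ Nγ Nγ′ Nδ Nδ′ ⟩
    (Nβ * Nγ * Nδ) * (Nβ′ * Nγ′ * Nδ′)
      ≈⟨ *-cong product≈0 refl ⟩
    0# * (Nβ′ * Nγ′ * Nδ′)
      ≈⟨ solve 1 (λ a → con 0ℚ :* a := con 0ℚ) refl (Nβ′ * Nγ′ * Nδ′) ⟩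
    0# ∎)
    where
    Nβ = norm (x - β) y
    Nγ = norm (x - γ) y
    Nδ = norm (x - δ) y
    Nβ′ = norm (x + β) y
    Nγ′ = norm (x + γ) y
    Nδ′ = norm (x + δ) y
    p r : R
    p = (x - β) * (x - γ) - y * y
    r = (x - β) * y + y * (x - γ)
    re : p * (x - δ) - r * y ≈ 0#
    re = begin-equality
      p * (x - δ) - r * y
        ≈⟨ solve 3 (λ x y b → let c = b :* b :- con (2 ∕ 1) :* b in let d = con (2 ∕ 1) :+ b :- b :* b in
             ((x :- b) :* (x :- c) :- y :* y) :* (x :- d) :- ((x :- b) :* y :+ y :* (x :- c)) :* y :=
             ((x :* x :- y :* y) :* x :- (x :* y :+ y :* x) :* y :- (con (2 ∕ 1) :* (x :* x :- y :* y) :- con 0ℚ :* (x :* y :+ y :* x)) :- x :+ con 1ℚ)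
             :+ ((b :* c :+ b :* d :+ c :* d) :+ con 1ℚ) :* x :- (b :* c :* d :+ con 1ℚ)) refl x y β ⟩
      _ + (β * γ + β * δ + γ * δ + 1#) * x - (β * γ * δ + 1#)
        ≈⟨ +-cong (+-cong re≈0 (*-cong (+-cong e₂≈ refl) refl)) (-‿cong (+-cong e₃≈ refl)) ⟩
      0# + (- 1# + 1#) * x - (- 1# + 1#)
        ≈⟨ solve 1 (λ x → con 0ℚ :+ (:- con 1ℚ :+ con 1ℚ) :* x :- (:- con 1ℚ :+ con 1ℚ) := con 0ℚ) refl x ⟩
      0# ∎
    im : p * y + r * (x - δ) ≈ 0#
    im = begin-equality
      p * y + r * (x - δ)
        ≈⟨ solve 3 (λ x y b → let c = b :* b :- con (2 ∕ 1) :* b in let d = con (2 ∕ 1) :+ b :- b :* b in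
             ((x :- b) :* (x :- c) :- y :* y) :* y :+ ((x :- b) :* y :+ y :* (x :- c)) :* (x :- d) :=
             ((x :* x :- y :* y) :* y :+ (x :* y :+ y :* x) :* x :- (con (2 ∕ 1) :* (x :* y :+ y :* x) :+ con 0ℚ :* (x :* x :- y :* y)) :- y :+ con 0ℚ)
             :+ ((b :* c :+ b :* d :+ c :* d) :+ con 1ℚ) :* y) refl x y β ⟩
      _ + (β * γ + β * δ + γ * δ + 1#) * y
        ≈⟨ +-cong im≈0 (*-cong (+-cong e₂≈ refl) refl) ⟩
      0# + (- 1# + 1#) * y
        ≈⟨ solve 1 (λ x → con 0ℚ :+ (:- con 1ℚ :+ con 1ℚ) :* x := con 0ℚ) refl y ⟩
      0# ∎
    product≈0 : Nβ * Nγ * Nδ ≈ 0#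
    product≈0 = begin-equality
      Nβ * Nγ * Nδ  ≈⟨ *-cong (norm-* (x - β) y (x - γ) y) refl ⟨
      norm p r * Nδ  ≈⟨ norm-* p r (x - δ) y ⟨
      norm (p * (x - δ) - r * y) (p * y + r * (x - δ)) ≈⟨ +-cong (*-cong re re) (*-cong im im) ⟩
      0# * 0# + 0# * 0#  ≈⟨ solve 0 (con 0ℚ :* con 0ℚ :+ con 0ℚ :* con 0ℚ := con 0ℚ) refl ⟩
      0#  ∎

  -- The vanishing imaginary parts are kept so that this is literally the real part of
  -- `IsRoot (ofℝ β)`.
  β-root : (β * β - 0# * 0#) * β - (β * 0# + 0# * β) * 0# - (2# * (β * β - 0# * 0#) - 0# * (β * 0# + 0# * β)) - β + 1# ≈ 0#
  β-root = trans (solve 1 (λ b → (b :* b :- con 0ℚ :* con 0ℚ) :* b :- (b :* con 0ℚ :+ con 0ℚ :* b) :* con 0ℚ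
      :- (con (2 ∕ 1) :* (b :* b :- con 0ℚ :* con 0ℚ) :- con 0ℚ :* (b :* con 0ℚ :+ con 0ℚ :* b)) :- b :+ con 1ℚ := fP b) refl β) fβ≈0

  β-root-im : (β * β - 0# * 0#) * 0# + (β * 0# + 0# * β) * β - (2# * (β * 0# + 0# * β) + 0# * (β * β - 0# * 0#)) - 0# + 0# ≈ 0#
  β-root-im = solve 1 (λ b → (b :* b :- con 0ℚ :* con 0ℚ) :* con 0ℚ :+ (b :* con 0ℚ :+ con 0ℚ :* b) :* b
      :- (con (2 ∕ 1) :* (b :* con 0ℚ :+ con 0ℚ :* b) :+ con 0ℚ :* (b :* b :- con 0ℚ :* con 0ℚ)) :- con 0ℚ :+ con 0ℚ := con 0ℚ) refl β

  norm≤norm-β : ∀ {S} → S ≤ β * β → S ≤ norm β 0#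
  norm≤norm-β h = ≤-trans h (≤-reflexive (solve 1 (λ b → b :* b := b :* b :+ con 0ℚ :* con 0ℚ) refl β))

-- The golden ratio

module Golden (𝓡 : RealField) (s : RealField.R 𝓡)
  (s²≈5 : RealField._≈_ 𝓡 (RealField._*_ 𝓡 s s) (RealField.ι 𝓡 (5 ∕ 1)))
  (0≤s : RealField._≤_ 𝓡 (RealField.ι 𝓡 0ℚ) s) where
  open Ordered 𝓡

  φ : R
  φ = (1# + s) * ι ½

  φ²≈φ+1 : φ * φ ≈ φ + 1#
  φ²≈φ+1 = trans (solve 1 (λ s → ((con 1ℚ :+ s) :* con ½) :* ((con 1ℚ :+ s) :* con ½) := ((con 1ℚ :+ s) :* con ½) :- con (1 ∕ 4) :+ con (1 ∕ 4) :* (s :* s)) refl s)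
    (trans (+-cong refl (*-cong refl s²≈5)) (solve 1 (λ p → p :- con (1 ∕ 4) :+ con (1 ∕ 4) :* con (5 ∕ 1) := p :+ con 1ℚ) refl φ))

  1≤s : 1# ≤ s
  1≤s = ≮⇒≥ λ s<1 → <-irrefl (begin-strict
    ι (5 ∕ 1)  ≈⟨ s²≈5 ⟨
    s * s  ≤⟨ *-mono-≤ 0≤s 0≤1 (<⇒≤ s<1) (<⇒≤ s<1) ⟩
    1# * 1#  ≈⟨ solve 0 (con 1ℚ :* con 1ℚ := con 1ℚ) refl ⟩
    1#  <⟨ ι< _ _ ⟩
    ι (5 ∕ 1)  ∎)

  s≤5/2 : s ≤ ι (5 ∕ 2)
  s≤5/2 = ≮⇒≥ λ 5/2<s → <-irrefl (begin-strict
    ι (5 ∕ 1)  <⟨ ι< _ (25 ∕ 4) ⟩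
    ι (25 ∕ 4)  ≈⟨ solve 0 (con (25 ∕ 4) := con (5 ∕ 2) :* con (5 ∕ 2)) refl ⟩
    ι (5 ∕ 2) * ι (5 ∕ 2)  ≤⟨ *-mono-≤ (ι≤ _ _) 0≤s (<⇒≤ 5/2<s) (<⇒≤ 5/2<s) ⟩
    s * s  ≈⟨ s²≈5 ⟩
    ι (5 ∕ 1)  ∎)

  1≤φ : 1# ≤ φ
  1≤φ = ≤-by (ι ½ * (s - 1#)) (*-nonNeg (ι≤ _ _) (diff-nonNeg 1≤s)) (solve 1 (λ s → (con 1ℚ :+ s) :* con ½ := con 1ℚ :+ con ½ :* (s :- con 1ℚ)) refl s)

  φ<2 : φ < 2#
  φ<2 = ≤-<-trans (≤-by (ι ½ * (ι (5 ∕ 2) - s)) (*-nonNeg (ι≤ _ _) (diff-nonNeg s≤5/2))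
    (solve 1 (λ s → con (7 ∕ 4) := (con 1ℚ :+ s) :* con ½ :+ con ½ :* (con (5 ∕ 2) :- s)) refl s)) (ι< (7 ∕ 4) (2 ∕ 1))

F-mono-≤ : ∀ {m n} → m ℕ.≤ n → F m ℕ.≤ F n
F-mono-≤ {m} {n} m≤n = ≡.subst (λ k → F m ℕ.≤ F k) (ℕ.m∸n+n≡m m≤n) (go (n ℕ.∸ m))
  where
  go : ∀ k → F m ℕ.≤ F (k ℕ.+ m)
  go zero    = ℕ.≤-refl
  go (suc k) = ℕ.≤-trans (go k) (F-mono (k ℕ.+ m))

rep-long : ∀ k n r → rep n ≡ 1F ∷ 0F ∷ r → F (2 ℕ.+ k) ℕ.≤ n → k ℕ.≤ length r
rep-long k n r e F≤n = ℕ.≮⇒≥ λ r<k → contradiction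
  (ℕ.<-≤-trans (≡.subst₂ (λ m w → m ℕ.< F (length w)) (value-rep n) e (tail-value< (rep n) (proj₂ (rep-normal n))))
    (F-mono-≤ (ℕ.s≤s (ℕ.s≤s (ℕ.<⇒≤ r<k)))))
  (ℕ.≤⇒≯ F≤n)

-- The refinement equation

module Zeckendorf (𝓡 : RealField) (φ : RealField.R 𝓡)
  (φ²≈φ+1 : RealField._≈_ 𝓡 (RealField._*_ 𝓡 φ φ) (RealField._+_ 𝓡 φ (RealField.ι 𝓡 1ℚ)))
  (1≤φ : RealField._≤_ 𝓡 (RealField.ι 𝓡 1ℚ) φ) (φ<2 : RealField._<_ 𝓡 φ (RealField.ι 𝓡 (2 ∕ 1))) where
  open Ordered 𝓡 public
  open DominantRoot 𝓡 public
  open Words using (X; Y; Sx; Sy; Sx-0; Sy-0; Sx-1; Sy-1; Y≡B; summatory; linked-10; rep-10)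

  0≤φ : 0# ≤ φ
  0≤φ = ≤-trans 0≤1 1≤φ

  ∣∣-nonPos : ∀ {x} → x ≤ 0# → ∣ x ∣ ≈ - x
  ∣∣-nonPos {x} x≤0 = ≤-antisym
    (∣∣-lub (diff-≤ (≤-respʳ (solve 1 (λ x → (con 0ℚ :- x) :+ (con 0ℚ :- x) := :- x :- x) refl x) (+-nonNeg (diff-nonNeg x≤0) (diff-nonNeg x≤0)))) ≤-refl)
    (-x≤∣x∣ x)

  ∣∣-lipschitz : ∀ x y → ∣ ∣ x ∣ - ∣ y ∣ ∣ ≤ ∣ x - y ∣
  ∣∣-lipschitz x y = ∣∣-lub (one-sided x y) (≤-respˡ (solve 2 (λ a b → b :- a := :- (a :- b)) refl (∣ x ∣) (∣ y ∣)) (≤-trans (one-sided y x) (∣∣-swap x y ≤-refl)))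
    where
    one-sided : ∀ x y → ∣ x ∣ - ∣ y ∣ ≤ ∣ x - y ∣
    one-sided x y = ≤-trans (+-mono-≤ (∣∣≤-resp (solve 2 (λ x y → (x :- y) :+ y := x) refl x y) (∣+∣≤ (≤-refl {∣ x - y ∣}) (≤-refl {∣ y ∣}))) ≤-refl)
      (≤-reflexive (solve 2 (λ a b → a :+ b :- b := a) refl (∣ x - y ∣) (∣ y ∣)))

  -- max(0, min(1, x)), expressed by absolute values so that it is defined and Lipschitz without
  -- comparing x with 0 and 1.
  clamp : R → R
  clamp x = ι ½ * (1# + ∣ x ∣ - ∣ x - 1# ∣)

  clamp-nonPos : ∀ {x} → x ≤ 0# → clamp x ≈ 0#
  clamp-nonPos {x} x≤0 = trans (*-cong refl (+-cong (+-cong refl (∣∣-nonPos x≤0))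
      (-‿cong (∣∣-nonPos {x - 1#} (≤-trans (+-mono-≤ x≤0 ≤-refl) (≤-by 1# 0≤1 (solve 0 (con 0ℚ := con 0ℚ :- con 1ℚ :+ con 1ℚ) refl)))))))
    (solve 1 (λ x → con ½ :* (con 1ℚ :+ :- x :- :- (x :- con 1ℚ)) := con 0ℚ) refl x)

  clamp-≥1 : ∀ {x} → 1# ≤ x → clamp x ≈ 1#
  clamp-≥1 {x} 1≤x = trans (*-cong refl (+-cong (+-cong refl (∣∣-nonNeg (≤-trans 0≤1 1≤x))) (-‿cong (∣∣-nonNeg (diff-nonNeg 1≤x)))))
    (solve 1 (λ x → con ½ :* (con 1ℚ :+ x :- (x :- con 1ℚ)) := con 1ℚ) refl x)

  clamp-lipschitz : ∀ x y → ∣ clamp x - clamp y ∣ ≤ ∣ x - y ∣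
  clamp-lipschitz x y = begin
    ∣ clamp x - clamp y ∣
      ≈⟨ ∣∣-cong (solve 4 (λ a b c d → con ½ :* (con 1ℚ :+ a :- b) :- con ½ :* (con 1ℚ :+ c :- d) := con ½ :* ((a :- c) :- (b :- d))) refl (∣ x ∣) (∣ x - 1# ∣) (∣ y ∣) (∣ y - 1# ∣)) ⟩
    ∣ ι ½ * ((∣ x ∣ - ∣ y ∣) - (∣ x - 1# ∣ - ∣ y - 1# ∣)) ∣
      ≤⟨ ∣c*∣≤ (ι≤ _ _) (∣-∣≤ (∣∣-lipschitz x y) (≤-trans (∣∣-lipschitz (x - 1#) (y - 1#)) (∣∣-mono (solve 2 (λ x y → (x :- con 1ℚ) :- (y :- con 1ℚ) := x :- y) refl x y)))) ⟩
    ι ½ * (∣ x - y ∣ + ∣ x - y ∣)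
      ≈⟨ solve 1 (λ a → con ½ :* (a :+ a) := a) refl (∣ x - y ∣) ⟩
    ∣ x - y ∣ ∎

  ∣clamp∣≤1 : ∀ x → ∣ clamp x ∣ ≤ 1#
  ∣clamp∣≤1 x = ∣∣-lub
    (≤-by (ι ½ * (∣ x - 1# ∣ + 1# - ∣ x ∣)) (*-nonNeg (ι≤ _ _) (diff-nonNeg (∣∣≤-resp (solve 1 (λ x → (x :- con 1ℚ) :+ con 1ℚ := x) refl x) (∣+∣≤ ≤-refl (≤-reflexive (∣∣-nonNeg 0≤1))))))
      (solve 2 (λ a b → con 1ℚ := con ½ :* (con 1ℚ :+ a :- b) :+ con ½ :* (b :+ con 1ℚ :- a)) refl (∣ x ∣) (∣ x - 1# ∣)))
    (≤-by (1# + ι ½ * (1# + ∣ x ∣ - ∣ x - 1# ∣)) (+-nonNeg 0≤1 (*-nonNeg (ι≤ _ _) (diff-nonNeg (≤-trans (∣-∣≤ (≤-refl {∣ x ∣}) (≤-reflexive (∣∣-nonNeg 0≤1))) (≤-reflexive (solve 1 (λ a → a :+ con 1ℚ := con 1ℚ :+ a) refl (∣ x ∣)))))))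
      (solve 1 (λ a → con 1ℚ := :- a :+ (con 1ℚ :+ a)) refl (clamp x)))

  -- (X₁ , 1) is, up to scaling, the limit of the sums over all words of length k divided by β^k.
  X₁ : R
  X₁ = β * β - β - 1#

  X₁P : ∀ {n} → Polynomial n → Polynomial n
  X₁P x = x :* x :- x :- con 1ℚ

  -- (X₁ , 1) is fixed by β⁻¹ M₀ + β⁻² M₁ M₀, so the boundary value on [1, ∞) is compatible with the
  -- equation.
  full-X : β⁻¹ * (X₁ + 1#) + β⁻¹ * β⁻¹ * (X₁ + 1#) ≈ X₁
  full-X = modulo-f (β * β * β - ι (3 ∕ 1) * (β * β) + 1#) (solve 1 (λ x →
    β⁻¹P x :* (X₁P x :+ con 1ℚ) :+ β⁻¹P x :* β⁻¹P x :* (X₁P x :+ con 1ℚ) := X₁P x :+ (x :* x :* x :- con (3 ∕ 1) :* (x :* x) :+ con 1ℚ) :* fP x) refl β)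

  full-Y : β⁻¹ * 1# + β⁻¹ * β⁻¹ * (X₁ + 1#) ≈ 1#
  full-Y = modulo-f (β * β * β - ι (3 ∕ 1) * (β * β) + β) (solve 1 (λ x →
    β⁻¹P x :* con 1ℚ :+ β⁻¹P x :* β⁻¹P x :* (X₁P x :+ con 1ℚ) := con 1ℚ :+ (x :* x :* x :- con (3 ∕ 1) :* (x :* x) :+ x) :* fP x) refl β)

  β⁻¹*full : β⁻¹ * (X₁ + 1#) ≈ β - 1#
  β⁻¹*full = modulo-f (1# - β) (solve 1 (λ x → β⁻¹P x :* (X₁P x :+ con 1ℚ) := x :- con 1ℚ :+ (con 1ℚ :- x) :* fP x) refl β)

  ∣X₁∣≤2 : ∣ X₁ ∣ ≤ 2#
  ∣X₁∣≤2 = ≤-respˡ (sym (∣∣-nonNeg (≤-by (β * (β - 2#) + (β - 1#)) (+-nonNeg (*-nonNeg 0≤β (diff-nonNeg (≤-trans (ι≤ _ _) lo≤β))) (diff-nonNeg 1≤β))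
      (solve 1 (λ x → X₁P x := con 0ℚ :+ (x :* (x :- con (2 ∕ 1)) :+ (x :- con 1ℚ))) refl β))))
    (≤-by (hi * (hi - 1#) - β * (β - 1#) + ι (3 ∕ 16)) (+-nonNeg (diff-nonNeg (*-mono-≤ 0≤β (diff-nonNeg (ι≤ 1ℚ (9 ∕ 4))) β≤hi (+-mono-≤ β≤hi ≤-refl))) (ι≤ _ _))
      (solve 1 (λ x → con (2 ∕ 1) := X₁P x :+ (con (9 ∕ 4) :* (con (9 ∕ 4) :- con 1ℚ) :- x :* (x :- con 1ℚ) :+ con (3 ∕ 16))) refl β))

  ψ : R → R
  ψ α = φ * (φ * α - 1#)

  -- Iterates of the refinement operator, started from a function that already has the prescribed
  -- values outside (0, 1). The summand `0#` gives both components the same shape, so one set of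
  -- estimates serves both.
  hX hY : ℕ → R → R
  hX zero    α = X₁ * clamp α
  hX (suc n) α = β⁻¹ * (hX n (φ * α) + hY n (φ * α)) + β⁻¹ * β⁻¹ * (hX n (ψ α) + hY n (ψ α))
  hY zero    α = clamp α
  hY (suc n) α = β⁻¹ * (0# + hY n (φ * α)) + β⁻¹ * β⁻¹ * (hX n (ψ α) + hY n (ψ α))

  φ*-nonPos : ∀ {α} → α ≤ 0# → φ * α ≤ 0#
  φ*-nonPos α≤0 = ≤-trans (*-monoʳ-≤ 0≤φ α≤0) (≤-reflexive (solve 1 (λ p → p :* con 0ℚ := con 0ℚ) refl φ))

  ψ-nonPos : ∀ {α} → φ * α ≤ 1# → ψ α ≤ 0#
  ψ-nonPos h = φ*-nonPos (≤-trans (+-mono-≤ h ≤-refl) (≤-reflexive (solve 0 (con 1ℚ :- con 1ℚ := con 0ℚ) refl)))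

  1≤φ* : ∀ {α} → 1# ≤ α → 1# ≤ φ * α
  1≤φ* {α} 1≤α = ≤-trans (≤-reflexive (solve 0 (con 1ℚ := con 1ℚ :* con 1ℚ) refl)) (*-mono-≤ 0≤1 (≤-trans 0≤1 1≤α) 1≤φ 1≤α)

  1≤ψ : ∀ {α} → 1# ≤ α → 1# ≤ ψ α
  1≤ψ {α} 1≤α = ≤-by (φ * (φ * (α - 1#))) (*-nonNeg 0≤φ (*-nonNeg 0≤φ (diff-nonNeg 1≤α)))
    (trans (solve 2 (λ p a → p :* (p :* a :- con 1ℚ) := (p :* p :- p) :+ p :* (p :* (a :- con 1ℚ))) refl φ α)
      (+-cong (trans (+-cong φ²≈φ+1 refl) (solve 1 (λ p → p :+ con 1ℚ :- p := con 1ℚ) refl φ)) refl))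

  zero-sum : β⁻¹ * (0# + 0#) + β⁻¹ * β⁻¹ * (0# + 0#) ≈ 0#
  zero-sum = solve 1 (λ b → b :* (con 0ℚ :+ con 0ℚ) :+ b :* b :* (con 0ℚ :+ con 0ℚ) := con 0ℚ) refl β⁻¹

  combine-cong : ∀ {p p′ q q′ r r′ s s′} → p ≈ p′ → q ≈ q′ → r ≈ r′ → s ≈ s′ →
    β⁻¹ * (p + q) + β⁻¹ * β⁻¹ * (r + s) ≈ β⁻¹ * (p′ + q′) + β⁻¹ * β⁻¹ * (r′ + s′)
  combine-cong p q r s = +-cong (*-cong refl (+-cong p q)) (*-cong refl (+-cong r s))

  h-nonPos : ∀ n {α} → α ≤ 0# → hX n α ≈ 0# × hY n α ≈ 0#
  h-nonPos zero    α≤0 = trans (*-cong refl (clamp-nonPos α≤0)) (solve 1 (λ x → x :* con 0ℚ := con 0ℚ) refl X₁) , clamp-nonPos α≤0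
  h-nonPos (suc n) α≤0 =
    let (x₀ , y₀) = h-nonPos n (φ*-nonPos α≤0)
        (x₁ , y₁) = h-nonPos n (ψ-nonPos (≤-trans (φ*-nonPos α≤0) 0≤1))
    in trans (combine-cong x₀ y₀ x₁ y₁) zero-sum , trans (combine-cong refl y₀ x₁ y₁) zero-sum

  h-≥1 : ∀ n {α} → 1# ≤ α → hX n α ≈ X₁ × hY n α ≈ 1#
  h-≥1 zero    1≤α = trans (*-cong refl (clamp-≥1 1≤α)) (solve 1 (λ x → x :* con 1ℚ := x) refl X₁) , clamp-≥1 1≤α
  h-≥1 (suc n) 1≤α =
    let (x₀ , y₀) = h-≥1 n (1≤φ* 1≤α)
        (x₁ , y₁) = h-≥1 n (1≤ψ 1≤α)
    in trans (combine-cong x₀ y₀ x₁ y₁) full-X , trans (combine-cong refl y₀ x₁ y₁)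
         (trans (+-cong (*-cong refl (solve 0 (con 0ℚ :+ con 1ℚ := con 1ℚ) refl)) refl) full-Y)

  -- 2 * 5/11 and 2 * (5/11)², the norms of the two terms when `β⁻¹` is replaced by 5/11.
  q κ : R
  q = ι (10 ∕ 11)
  κ = ι (50 ∕ 121)

  ∣combine∣≤ : ∀ {p q′ r s A A′} → ∣ p ∣ ≤ A → ∣ q′ ∣ ≤ A → ∣ r ∣ ≤ A′ → ∣ s ∣ ≤ A′ →
    ∣ β⁻¹ * (p + q′) + β⁻¹ * β⁻¹ * (r + s) ∣ ≤ q * A + κ * A′
  ∣combine∣≤ {A = A} {A′} p≤ q≤ r≤ s≤ = begin
    _  ≤⟨ ∣+∣≤ (∣c*∣≤ 0≤β⁻¹ (∣+∣≤ p≤ q≤)) (∣c*∣≤ (*-nonNeg 0≤β⁻¹ 0≤β⁻¹) (∣+∣≤ r≤ s≤)) ⟩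
    β⁻¹ * (A + A) + β⁻¹ * β⁻¹ * (A′ + A′)  ≤⟨ +-mono-≤ (*-monoˡ-≤ (+-nonNeg 0≤A 0≤A) β⁻¹≤5/11)
                                                               (*-monoˡ-≤ (+-nonNeg 0≤A′ 0≤A′) (*-mono-≤ 0≤β⁻¹ (ι≤ _ _) β⁻¹≤5/11 β⁻¹≤5/11)) ⟩
    ι (5 ∕ 11) * (A + A) + ι (5 ∕ 11) * ι (5 ∕ 11) * (A′ + A′)
      ≈⟨ solve 2 (λ a b → con (5 ∕ 11) :* (a :+ a) :+ con (5 ∕ 11) :* con (5 ∕ 11) :* (b :+ b) := con (10 ∕ 11) :* a :+ con (50 ∕ 121) :* b) refl A A′ ⟩
    q * A + κ * A′  ∎
    where
    0≤A = ≤-trans (0≤∣∣ _) p≤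
    0≤A′ = ≤-trans (0≤∣∣ _) r≤

  ∣0∣≤ : ∀ {A} → 0# ≤ A → ∣ 0# ∣ ≤ A
  ∣0∣≤ = ≤-trans (≤-reflexive (∣∣-nonNeg ≤-refl))

  combine-diff : ∀ p q r s p′ q′ r′ s′ →
    (β⁻¹ * (p - p′ + (q - q′)) + β⁻¹ * β⁻¹ * (r - r′ + (s - s′))) ≈
    (β⁻¹ * (p + q) + β⁻¹ * β⁻¹ * (r + s)) - (β⁻¹ * (p′ + q′) + β⁻¹ * β⁻¹ * (r′ + s′))
  combine-diff p q r s p′ q′ r′ s′ = solve 9 (λ b p q r s p′ q′ r′ s′ →
    b :* (p :- p′ :+ (q :- q′)) :+ b :* b :* (r :- r′ :+ (s :- s′)) :=
    (b :* (p :+ q) :+ b :* b :* (r :+ s)) :- (b :* (p′ :+ q′) :+ b :* b :* (r′ :+ s′))) refl β⁻¹ p q r s p′ q′ r′ s′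

  Increment : ℕ → R → Set
  Increment n M = ∀ α → ∣ hX (suc n) α - hX n α ∣ ≤ M × ∣ hY (suc n) α - hY n α ∣ ≤ M

  -- Bounds the first step: 2 q + 2 κ + 2 < 5, all initial values being at most 2.
  5# : R
  5# = ι (5 ∕ 1)

  increment-0 : Increment 0 5#
  increment-0 α = bound (∣∣≤2 (φ * α)) (X≤2 (φ * α)) (X≤2 α) , bound (∣∣≤2 (φ * α)) (∣0∣≤ (ι≤ _ _)) (∣∣≤2 α)
    where
    ∣∣≤2 : ∀ α → ∣ hY 0 α ∣ ≤ 2#
    ∣∣≤2 α = ≤-trans (∣clamp∣≤1 α) (ι≤ _ _)
    X≤2 : ∀ α → ∣ hX 0 α ∣ ≤ 2#
    X≤2 α = ≤-trans (∣*∣≤ ∣X₁∣≤2 (∣clamp∣≤1 α)) (≤-reflexive (solve 0 (con (2 ∕ 1) :* con 1ℚ := con (2 ∕ 1)) refl))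
    bound : ∀ {p q′ z} → ∣ q′ ∣ ≤ 2# → ∣ p ∣ ≤ 2# → ∣ z ∣ ≤ 2# → ∣ β⁻¹ * (p + q′) + β⁻¹ * β⁻¹ * (hX 0 (ψ α) + hY 0 (ψ α)) - z ∣ ≤ 5#
    bound q≤ p≤ z≤ = ≤-trans (∣-∣≤ (∣combine∣≤ p≤ q≤ (X≤2 (ψ α)) (∣∣≤2 (ψ α))) z≤)
      (≤-by (ι (43 ∕ 121)) (ι≤ _ _) (solve 0 (con (5 ∕ 1) := (con (10 ∕ 11) :* con (2 ∕ 1) :+ con (50 ∕ 121) :* con (2 ∕ 1)) :+ con (2 ∕ 1) :+ con (43 ∕ 121)) refl))

  -- For every α, one of φ α ≤ 1 and 1 ≤ φ α makes one of the two terms of the recursion constant in n.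
  increment-suc : ∀ n {M} → 0# ≤ M → Increment n M → Increment (suc n) (q * M)
  increment-suc n {M} 0≤M h α =
    ∣∣≤-resp (combine-diff _ _ _ _ _ _ _ _) (≤-cases (φ * α) 1#
      (λ φα≤1 → let (x , y) = constant (h-nonPos (suc n) (ψ-nonPos φα≤1)) (h-nonPos n (ψ-nonPos φα≤1)) in
        left (∣combine∣≤ (proj₁ (h (φ * α))) (proj₂ (h (φ * α))) x y))
      (λ 1≤φα → let (x , y) = constant (h-≥1 (suc n) 1≤φα) (h-≥1 n 1≤φα) in
        right (∣combine∣≤ x y (proj₁ (h (ψ α))) (proj₂ (h (ψ α)))))) ,
    ∣∣≤-resp (combine-diff _ _ _ _ _ _ _ _) (≤-cases (φ * α) 1#
      (λ φα≤1 → let (x , y) = constant (h-nonPos (suc n) (ψ-nonPos φα≤1)) (h-nonPos n (ψ-nonPos φα≤1)) in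
        left (∣combine∣≤ (≤-trans (∣x-x∣≤0 0#) 0≤M) (proj₂ (h (φ * α))) x y))
      (λ 1≤φα → let (x , y) = constant (h-≥1 (suc n) 1≤φα) (h-≥1 n 1≤φα) in
        right (∣combine∣≤ (∣x-x∣≤0 0#) y (proj₁ (h (ψ α))) (proj₂ (h (ψ α))))))
    where
    constant : ∀ {x y x′ y′ a b} → x ≈ a × y ≈ b → x′ ≈ a × y′ ≈ b → ∣ x - x′ ∣ ≤ 0# × ∣ y - y′ ∣ ≤ 0#
    constant (x , y) (x′ , y′) = ≈⇒∣-∣≤0 (trans x (sym x′)) , ≈⇒∣-∣≤0 (trans y (sym y′))
    left : ∀ {z} → z ≤ q * M + κ * 0# → z ≤ q * M
    left h = ≤-trans h (≤-reflexive (solve 2 (λ a k → a :+ k :* con 0ℚ := a) refl (q * M) κ))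
    right : ∀ {z} → z ≤ q * 0# + κ * M → z ≤ q * M
    right h = ≤-trans h (≤-by (ι (60 ∕ 121) * M) (*-nonNeg (ι≤ _ _) 0≤M)
      (solve 1 (λ m → con (10 ∕ 11) :* m := con (10 ∕ 11) :* con 0ℚ :+ con (50 ∕ 121) :* m :+ con (60 ∕ 121) :* m) refl M))

  0≤q^ : ∀ n → 0# ≤ q ^ n
  0≤q^ = ^-nonNeg (ι≤ _ _)

  increment : ∀ n → Increment n (q ^ n * 5#)
  increment zero    α = let (x , y) = increment-0 α in one x , one y
    where
    one : ∀ {z} → z ≤ 5# → z ≤ 1# * 5#
    one h = ≤-trans h (≤-reflexive (solve 0 (con (5 ∕ 1) := con 1ℚ :* con (5 ∕ 1)) refl))
  increment (suc n) α = let (x , y) = increment-suc n (*-nonNeg (0≤q^ n) (ι≤ _ _)) (increment n) α in assoc x , assoc y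
    where
    assoc : ∀ {z} → z ≤ q * (q ^ n * 5#) → z ≤ q * q ^ n * 5#
    assoc h = ≤-trans h (≤-reflexive (solve 3 (λ a b c → a :* (b :* c) := a :* b :* c) refl q (q ^ n) 5#))

  -- 55 = 5 / (1 - q), the geometric sum of the increments.
  rate : ℕ → R
  rate n = ι (55 ∕ 1) * q ^ n

  null-q^ : Null (q ^_)
  null-q^ = null-geometric {t = ι (1 ∕ 10)} (ι≤ _ _) (ι< _ _) (≤-reflexive (solve 0 (con (10 ∕ 11) :* (con 1ℚ :+ con (1 ∕ 10)) := con 1ℚ) refl))

  null-rate : Null rate
  null-rate = null-scale _ (ι≤ _ _) null-q^

  0≤rate : ∀ n → 0# ≤ rate n
  0≤rate n = *-nonNeg (ι≤ _ _) (0≤q^ n)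

  increment≤rate : ∀ n {z} → z ≤ q ^ n * 5# → z ≤ rate n - rate (suc n)
  increment≤rate n h = ≤-trans h (≤-reflexive (solve 1 (λ p → p :* con (5 ∕ 1) := con (55 ∕ 1) :* p :- con (55 ∕ 1) :* (con (10 ∕ 11) :* p)) refl (q ^ n)))

  opaque
    limX : ∀ α → Σ[ ℓ ∈ R ] ∀ n → ∣ hX n α - ℓ ∣ ≤ rate n
    limX α = limit (λ n → hX n α) rate (λ n → increment≤rate n (proj₁ (increment n α))) 0≤rate null-rate

    limY : ∀ α → Σ[ ℓ ∈ R ] ∀ n → ∣ hY n α - ℓ ∣ ≤ rate n
    limY α = limit (λ n → hY n α) rate (λ n → increment≤rate n (proj₂ (increment n α))) 0≤rate null-rate

  HX HY : R → R
  HX α = proj₁ (limX α)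
  HY α = proj₁ (limY α)

  limit-unique : ∀ {u : ℕ → R} {ℓ a} → (∀ n → ∣ u n - ℓ ∣ ≤ rate n) → (∀ n → u n ≈ a) → ℓ ≈ a
  limit-unique {u} {ℓ} h e = ≈-limit (λ n → ∣∣≤-resp (+-cong refl (-‿cong (e n))) (∣∣-swap (u n) ℓ (h n))) null-rate

  H-nonPos : ∀ {α} → α ≤ 0# → HX α ≈ 0# × HY α ≈ 0#
  H-nonPos {α} α≤0 = limit-unique (proj₂ (limX α)) (λ n → proj₁ (h-nonPos n α≤0)) , limit-unique (proj₂ (limY α)) (λ n → proj₂ (h-nonPos n α≤0))

  H-≥1 : ∀ {α} → 1# ≤ α → HX α ≈ X₁ × HY α ≈ 1#
  H-≥1 {α} 1≤α = limit-unique (proj₂ (limX α)) (λ n → proj₁ (h-≥1 n 1≤α)) , limit-unique (proj₂ (limY α)) (λ n → proj₂ (h-≥1 n 1≤α))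

  null-combine : Null (λ n → rate (suc n) + (q * rate n + κ * rate n))
  null-combine = null-+ (null-suc null-rate) (null-+ (null-scale q (ι≤ _ _) null-rate) (null-scale κ (ι≤ _ _) null-rate))

  HX-equation : ∀ α → HX α ≈ β⁻¹ * (HX (φ * α) + HY (φ * α)) + β⁻¹ * β⁻¹ * (HX (ψ α) + HY (ψ α))
  HX-equation α = ≈-limit (λ n → ∣∣-chain (HX α) (hX (suc n) α) _ (∣∣-swap (hX (suc n) α) (HX α) (proj₂ (limX α) (suc n)))
    (∣∣≤-resp (combine-diff _ _ _ _ _ _ _ _) (∣combine∣≤ (proj₂ (limX (φ * α)) n) (proj₂ (limY (φ * α)) n) (proj₂ (limX (ψ α)) n) (proj₂ (limY (ψ α)) n)))) null-combine

  HY-equation : ∀ α → HY α ≈ β⁻¹ * (0# + HY (φ * α)) + β⁻¹ * β⁻¹ * (HX (ψ α) + HY (ψ α))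
  HY-equation α = ≈-limit (λ n → ∣∣-chain (HY α) (hY (suc n) α) _ (∣∣-swap (hY (suc n) α) (HY α) (proj₂ (limY α) (suc n)))
    (∣∣≤-resp (combine-diff _ _ _ _ _ _ _ _) (∣combine∣≤ (≤-trans (∣x-x∣≤0 0#) (0≤rate n)) (proj₂ (limY (φ * α)) n) (proj₂ (limX (ψ α)) n) (proj₂ (limY (ψ α)) n)))) null-combine

  -- The constants grow geometrically with n; only uniform continuity is passed on to the limit.
  lipschitz : ∀ n → Σ[ K ∈ R ] 0# ≤ K × (∀ x y → ∣ hX n x - hX n y ∣ ≤ K * ∣ x - y ∣ × ∣ hY n x - hY n y ∣ ≤ K * ∣ x - y ∣)
  lipschitz zero = 2# , ι≤ _ _ , λ x y →
    ∣∣≤-resp (solve 3 (λ a b c → a :* (b :- c) := a :* b :- a :* c) refl X₁ (clamp x) (clamp y)) (∣*∣≤ ∣X₁∣≤2 (clamp-lipschitz x y)) ,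
    ≤-trans (clamp-lipschitz x y) (≤-by (∣ x - y ∣) (0≤∣∣ _) (solve 1 (λ d → con (2 ∕ 1) :* d := d :+ d) refl (∣ x - y ∣)))
  lipschitz (suc n) = K′ , +-nonNeg (*-nonNeg (ι≤ _ _) (*-nonNeg 0≤K 0≤φ)) (*-nonNeg (ι≤ _ _) (*-nonNeg 0≤K (*-nonNeg 0≤φ 0≤φ))) , λ x y →
    let (x₀ , y₀) = h (φ * x) (φ * y)
        (x₁ , y₁) = h (ψ x) (ψ y)
    in ≤-trans (∣∣≤-resp (combine-diff _ _ _ _ _ _ _ _) (∣combine∣≤ (step₀ x y x₀) (step₀ x y y₀) (step₁ x y x₁) (step₁ x y y₁))) (collect x y) ,
       ≤-trans (∣∣≤-resp (combine-diff _ _ _ _ _ _ _ _) (∣combine∣≤ (≤-trans (∣x-x∣≤0 0#) (*-nonNeg 0≤K (*-nonNeg 0≤φ (0≤∣∣ _)))) (step₀ x y y₀) (step₁ x y x₁) (step₁ x y y₁))) (collect x y)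
    where
    K = proj₁ (lipschitz n)
    0≤K = proj₁ (proj₂ (lipschitz n))
    h = proj₂ (proj₂ (lipschitz n))
    K′ = q * (K * φ) + κ * (K * (φ * φ))
    step₀ : ∀ x y {z} → z ≤ K * ∣ φ * x - φ * y ∣ → z ≤ K * (φ * ∣ x - y ∣)
    step₀ x y h = ≤-trans h (*-monoʳ-≤ 0≤K (∣∣≤-resp (solve 3 (λ p x y → p :* (x :- y) := p :* x :- p :* y) refl φ x y) (∣c*∣≤ 0≤φ ≤-refl)))
    step₁ : ∀ x y {z} → z ≤ K * ∣ ψ x - ψ y ∣ → z ≤ K * (φ * φ * ∣ x - y ∣)
    step₁ x y h = ≤-trans h (*-monoʳ-≤ 0≤K (∣∣≤-resp (solve 3 (λ p x y → p :* p :* (x :- y) := p :* (p :* x :- con 1ℚ) :- p :* (p :* y :- con 1ℚ)) refl φ x y) (∣c*∣≤ (*-nonNeg 0≤φ 0≤φ) ≤-refl)))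
    collect : ∀ x y → q * (K * (φ * ∣ x - y ∣)) + κ * (K * (φ * φ * ∣ x - y ∣)) ≤ K′ * ∣ x - y ∣
    collect x y = ≤-reflexive (solve 5 (λ a b k p d → a :* (k :* (p :* d)) :+ b :* (k :* (p :* p :* d)) := (a :* (k :* p) :+ b :* (k :* (p :* p))) :* d) refl q κ K φ (∣ x - y ∣))

  UniformlyContinuous : (R → R) → Set
  UniformlyContinuous F = ∀ ε → 0# < ε → Σ[ δ ∈ R ] 0# < δ × (∀ x y → ∣ x - y ∣ ≤ δ → ∣ F x - F y ∣ ≤ ε)

  uniform-limit : ∀ (F : R → R) (u : ℕ → R → R) → (∀ α n → ∣ u n α - F α ∣ ≤ rate n) →
    (∀ n → Σ[ K ∈ R ] 0# ≤ K × (∀ x y → ∣ u n x - u n y ∣ ≤ K * ∣ x - y ∣)) → UniformlyContinuous F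
  uniform-limit F u close lip ε 0<ε =
    let third = ι (1 ∕ 3) * ε
        0<third = *-pos (ι< _ _) 0<ε
        (n , small) = null-rate third 0<third
        (K , 0≤K , h) = lip n
        (δ , 0<δ , Kδ≤) = small-factor K 0<third
    in δ , 0<δ , λ x y xy≤δ → ≤-trans
      (∣∣-chain (F x) (u n x) (F y) (∣∣-swap (u n x) (F x) (≤-trans (close x n) (small n ℕ.≤-refl)))
        (∣∣-chain (u n x) (u n y) (F y) (≤-trans (h x y) (≤-trans (*-monoʳ-≤ 0≤K xy≤δ) Kδ≤)) (≤-trans (close y n) (small n ℕ.≤-refl))))
      (≤-reflexive (solve 1 (λ e → con (1 ∕ 3) :* e :+ (con (1 ∕ 3) :* e :+ con (1 ∕ 3) :* e) := e) refl ε))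

  HX-continuous : UniformlyContinuous HX
  HX-continuous = uniform-limit HX hX (λ α → proj₂ (limX α)) (λ n → let (K , 0≤K , h) = lipschitz n in K , 0≤K , λ x y → proj₁ (h x y))

  HY-continuous : UniformlyContinuous HY
  HY-continuous = uniform-limit HY hY (λ α → proj₂ (limY α)) (λ n → let (K , 0≤K , h) = lipschitz n in K , 0≤K , λ x y → proj₂ (h x y))

  ContinuousAt : (R → R) → R → Set
  ContinuousAt F x = ∀ ε → 0# < ε → Σ[ δ ∈ R ] 0# < δ × (∀ y → ∣ y - x ∣ ≤ δ → ∣ F y - F x ∣ ≤ ε)

  cont-uniform : ∀ {F} → UniformlyContinuous F → ∀ x → ContinuousAt F x
  cont-uniform uc x ε 0<ε = let (δ , 0<δ , h) = uc ε 0<ε in δ , 0<δ , λ y → h y x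

  -- A map on Cauchy sequences respects ≈ only if this is proved. Continuity suffices, since equal
  -- reals are within every δ.
  cont⇒cong : ∀ {F} → (∀ x → ContinuousAt F x) → ∀ {x y} → x ≈ y → F x ≈ F y
  cont⇒cong {F} c x≈y = ≤-antisym (one-sided _ _ x≈y) (one-sided _ _ (sym x≈y))
    where
    one-sided : ∀ x y → x ≈ y → F x ≤ F y
    one-sided x y x≈y = ≮⇒≥ λ Fy<Fx →
      let (δ , 0<δ , h) = c y (ι ½ * (F x - F y)) (half (diff-pos Fy<Fx))
      in <-irrefl (begin-strict
        F x  ≤⟨ ∣x-y∣≤⇒ (h x (≤-trans (≈⇒∣-∣≤0 x≈y) (<⇒≤ 0<δ))) ⟩
        F y + ι ½ * (F x - F y)  <⟨ <-by (ι ½ * (F x - F y)) (half (diff-pos Fy<Fx)) (solve 2 (λ a b → a := b :+ con ½ :* (a :- b) :+ con ½ :* (a :- b)) refl (F x) (F y)) ⟩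
        F x  ∎)

  -- The solution at Zeckendorf words

  φ⁻¹ : R
  φ⁻¹ = φ - 1#

  φ*φ⁻¹ : ∀ a → φ * (φ⁻¹ * a) ≈ a
  φ*φ⁻¹ a = trans (solve 2 (λ p a → p :* ((p :- con 1ℚ) :* a) := (p :* p :- p) :* a) refl φ a)
    (trans (*-cong (+-cong φ²≈φ+1 refl) refl) (solve 2 (λ p a → (p :+ con 1ℚ :- p) :* a := a) refl φ a))

  0≤φ⁻¹ : 0# ≤ φ⁻¹
  0≤φ⁻¹ = diff-nonNeg 1≤φ

  position : Word → R
  position []       = 0#
  position (0F ∷ r) = φ⁻¹ * position r
  position (1F ∷ r) = φ⁻¹ * (1# + position r)

  -- The recursion of V r scaled by β⁻¹ for each letter, with the sums over all words replaced by
  -- their limit (X₁ , 1); up to the factor c this is the main term of V r / β ^ ∣r∣.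
  vX vY : Word → R
  vX []       = 0#
  vX (0F ∷ r) = β⁻¹ * (vX r + vY r)
  vX (1F ∷ r) = β⁻¹ * (X₁ + 1# + vX r)
  vY []       = 0#
  vY (0F ∷ r) = β⁻¹ * vY r
  vY (1F ∷ r) = β⁻¹ * (1# + vX r)

  φ⁻¹<1 : φ⁻¹ < 1#
  φ⁻¹<1 = <-by (2# - φ) (diff-pos φ<2) (solve 1 (λ p → con 1ℚ := (p :- con 1ℚ) :+ (con (2 ∕ 1) :- p)) refl φ)

  φ⁻¹*φ⁻¹ : φ⁻¹ * (1# + φ⁻¹) ≈ 1#
  φ⁻¹*φ⁻¹ = trans (solve 1 (λ p → (p :- con 1ℚ) :* (con 1ℚ :+ (p :- con 1ℚ)) := p :* p :- p) refl φ)
    (trans (+-cong φ²≈φ+1 refl) (solve 1 (λ p → p :+ con 1ℚ :- p := con 1ℚ) refl φ))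

  0<φ⁻¹ : 0# < φ⁻¹
  0<φ⁻¹ = <-≤-trans (ι< 0ℚ ½) (≤-by (ι ½ * (φ⁻¹ * (2# - φ))) (*-nonNeg (ι≤ _ _) (*-nonNeg 0≤φ⁻¹ (<⇒≤ (diff-pos φ<2))))
    (trans (solve 1 (λ p → p :- con 1ℚ := con ½ :* ((p :- con 1ℚ) :* (con 1ℚ :+ (p :- con 1ℚ))) :+ con ½ :* ((p :- con 1ℚ) :* (con (2 ∕ 1) :- p))) refl φ)
      (+-cong (trans (*-cong refl φ⁻¹*φ⁻¹) (solve 0 (con ½ :* con 1ℚ := con ½) refl)) refl)))

  0≤position : ∀ r → 0# ≤ position r
  0≤position []       = ≤-refl
  0≤position (0F ∷ r) = *-nonNeg 0≤φ⁻¹ (0≤position r)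
  0≤position (1F ∷ r) = *-nonNeg 0≤φ⁻¹ (+-nonNeg 0≤1 (0≤position r))

  -- Without 11 a digit 1 is followed by 0, and φ⁻¹ (1 + φ⁻¹) = 1.
  position<1 : ∀ r → Linked NotBothOne r → position r < 1#
  position<1 []            _ = ι< _ _
  position<1 (0F ∷ r)      h = ≤-<-trans (≤-trans (*-monoʳ-≤ 0≤φ⁻¹ (<⇒≤ (position<1 r (Linked.tail h)))) (≤-reflexive (solve 1 (λ p → p :* con 1ℚ := p) refl φ⁻¹))) φ⁻¹<1
  position<1 (1F ∷ [])     _ = ≤-<-trans (≤-reflexive (solve 1 (λ p → p :* (con 1ℚ :+ con 0ℚ) := p) refl φ⁻¹)) φ⁻¹<1
  position<1 (1F ∷ 1F ∷ r) (¬11 ∷ _) = contradiction (≡.refl , ≡.refl) ¬11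
  position<1 (1F ∷ 0F ∷ r) h = <-≤-trans
    (*-monoʳ-< 0<φ⁻¹ (+-monoʳ-< 1# (*-monoʳ-< 0<φ⁻¹ (position<1 r (Linked.tail (Linked.tail h))))))
    (≤-reflexive (trans (*-cong refl (+-cong refl (solve 1 (λ p → p :* con 1ℚ := p) refl φ⁻¹))) φ⁻¹*φ⁻¹))

  HX-cong : ∀ {x y} → x ≈ y → HX x ≈ HX y
  HX-cong = cont⇒cong (cont-uniform HX-continuous)

  HY-cong : ∀ {x y} → x ≈ y → HY x ≈ HY y
  HY-cong = cont⇒cong (cont-uniform HY-continuous)

  H-at : ∀ {α x y x′ y′} → HX (φ * α) ≈ x → HY (φ * α) ≈ y → HX (ψ α) ≈ x′ → HY (ψ α) ≈ y′ →
    HX α ≈ β⁻¹ * (x + y) + β⁻¹ * β⁻¹ * (x′ + y′) × HY α ≈ β⁻¹ * (0# + y) + β⁻¹ * β⁻¹ * (x′ + y′)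
  H-at {α} x y x′ y′ = trans (HX-equation α) (combine-cong x y x′ y′) , trans (HY-equation α) (combine-cong refl y x′ y′)

  -- The equation reads off digits. At 0r the argument φ α is the position of r and the second term
  -- vanishes. At 10r the argument φ α is at least 1, so the first term is constant, and ψ α is the
  -- position of r. At the single digit 1, φ α = 1 and ψ α = 0.
  v≈H : ∀ r → Linked NotBothOne r → vX r ≈ HX (position r) × vY r ≈ HY (position r)
  v≈H []       _ = let (x , y) = H-nonPos ≤-refl in sym x , sym y
  v≈H (0F ∷ r) h =
    let (x , y) = v≈H r (Linked.tail h)
        φα≈ = φ*φ⁻¹ (position r)
        (x′ , y′) = H-nonPos (ψ-nonPos (≤-respˡ (sym φα≈) (<⇒≤ (position<1 r (Linked.tail h)))))
        (HX≈ , HY≈) = H-at (trans (HX-cong φα≈) (sym x)) (trans (HY-cong φα≈) (sym y)) x′ y′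
    in sym (trans HX≈ (solve 3 (λ b x y → b :* (x :+ y) :+ b :* b :* (con 0ℚ :+ con 0ℚ) := b :* (x :+ y)) refl β⁻¹ (vX r) (vY r))) ,
       sym (trans HY≈ (solve 2 (λ b y → b :* (con 0ℚ :+ y) :+ b :* b :* (con 0ℚ :+ con 0ℚ) := b :* y) refl β⁻¹ (vY r)))
  v≈H (1F ∷ []) _ =
    let φα≈ = φ*φ⁻¹ (1# + 0#)
        1+0 = solve 0 (con 1ℚ :+ con 0ℚ := con 1ℚ) refl
        (x , y) = H-≥1 (≤-reflexive (sym (trans φα≈ 1+0)))
        (x′ , y′) = H-nonPos (ψ-nonPos (≤-reflexive (trans φα≈ 1+0)))
        (HX≈ , HY≈) = H-at x y x′ y′
    in sym (trans HX≈ (solve 2 (λ b x → b :* (x :+ con 1ℚ) :+ b :* b :* (con 0ℚ :+ con 0ℚ) := b :* (x :+ con 1ℚ :+ con 0ℚ)) refl β⁻¹ X₁)) ,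
       sym (trans HY≈ (solve 1 (λ b → b :* (con 0ℚ :+ con 1ℚ) :+ b :* b :* (con 0ℚ :+ con 0ℚ) := b :* (con 1ℚ :+ con 0ℚ)) refl β⁻¹))
  v≈H (1F ∷ 1F ∷ r) (¬11 ∷ _) = contradiction (≡.refl , ≡.refl) ¬11
  v≈H (1F ∷ 0F ∷ r) h =
    let (x , y) = v≈H r (Linked.tail (Linked.tail h))
        α₀ = position (0F ∷ r)
        φα≈ = φ*φ⁻¹ (1# + α₀)
        (x₁ , y₁) = H-≥1 (≤-respʳ (sym φα≈) (≤-by α₀ (0≤position (0F ∷ r)) refl))
        ψα≈ = trans (*-cong refl (trans (+-cong φα≈ refl) (solve 1 (λ a → con 1ℚ :+ a :- con 1ℚ := a) refl α₀))) (φ*φ⁻¹ (position r))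
        (HX≈ , HY≈) = H-at x₁ y₁ (trans (HX-cong ψα≈) (sym x)) (trans (HY-cong ψα≈) (sym y))
    in sym (trans HX≈ (solve 4 (λ b f x y → b :* (f :+ con 1ℚ) :+ b :* b :* (x :+ y) := b :* (f :+ con 1ℚ :+ b :* (x :+ y))) refl β⁻¹ X₁ (vX r) (vY r))) ,
       sym (trans HY≈ (solve 3 (λ b x y → b :* (con 0ℚ :+ con 1ℚ) :+ b :* b :* (x :+ y) := b :* (con 1ℚ :+ b :* (x :+ y))) refl β⁻¹ (vX r) (vY r)))

  -- Pointwise continuity

  unit-below : ∀ {ε} → 0# < ε → ∃[ n ] unitR n ≤ ε
  unit-below {ε} 0<ε with archimedean 1# 0<ε
  ... | n , 1≤nε = n , (begin
    unitR n  ≈⟨ solve 1 (λ u → u := u :* con 1ℚ) refl (unitR n) ⟩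
    unitR n * 1#  ≤⟨ *-monoʳ-≤ (0≤unitR n) 1≤nε ⟩
    unitR n * (natR n * ε)  ≈⟨ solve 3 (λ a b c → a :* (b :* c) := a :* b :* c) refl (unitR n) (natR n) ε ⟩
    unitR n * natR n * ε  ≤⟨ *-monoˡ-≤ (<⇒≤ 0<ε) (unitR*≤1 (ℕ.n≤1+n n)) ⟩
    1# * ε  ≈⟨ solve 1 (λ e → con 1ℚ :* e := e) refl ε ⟩
    ε  ∎)

  unitR-antitone : ∀ {m n} → m ℕ.≤ n → unitR n ≤ unitR m
  unitR-antitone {m} {n} m≤n = begin
    unitR n  ≈⟨ solve 1 (λ u → u := u :* con 1ℚ) refl (unitR n) ⟩
    unitR n * 1#  ≈⟨ *-cong refl (natR*unitR m) ⟨
    unitR n * (natR (suc m) * unitR m)  ≈⟨ solve 3 (λ a b c → a :* (b :* c) := a :* b :* c) refl (unitR n) (natR (suc m)) (unitR m) ⟩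
    unitR n * natR (suc m) * unitR m  ≤⟨ *-monoˡ-≤ (0≤unitR m) (unitR*≤1 {suc m} {n} (ℕ.s≤s m≤n)) ⟩
    1# * unitR m  ≈⟨ solve 1 (λ e → con 1ℚ :* e := e) refl (unitR m) ⟩
    unitR m  ∎

  -- A unit fraction below both numbers serves as a common δ.
  minimum : ∀ {a b} → 0# < a → 0# < b → Σ[ δ ∈ R ] 0# < δ × δ ≤ a × δ ≤ b
  minimum 0<a 0<b =
    let (m , m≤) = unit-below 0<a
        (n , n≤) = unit-below 0<b
    in unitR (m ℕ.⊔ n) , ι-< (0<unit (m ℕ.⊔ n)) , ≤-trans (unitR-antitone (ℕ.m≤m⊔n m n)) m≤ , ≤-trans (unitR-antitone (ℕ.m≤n⊔m m n)) n≤

  cont-const : ∀ a x → ContinuousAt (λ _ → a) x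
  cont-const a x ε 0<ε = 1# , ι< _ _ , λ y _ → ≤-trans (∣x-x∣≤0 a) (<⇒≤ 0<ε)

  cont-+ : ∀ {F G x} → ContinuousAt F x → ContinuousAt G x → ContinuousAt (λ y → F y + G y) x
  cont-+ {F} {G} {x} cF cG ε 0<ε =
    let (δ₁ , 0<δ₁ , h) = cF (ι ½ * ε) (half 0<ε)
        (δ₂ , 0<δ₂ , k) = cG (ι ½ * ε) (half 0<ε)
        (δ , 0<δ , δ≤δ₁ , δ≤δ₂) = minimum 0<δ₁ 0<δ₂
    in δ , 0<δ , λ y yx≤δ → ∣∣≤-resp
      (solve 4 (λ a b c d → (a :- b) :+ (c :- d) := (a :+ c) :- (b :+ d)) refl (F y) (F x) (G y) (G x))
      (≤-respʳ (half+half ε) (∣+∣≤ (h y (≤-trans yx≤δ δ≤δ₁)) (k y (≤-trans yx≤δ δ≤δ₂))))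

  cont-* : ∀ {F G x} → ContinuousAt F x → ContinuousAt G x → ContinuousAt (λ y → F y * G y) x
  cont-* {F} {G} {x} cF cG ε 0<ε =
    let (ε₁ , 0<ε₁ , ε₁≤) = small-factor (∣ G x ∣ + 1#) (half 0<ε)
        (ε₂ , 0<ε₂ , ε₂≤) = small-factor ∣ F x ∣ (half 0<ε)
        -- ε₃ ≤ 1 keeps ∣G y∣ below ∣G x∣ + 1, the factor for which ε₁ was chosen.
        (ε₃ , 0<ε₃ , ε₃≤ε₂ , ε₃≤1) = minimum 0<ε₂ (ι< 0ℚ 1ℚ)
        (δ₁ , 0<δ₁ , h) = cF ε₁ 0<ε₁
        (δ₂ , 0<δ₂ , k) = cG ε₃ 0<ε₃
        (δ , 0<δ , δ≤δ₁ , δ≤δ₂) = minimum 0<δ₁ 0<δ₂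
    in δ , 0<δ , λ y yx≤δ →
      let fy = h y (≤-trans yx≤δ δ≤δ₁)
          gy = k y (≤-trans yx≤δ δ≤δ₂)
      in ∣∣≤-resp
        (solve 4 (λ a b c d → (a :- b) :* (d :+ (c :- d)) :+ b :* (c :- d) := a :* c :- b :* d) refl (F y) (F x) (G y) (G x))
        (≤-respʳ (half+half ε) (∣+∣≤
          (≤-trans (∣*∣≤ fy (∣+∣≤ ≤-refl (≤-trans gy ε₃≤1))) (≤-trans (≤-reflexive (solve 2 (λ a b → a :* b := b :* a) refl ε₁ (∣ G x ∣ + 1#))) ε₁≤))
          (≤-trans (∣*∣≤ (≤-refl {∣ F x ∣}) (≤-trans gy ε₃≤ε₂)) ε₂≤)))

  cont-shift : ∀ {F} a {x} → ContinuousAt F (x - a) → ContinuousAt (λ y → F (y - a)) x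
  cont-shift a {x} cF ε 0<ε = let (δ , 0<δ , h) = cF ε 0<ε in δ , 0<δ , λ y yx≤δ →
    h (y - a) (∣∣≤-resp (solve 3 (λ x y a → y :- x := (y :- a) :- (x :- a)) refl x y a) yx≤δ)

  cont-scaled : ∀ {F} a {x} → ContinuousAt F (- (x * a)) → ContinuousAt (λ y → F (- (y * a))) x
  cont-scaled a {x} cF ε 0<ε =
    let (δ₁ , 0<δ₁ , h) = cF ε 0<ε
        (δ , 0<δ , aδ≤) = small-factor ∣ a ∣ 0<δ₁
    in δ , 0<δ , λ y yx≤δ → h (- (y * a)) (≤-trans
      (∣∣≤-resp (solve 3 (λ x y a → :- a :* (y :- x) := :- (y :* a) :- :- (x :* a)) refl x y a) (∣*∣≤ (∣-x∣≤ a) yx≤δ)) aδ≤)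

  cont-exp : ∀ x → ContinuousAt exp x
  cont-exp x ε 0<ε =
    let (δ₁ , 0<δ₁ , bound) = small-factor (∣ exp x ∣ * 2#) 0<ε
        (δ , 0<δ , δ≤δ₁ , δ≤1) = minimum 0<δ₁ (ι< 0ℚ 1ℚ)
    in δ , 0<δ , λ y yx≤δ → ≤-trans
      (∣∣≤-resp (trans (solve 2 (λ a b → a :* (b :- con 1ℚ) := a :* b :- a) refl (exp x) (exp (y - x)))
                  (+-cong (trans (sym (exp-+ x (y - x))) (exp-cong (solve 2 (λ x y → x :+ (y :- x) := y) refl x y))) refl))
        (∣*∣≤ (≤-refl {∣ exp x ∣}) (≤-trans (∣exp-1∣≤ (≤-trans yx≤δ δ≤1)) (*-monoʳ-≤ (ι≤ _ _) (≤-trans yx≤δ δ≤δ₁)))))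
      (≤-trans (≤-reflexive (solve 3 (λ a t d → a :* (t :* d) := a :* t :* d) refl (∣ exp x ∣) 2# δ₁)) bound)

  -- The periodic function

  u : R → R
  u α = β⁻¹ * (HX α + HY α)

  u-nonPos : ∀ {α} → α ≤ 0# → u α ≈ 0#
  u-nonPos α≤0 = let (x , y) = H-nonPos α≤0 in
    trans (*-cong refl (+-cong x y)) (solve 1 (λ b → b :* (con 0ℚ :+ con 0ℚ) := con 0ℚ) refl β⁻¹)

  -- Thus 1 + u = β from α = 1 on, which is what joins consecutive periods.
  u-≥1 : ∀ {α} → 1# ≤ α → u α ≈ β - 1#
  u-≥1 1≤α = let (x , y) = H-≥1 1≤α in trans (*-cong refl (+-cong x y)) β⁻¹*full

  cont-u : ∀ x → ContinuousAt u x
  cont-u x = cont-* (cont-const β⁻¹ x) (cont-+ (cont-uniform HX-continuous x) (cont-uniform HY-continuous x))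

  -- On [0, 2] this is the quotient by β^y of the function equal to 1 + u on [0, 1] and multiplied by β
  -- under y ↦ y + 1; two periods are covered so that every real has a suitable representative,
  -- found without deciding an equality.
  g : R → R
  g y = (1# + u y + β * u (y - 1#)) * exp (- (y * ln-β))

  cont-g : ∀ x → ContinuousAt g x
  cont-g x = cont-* (cont-+ (cont-+ (cont-const 1# x) (cont-u x)) (cont-* (cont-const β x) (cont-shift 1# (cont-u (x - 1#)))))
    (cont-scaled {exp} ln-β (cont-exp (- (x * ln-β))))

  g-cong : ∀ {x y} → x ≈ y → g x ≈ g y
  g-cong = cont⇒cong cont-g

  g-unit : ∀ {y} → y ≤ 1# → g y ≈ (1# + u y) * exp (- (y * ln-β))
  g-unit {y} y≤1 = *-cong (trans (+-cong refl (*-cong refl (u-nonPos (≤-trans (+-mono-≤ y≤1 ≤-refl) (≤-reflexive (solve 0 (con 1ℚ :- con 1ℚ := con 0ℚ) refl))))))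
    (solve 2 (λ a b → a :+ b :* con 0ℚ := a) refl (1# + u y) β)) refl

  g-shift : ∀ {x y} → x ≈ y + 1# → 0# ≤ y → y ≤ 1# → g x ≈ g y
  g-shift {x} {y} x≈ 0≤y y≤1 = begin-equality
    g x  ≈⟨ g-cong x≈ ⟩
    (1# + u (y + 1#) + β * u (y + 1# - 1#)) * exp (- ((y + 1#) * ln-β))
      ≈⟨ *-cong (+-cong (+-cong refl (u-≥1 (≤-by y 0≤y (solve 1 (λ y → y :+ con 1ℚ := con 1ℚ :+ y) refl y))))
                  (*-cong refl (cont⇒cong cont-u (solve 1 (λ y → y :+ con 1ℚ :- con 1ℚ := y) refl y))))
           (trans (exp-cong (solve 2 (λ y l → :- ((y :+ con 1ℚ) :* l) := :- l :+ :- (y :* l)) refl y ln-β)) (exp-+ (- ln-β) (- (y * ln-β)))) ⟩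
    (1# + (β - 1#) + β * u y) * (exp (- ln-β) * E)
      ≈⟨ solve 4 (λ b u i e → (con 1ℚ :+ (b :- con 1ℚ) :+ b :* u) :* (i :* e) := (b :* i) :* ((con 1ℚ :+ u) :* e)) refl β (u y) (exp (- ln-β)) E ⟩
    β * exp (- ln-β) * ((1# + u y) * E)  ≈⟨ *-cong (trans (*-cong (sym exp-ln-β) refl) (exp-inverse ln-β)) refl ⟩
    1# * ((1# + u y) * E)  ≈⟨ solve 1 (λ a → con 1ℚ :* a := a) refl ((1# + u y) * E) ⟩
    (1# + u y) * E  ≈⟨ g-unit y≤1 ⟨
    g y  ∎
    where
    E = exp (- (y * ln-β))

  intR-mono : ∀ {i j} → i ℤ.≤ j → intR i ≤ intR j
  intR-mono i≤j = ι-≤ (fromℤ-mono-≤ i≤j)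

  7/4# : R
  7/4# = ι (7 ∕ 4)

  data Adjacent : ℤ → Set where
    same  : Adjacent (+ 0)
    above : Adjacent (+ 1)
    below : Adjacent -[1+ 0 ]

  adjacent : ∀ j → intR j ≤ 7/4# → - 7/4# ≤ intR j → Adjacent j
  adjacent (+ 0)           _  _  = same
  adjacent (+ 1)           _  _  = above
  adjacent (+ suc (suc n)) h  _  = contradiction (<-≤-trans (ι< (7 ∕ 4) (2 ∕ 1)) (≤-trans (intR-mono {+ 2} {+ suc (suc n)} (ℤ.+≤+ (ℕ.s≤s (ℕ.s≤s ℕ.z≤n)))) h)) <-irrefl
  adjacent -[1+ 0 ]        _  _  = below
  adjacent -[1+ suc n ]    _  h  = contradiction (≤-<-trans (≤-trans (≤-reflexive (ι-neg (7 ∕ 4))) (≤-trans h (intR-mono { -[1+ suc n ]} { -[1+ 1 ]} (ℤ.-≤- (ℕ.s≤s ℕ.z≤n))))) (ι< (-[1+ 1 ] ℚ./ 1) (ℚ.- (7 ∕ 4)))) <-irrefl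

  -- Representatives in [0, 2] and in [1/4, 7/4] differ by an integer of absolute value at most 7/4,
  -- so by -1, 0 or 1; two points of [0, 2] could differ by 2. If they differ by 1, the smaller lies
  -- in [0, 1] and `g-shift` applies.
  g-coherent : ∀ {y} m m′ → 0# ≤ y - intR m → y - intR m ≤ 2# → ι (1 ∕ 4) ≤ y - intR m′ → y - intR m′ ≤ 7/4# →
    g (y - intR m) ≈ g (y - intR m′)
  g-coherent {y} m m′ 0≤ ≤2 ¼≤ ≤7/4 = go (adjacent j j≤ ≤j) j≈
    where
    j = m′ ℤ.- m
    j≈ : intR j ≈ (y - intR m) - (y - intR m′)
    j≈ = trans (intR-+ m′ (ℤ.- m)) (trans (+-cong refl (intR-neg m)) (solve 3 (λ y a b → b :- a := (y :- a) :- (y :- b)) refl y (intR m) (intR m′)))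
    j≤ : intR j ≤ 7/4#
    j≤ = ≤-respˡ (sym j≈) (≤-trans (+-mono-≤ ≤2 (neg-mono-≤ ¼≤)) (≤-reflexive (solve 0 (con (2 ∕ 1) :- con (1 ∕ 4) := con (7 ∕ 4)) refl)))
    ≤j : - 7/4# ≤ intR j
    ≤j = ≤-respʳ (sym j≈) (≤-trans (≤-reflexive (solve 0 (:- con (7 ∕ 4) := con 0ℚ :- con (7 ∕ 4)) refl)) (+-mono-≤ 0≤ (neg-mono-≤ ≤7/4)))
    a = y - intR m
    b = y - intR m′
    0≤b : 0# ≤ b
    0≤b = ≤-trans (ι≤ _ _) ¼≤
    b≤2 : b ≤ 2#
    b≤2 = ≤-trans ≤7/4 (ι≤ _ _)
    less : ∀ {a b} → a ≈ b + 1# → a ≤ 2# → b ≤ 1#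
    less {a} {b} a≈ a≤2 = begin
      b  ≈⟨ solve 1 (λ b → b := b :+ con 1ℚ :- con 1ℚ) refl b ⟩
      b + 1# - 1#  ≈⟨ +-cong a≈ refl ⟨
      a - 1#  ≤⟨ +-mono-≤ a≤2 ≤-refl ⟩
      2# - 1#  ≈⟨ solve 0 (con (2 ∕ 1) :- con 1ℚ := con 1ℚ) refl ⟩
      1#  ∎
    go : ∀ {j} → Adjacent j → intR j ≈ a - b → g a ≈ g b
    go same  e = g-cong (trans (solve 2 (λ a b → a := b :+ (a :- b)) refl a b) (trans (+-cong refl (sym e)) (solve 1 (λ b → b :+ con 0ℚ := b) refl b)))
    go above e = g-shift a≈ 0≤b (less a≈ ≤2)
      where
      a≈ : a ≈ b + 1#
      a≈ = trans (solve 2 (λ a b → a := b :+ (a :- b)) refl a b) (+-cong refl (sym e))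
    go below e = sym (g-shift b≈ 0≤ (less b≈ b≤2))
      where
      b≈ : b ≈ a + 1#
      b≈ = trans (solve 2 (λ a b → b := a :- (a :- b)) refl a b) (trans (+-cong refl (-‿cong (sym e))) (solve 1 (λ a → a :- con (-[1+ 0 ] ℚ./ 1) := a :+ con 1ℚ) refl a))

  base : R → ℤ
  base x = proj₁ (nearby-integer x)

  x-base≥¼ : ∀ x → ι (1 ∕ 4) ≤ x - intR (base x)
  x-base≥¼ x = ≤-trans (≤-reflexive (solve 2 (λ m q → q := m :+ q :- m) refl (intR (base x)) (ι (1 ∕ 4)))) (+-mono-≤ (proj₁ (proj₂ (nearby-integer x))) ≤-refl)

  x-base≤7/4 : ∀ x → x - intR (base x) ≤ 7/4#
  x-base≤7/4 x = ≤-trans (+-mono-≤ (proj₂ (proj₂ (nearby-integer x))) ≤-refl) (≤-reflexive (solve 2 (λ m q → m :+ q :- m := q) refl (intR (base x)) 7/4#))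

  opaque
    -- `base` depends on the Cauchy sequence representing x and may jump; `G-at` shows that the
    -- value does not depend on this choice.
    G : R → R
    G x = g (x - intR (base x))

    G-at : ∀ x m {y} → x ≈ y + intR m → 0# ≤ y → y ≤ 2# → G x ≈ g y
    G-at x m {y} x≈ 0≤y y≤2 = trans (sym (g-coherent {x} m (base x) (≤-respʳ (sym e) 0≤y) (≤-respˡ (sym e) y≤2) (x-base≥¼ x) (x-base≤7/4 x))) (g-cong e)
      where
      e : x - intR m ≈ y
      e = trans (+-cong x≈ refl) (solve 2 (λ y m → y :+ m :- m := y) refl y (intR m))

    G-periodic : ∀ x → G (x + 1#) ≈ G x
    G-periodic x = G-at (x + 1#) (ℤ.suc (base x))
      (trans (solve 2 (λ x m → x :+ con 1ℚ := (x :- m) :+ (con 1ℚ :+ m)) refl x (intR (base x))) (+-cong refl (sym (intR-+ (+ 1) (base x)))))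
      (≤-trans (ι≤ _ _) (x-base≥¼ x)) (≤-trans (x-base≤7/4 x) (ι≤ _ _))

    G-continuous : ∀ x → ContinuousAt G x
    G-continuous x ε 0<ε =
      let m = base x
          (δ₁ , 0<δ₁ , h) = cont-shift {g} (intR m) {x} (cont-g (x - intR m)) ε 0<ε
          -- Within 1/4 of x, the integer m chosen for x still brings y into [0, 2], so `G` is
          -- computed at both points with the same m.
          (δ , 0<δ , δ≤δ₁ , δ≤¼) = minimum 0<δ₁ (ι< 0ℚ (1 ∕ 4))
      in δ , 0<δ , λ y yx≤δ →
        ∣∣≤-resp (+-cong (sym (G-at y m (solve 2 (λ y m → y := y :- m :+ m) refl y (intR m))
            (lower y (≤-trans yx≤δ δ≤¼)) (upper y (≤-trans yx≤δ δ≤¼)))) refl)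
          (h y (≤-trans yx≤δ δ≤δ₁))
      where
      m : ℤ
      m = base x
      lower : ∀ y → ∣ y - x ∣ ≤ ι (1 ∕ 4) → 0# ≤ y - intR m
      lower y yx≤ = ≤-respʳ (solve 3 (λ x y m → (x :- m :- con (1 ∕ 4)) :+ (con (1 ∕ 4) :- (x :- y)) := y :- m) refl x y (intR m))
        (+-nonNeg (diff-nonNeg (x-base≥¼ x)) (diff-nonNeg (∣∣≤⇒≤ (∣∣-swap y x yx≤))))
      upper : ∀ y → ∣ y - x ∣ ≤ ι (1 ∕ 4) → y - intR m ≤ 2#
      upper y yx≤ = ≤-trans (≤-reflexive (solve 3 (λ x y m → y :- m := (x :- m) :+ (y :- x)) refl x y (intR m)))
        (≤-trans (+-mono-≤ (x-base≤7/4 x) (∣∣≤⇒≤ yx≤)) (≤-reflexive (solve 0 (con (7 ∕ 4) :+ con (1 ∕ 4) := con (2 ∕ 1)) refl)))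

  opaque
    β^ : R → R
    β^ x = exp (x * ln-β)

    exp≈β^ : ∀ x → exp (x * ln-β) ≈ β^ x
    exp≈β^ x = refl

  exp*G : ∀ ℓ {x α} → x ≈ natR ℓ + α → 0# ≤ α → α ≤ 1# → β^ x * G x ≈ β ^ ℓ * (1# + u α)
  exp*G ℓ {x} {α} x≈ 0≤α α≤1 = begin-equality
    β^ x * G x
      ≈⟨ *-cong (trans (trans (sym (exp≈β^ x)) (exp-cong (trans (*-cong x≈ refl) (solve 3 (λ n a l → (n :+ a) :* l := n :* l :+ a :* l) refl (natR ℓ) α ln-β))))
                  (trans (exp-+ (natR ℓ * ln-β) (α * ln-β)) (*-cong (exp-natR ℓ ln-β) refl)))
           (trans (G-at x (+ ℓ) (trans x≈ (trans (solve 2 (λ n a → n :+ a := a :+ n) refl (natR ℓ) α) (+-cong refl (ι-cong (≡.sym (fromℕ≡nat ℓ)))))) 0≤α (≤-trans α≤1 (ι≤ _ _)))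
             (g-unit α≤1)) ⟩
    exp ln-β ^ ℓ * exp (α * ln-β) * ((1# + u α) * exp (- (α * ln-β)))
      ≈⟨ solve 4 (λ b e w i → b :* e :* (w :* i) := b :* w :* (e :* i)) refl (exp ln-β ^ ℓ) (exp (α * ln-β)) (1# + u α) (exp (- (α * ln-β))) ⟩
    exp ln-β ^ ℓ * (1# + u α) * (exp (α * ln-β) * exp (- (α * ln-β)))
      ≈⟨ *-cong (*-cong (^-cong ℓ exp-ln-β) refl) (exp-inverse (α * ln-β)) ⟩
    β ^ ℓ * (1# + u α) * 1#
      ≈⟨ solve 1 (λ a → a :* con 1ℚ := a) refl (β ^ ℓ * (1# + u α)) ⟩
    β ^ ℓ * (1# + u α) ∎
    where
    ^-cong : ∀ n {x y} → x ≈ y → x ^ n ≈ y ^ n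
    ^-cong zero    _ = refl
    ^-cong (suc n) h = *-cong h (^-cong n h)

  -- From the integer sums to the main term

  natℤ : ℕ → R
  natℤ n = intR (+ n)

  natℤ-+ : ∀ m n → natℤ (m ℕ.+ n) ≈ natℤ m + natℤ n
  natℤ-+ m n = intR-+ (+ m) (+ n)

  natℤ-cong : ∀ {m n} → m ≡ n → natℤ m ≈ natℤ n
  natℤ-cong ≡.refl = refl

  natℤ-2^ : ∀ k → natℤ (2 ℕ.^ k) ≈ 2# ^ k
  natℤ-2^ zero    = refl
  natℤ-2^ (suc k) = trans (natℤ-cong (≡.cong (2 ℕ.^ k ℕ.+_) (ℕ.+-identityʳ (2 ℕ.^ k))))
    (trans (natℤ-+ (2 ℕ.^ k) (2 ℕ.^ k)) (trans (+-cong (natℤ-2^ k) (natℤ-2^ k)) (solve 1 (λ p → p :+ p := con (2 ∕ 1) :* p) refl (2# ^ k))))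

  1≤2^ : ∀ k → 1# ≤ 2# ^ k
  1≤2^ zero    = ≤-refl
  1≤2^ (suc k) = ≤-trans (≤-reflexive (solve 0 (con 1ℚ := con 1ℚ :* con 1ℚ) refl)) (*-mono-≤ 0≤1 (≤-trans 0≤1 (1≤2^ k)) (ι≤ _ _) (1≤2^ k))

  full-Y-error : ∀ k → ∣ natℤ (Y k) - c * (β ^ k * 1#) ∣ ≤ errorBound
  full-Y-error k = ∣∣≤-resp (+-cong (ι-cong (≡.cong (λ i → i ℚ./ 1) (≡.sym (proj₁ (Y≡B k))))) (-‿cong (*-cong refl (solve 1 (λ p → p := p :* con 1ℚ) refl (β ^ k))))) (error-bounded k)

  -- X k + Y k is the difference B (k + 2) - B (k + 1), and X₁ + 1 = β² - β; hence twice the error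
  -- of `B`.
  full-XY-error : ∀ k → ∣ natℤ (X k ℕ.+ Y k) - c * (β ^ k * (X₁ + 1#)) ∣ ≤ 2# * errorBound
  full-XY-error k = ≤-trans (∣∣≤-resp
      (trans (solve 5 (λ b₂ b₁ x c p → (b₂ :- c :* (x :* (x :* p))) :- (b₁ :- c :* (x :* p)) := (b₂ :- b₁) :- c :* (p :* (X₁P x :+ con 1ℚ))) refl (Bᴿ (2 ℕ.+ k)) (Bᴿ (1 ℕ.+ k)) β c (β ^ k))
        (+-cong B-difference refl))
      (∣-∣≤ (error-bounded (2 ℕ.+ k)) (error-bounded (1 ℕ.+ k))))
    (≤-reflexive (solve 1 (λ e → e :+ e := con (2 ∕ 1) :* e) refl errorBound))
    where
    B-difference : Bᴿ (2 ℕ.+ k) - Bᴿ (1 ℕ.+ k) ≈ natℤ (X k ℕ.+ Y k)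
    B-difference = trans (+-cong (trans (ι-cong (≡.cong (λ i → i ℚ./ 1) (proj₂ (Y≡B k)))) (intR-+ (B (1 ℕ.+ k)) (+ (X k ℕ.+ Y k)))) refl)
      (solve 2 (λ a b → (a :+ b) :- a := b) refl (Bᴿ (1 ℕ.+ k)) (natℤ (X k ℕ.+ Y k)))

  M : R
  M = 2# * errorBound

  0≤M : 0# ≤ M
  0≤M = *-nonNeg (ι≤ _ _) 0≤errorBound

  β*β⁻¹ : ∀ c p z → c * (β * p * (β⁻¹ * z)) ≈ c * (p * z)
  β*β⁻¹ c p z = trans (solve 5 (λ b i c p z → c :* (b :* p :* (i :* z)) := (i :* b) :* (c :* (p :* z))) refl β β⁻¹ c p z)
    (trans (*-cong β⁻¹*β refl) (solve 1 (λ a → con 1ℚ :* a := a) refl (c * (p * z))))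

  -- A letter 0 adds the errors of both entries and at most doubles them. A letter 1 copies the
  -- error of the first entry and adds that of a full sum, at most `M`. So the errors grow like 2 ^
  -- k.
  S-error : ∀ r → Linked NotBothOne r → let k = length r in
    ∣ natℤ (Sx k (value r)) - c * (β ^ k * vX r) ∣ ≤ M * 2# ^ k - M × ∣ natℤ (Sy k (value r)) - c * (β ^ k * vY r) ∣ ≤ M * 2# ^ k - M
  S-error [] _ = zero-case , zero-case
    where
    zero-case : ∣ natℤ 0 - c * (1# * 0#) ∣ ≤ M * 1# - M
    zero-case = ∣∣≤-resp (solve 1 (λ c → con 0ℚ :- con 0ℚ := con 0ℚ :- c :* (con 1ℚ :* con 0ℚ)) refl c)
      (≤-trans (∣x-x∣≤0 0#) (≤-reflexive (solve 1 (λ m → con 0ℚ := m :* con 1ℚ :- m) refl M)))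
  S-error (0F ∷ r) h =
    let (ex , ey) = S-error r (Linked.tail h)
        k = length r
        v = value r
        v≤F = ℕ.<⇒≤ (tail-value< r (Linked.tail h))
    in ≤-trans (∣∣≤-resp
         (trans (solve 5 (λ s t c p z → s :- c :* (p :* z) :+ t := (s :+ t) :- c :* (p :* z)) refl (natℤ (Sx k v)) (natℤ (Sy k v) - c * (β ^ k * vY r)) c (β ^ k) (vX r))
           (trans (solve 6 (λ s t c p z w → (s :+ (t :- c :* (p :* w))) :- c :* (p :* z) := (s :+ t) :- c :* (p :* (z :+ w))) refl (natℤ (Sx k v)) (natℤ (Sy k v)) c (β ^ k) (vX r) (vY r))
             (+-cong (trans (sym (natℤ-+ (Sx k v) (Sy k v))) (natℤ-cong (≡.sym (Sx-0 k v v≤F)))) (-‿cong (sym (β*β⁻¹ c (β ^ k) (vX r + vY r)))))))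
         (∣+∣≤ ex ey))
         (≤-by M 0≤M (solve 2 (λ m p → m :* (con (2 ∕ 1) :* p) :- m := (m :* p :- m) :+ (m :* p :- m) :+ m) refl M (2# ^ k))) ,
       ≤-trans (∣∣≤-resp (+-cong (natℤ-cong (≡.sym (Sy-0 k v v≤F))) (-‿cong (sym (β*β⁻¹ c (β ^ k) (vY r))))) ey)
         (≤-by (M * 2# ^ k) (*-nonNeg 0≤M (≤-trans 0≤1 (1≤2^ k))) (solve 2 (λ m p → m :* (con (2 ∕ 1) :* p) :- m := (m :* p :- m) :+ m :* p) refl M (2# ^ k)))
  S-error (1F ∷ r) h =
    let (ex , _) = S-error r (Linked.tail h)
        k = length r
        v = value r
        value≡ = ≡.cong (ℕ._+ v) (ℕ.*-identityˡ (F k))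
        bound : M + (M * 2# ^ k - M) ≤ M * (2# * 2# ^ k) - M
        bound = ≤-by (M * 2# ^ k - M) (diff-nonNeg (≤-trans (≤-reflexive (solve 1 (λ m → m := m :* con 1ℚ) refl M)) (*-monoʳ-≤ 0≤M (1≤2^ k))))
          (solve 2 (λ m p → m :* (con (2 ∕ 1) :* p) :- m := m :+ (m :* p :- m) :+ (m :* p :- m)) refl M (2# ^ k))
    in ≤-trans (∣∣≤-resp
         (trans (solve 6 (λ s t c p f z → (s :- c :* (p :* f)) :+ (t :- c :* (p :* z)) := (s :+ t) :- c :* (p :* (f :+ z))) refl (natℤ (X k ℕ.+ Y k)) (natℤ (Sx k v)) c (β ^ k) (X₁ + 1#) (vX r))
           (+-cong (trans (sym (natℤ-+ (X k ℕ.+ Y k) (Sx k v))) (natℤ-cong (≡.sym (≡.trans (≡.cong (Sx (suc k)) value≡) (Sx-1 k v))))) (-‿cong (sym (β*β⁻¹ c (β ^ k) (X₁ + 1# + vX r))))))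
         (∣+∣≤ (full-XY-error k) ex)) bound ,
       ≤-trans (∣∣≤-resp
         (trans (solve 6 (λ s t c p f z → (s :- c :* (p :* f)) :+ (t :- c :* (p :* z)) := (s :+ t) :- c :* (p :* (f :+ z))) refl (natℤ (Y k)) (natℤ (Sx k v)) c (β ^ k) 1# (vX r))
           (+-cong (trans (sym (natℤ-+ (Y k) (Sx k v))) (natℤ-cong (≡.sym (≡.trans (≡.cong (Sy (suc k)) value≡) (Sy-1 k v))))) (-‿cong (sym (β*β⁻¹ c (β ^ k) (1# + vX r))))))
         (∣+∣≤ (≤-trans (full-Y-error k) (≤-by errorBound 0≤errorBound (solve 1 (λ e → con (2 ∕ 1) :* e := e :+ e) refl errorBound))) ex)) bound

  A : R
  A = errorBound + (M + M) + ι (6 ∕ 1)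

  0≤A : 0# ≤ A
  0≤A = +-nonNeg (+-nonNeg 0≤errorBound (+-nonNeg 0≤M 0≤M)) (ι≤ _ _)

  sum-error : ∀ n r → rep n ≡ 1F ∷ 0F ∷ r → let k = length r in
    ∣ natℤ (ℕ.sum (map sF (upTo (suc n)))) - c * (β ^ suc k * (1# + u (position r))) ∣ ≤ A * 2# ^ k
  sum-error n r e =
    let k = length r
        v = value r
        (s , total , small) = summatory n r e
        linked = linked-10 n r e
        (ex , ey) = S-error r linked
        (vX≈ , vY≈) = v≈H r linked
        sx = natℤ (Sx k v)
        sy = natℤ (Sy k v)
    in ≤-trans (∣∣≤-resp
        (trans (solve 9 (λ b sx sy s c x p v w → ((b :- c :* (x :* p)) :+ ((sx :- c :* (p :* v)) :+ (sy :- c :* (p :* w)))) :+ s :=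
                  ((b :+ (sx :+ sy)) :+ s) :- (c :* (x :* p) :+ c :* (p :* (v :+ w)))) refl (Bᴿ (suc k)) sx sy (natℤ s) c β (β ^ k) (vX r) (vY r))
          (+-cong
            (sym (trans (ι-cong (≡.cong (λ i → i ℚ./ 1) total)) (trans (intR-+ (B (suc k) ℤ.+ + (Sx k v ℕ.+ Sy k v)) (+ s))
              (+-cong (trans (intR-+ (B (suc k)) (+ (Sx k v ℕ.+ Sy k v))) (+-cong refl (natℤ-+ (Sx k v) (Sy k v)))) refl))))
            (-‿cong (trans (+-cong refl (sym (β*β⁻¹ c (β ^ k) (vX r + vY r))))
              (trans (solve 4 (λ c p b z → c :* p :+ c :* (p :* (b :* z)) := c :* (p :* (con 1ℚ :+ b :* z))) refl c (β ^ suc k) β⁻¹ (vX r + vY r))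
                (*-cong refl (*-cong refl (+-cong refl (*-cong refl (+-cong vX≈ vY≈))))))))))
        (∣+∣≤ (∣+∣≤ (error-bounded (suc k)) (∣+∣≤ (weaken ex) (weaken ey))) (s≤ {s} {k} small)))
      (≤-by (errorBound * (2# ^ k - 1#)) (*-nonNeg 0≤errorBound (diff-nonNeg (1≤2^ k)))
        (solve 3 (λ e m p → (e :+ (m :+ m) :+ con (6 ∕ 1)) :* p := e :+ (m :* p :+ m :* p) :+ con (6 ∕ 1) :* p :+ e :* (p :- con 1ℚ)) refl errorBound M (2# ^ k)))
    where
    weaken : ∀ {z p} → z ≤ M * p - M → z ≤ M * p
    weaken {z} {p} h = ≤-trans h (≤-by M 0≤M (solve 2 (λ m p → m :* p := m :* p :- m :+ m) refl M p))
    s≤ : ∀ {s k} → s ℕ.≤ 6 ℕ.* 2 ℕ.^ k → ∣ natℤ s ∣ ≤ ι (6 ∕ 1) * 2# ^ k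
    s≤ {s} {k} h = ≤-trans (≤-reflexive (∣∣-nonNeg (intR-mono {+ 0} {+ s} (ℤ.+≤+ ℕ.z≤n)))) (≤-trans (intR-mono {+ s} {+ (6 ℕ.* 2 ℕ.^ k)} (ℤ.+≤+ h))
      (≤-reflexive (trans (ι-cong (≡.cong (λ i → i ℚ./ 1) (ℤ.pos-* 6 (2 ℕ.^ k)))) (trans (intR-* (+ 6) (+ (2 ℕ.^ k))) (*-cong refl (natℤ-2^ k))))))

  asymptotics : ∀ n r {x} → rep n ≡ 1F ∷ 0F ∷ r → x ≈ natR (suc (length r)) + position r →
    ∣ natℤ (ℕ.sum (map sF (upTo (suc n)))) - c * β^ x * G x ∣ ≤ A * 2# ^ length r
  asymptotics n r {x} e x≈ = ∣∣≤-resp (+-cong refl (-‿cong (trans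
      (*-cong refl (sym (exp*G (suc (length r)) x≈ (0≤position r) (<⇒≤ (position<1 r (linked-10 n r e))))))
      (solve 3 (λ a b c → a :* (b :* c) := a :* b :* c) refl c (β^ x) (G x)))))
    (sum-error n r e)

  -- 2 ≤ (10/11) β because β ≥ 11/5: here the crude error 2 ^ k is beaten by β ^ k.
  2^≤ : ∀ k → 2# ^ k ≤ q ^ k * β ^ k
  2^≤ k = ≤-trans (^-mono-≤ (ι≤ _ _) (≤-by (q * (β - lo)) (*-nonNeg (ι≤ _ _) (diff-nonNeg lo≤β))
      (solve 1 (λ b → con (10 ∕ 11) :* b := con (2 ∕ 1) :+ con (10 ∕ 11) :* (b :- con (11 ∕ 5))) refl β)) k)
    (≤-reflexive (^-distrib-* q β k))

  negligible : ∀ ε → 0# < ε → ∃[ N ] ∀ n r → N ℕ.≤ n → rep n ≡ 1F ∷ 0F ∷ r → A * 2# ^ length r ≤ ε * β ^ suc (length r)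
  negligible ε 0<ε =
    let (K , small) = null-scale A 0≤A null-q^ ε 0<ε
    -- From this threshold on, `rep-long` guarantees at least K digits after the leading 10.
    in F (2 ℕ.+ K) , λ n r N≤n e → let k = length r in begin
      A * 2# ^ k  ≤⟨ *-monoʳ-≤ 0≤A (2^≤ k) ⟩
      A * (q ^ k * β ^ k)  ≈⟨ solve 3 (λ a b c → a :* (b :* c) := a :* b :* c) refl A (q ^ k) (β ^ k) ⟩
      A * q ^ k * β ^ k  ≤⟨ *-monoˡ-≤ (^-nonNeg 0≤β k) (small k (rep-long K n r e N≤n)) ⟩
      ε * β ^ k  ≤⟨ *-monoʳ-≤ (<⇒≤ 0<ε) (≤-trans (≤-reflexive (solve 1 (λ p → p := con 1ℚ :* p) refl (β ^ k))) (*-monoˡ-≤ (^-nonNeg 0≤β k) 1≤β)) ⟩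
      ε * (β * β ^ k)  ∎

  -- Matching the series, quotients and logarithm of the statement

  1/! : ℕ → R
  1/! n = ι (1/ℕ (n !) {{n ℕ.!≢0}})

  1/!-suc : ∀ n → 1/! (suc n) ≈ unitR n * 1/! n
  1/!-suc n = trans (ι-cong (inverse-unique (+ (suc n !) ℚ./ 1) (m*1/m (suc n !) {{suc n ℕ.!≢0}}) inverse)) (ι-* (unit n) r)
    where
    r = 1/ℕ (n !) {{n ℕ.!≢0}}
    factors : + (suc n !) ℚ./ 1 ≡ nat (suc n) ℚ.* (+ (n !) ℚ./ 1)
    factors = ≡.trans (≡.cong (λ i → i ℚ./ 1) (ℤ.pos-* (suc n) (n !))) (≡.trans (fromℤ-* (+ suc n) (+ (n !))) (≡.cong (ℚ._* (+ (n !) ℚ./ 1)) (fromℕ≡nat (suc n))))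
    inverse : (+ (suc n !) ℚ./ 1) ℚ.* (unit n ℚ.* r) ≡ 1ℚ
    inverse = ≡.trans (≡.cong (ℚ._* (unit n ℚ.* r)) factors)
      (≡.trans (ℚSolver.solve 4 (λ a b c d → (a ℚSolver.:* b) ℚSolver.:* (c ℚSolver.:* d) ℚSolver.:= (a ℚSolver.:* c) ℚSolver.:* (b ℚSolver.:* d)) ≡.refl (nat (suc n)) (+ (n !) ℚ./ 1) (unit n) r)
        (≡.cong₂ ℚ._*_ (nat*unit n) (m*1/m (n !) {{n ℕ.!≢0}})))

  term≈ : ∀ x n → 1/! n * x ^ n ≈ term x n
  term≈ x zero    = solve 0 (con 1ℚ :* con 1ℚ := con 1ℚ) refl
  term≈ x (suc n) = trans (*-cong (1/!-suc n) refl) (trans (solve 4 (λ u f x p → u :* f :* (x :* p) := u :* (x :* (f :* p))) refl (unitR n) (1/! n) x (x ^ n))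
    (*-cong refl (*-cong refl (term≈ x n))))

  -- Describes the partial sums of the statement by their recursion, so that convergence is proved
  -- over the abstract field and transferred at the end.
  expSeries : (R → ℕ → R) → Set
  expSeries E = ∀ x → E x 0 ≈ 1# × (∀ n → E x (suc n) ≈ E x n + 1/! (suc n) * x ^ suc n)

  expSeries≈ : ∀ {E} → expSeries E → ∀ x n → E x n ≈ expSum x n
  expSeries≈ e x zero    = proj₁ (e x)
  expSeries≈ e x (suc n) = trans (proj₂ (e x) n) (+-cong (expSeries≈ e x n) (term≈ x (suc n)))

  Converges : (ℕ → R) → R → Set
  Converges v ℓ = ∀ ε → 0# < ε → ∃[ N ] ∀ n → N ℕ.≤ n → ∣ v n - ℓ ∣ < ε

  rate⇒converges : ∀ {v ℓ w} → (∀ n → ∣ v n - ℓ ∣ ≤ w n) → Null w → Converges v ℓ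
  rate⇒converges h null ε 0<ε = let (N , k) = null (ι ½ * ε) (half 0<ε) in N , λ n N≤n →
    ≤-<-trans (≤-trans (h n) (k n N≤n)) (<-by (ι ½ * ε) (half 0<ε) (sym (half+half ε)))

  exp-converges : ∀ {E} → expSeries E → ∀ x y → exp x ≈ y → Converges (E x) y
  exp-converges e x y ex≈y = rate⇒converges (λ n → ∣∣≤-resp (+-cong (sym (expSeries≈ e x n)) (-‿cong ex≈y)) (exp-rate x n)) (null-expRate x)

  ln-β-converges : ∀ {E} → expSeries E → Converges (E ln-β) β
  ln-β-converges e = exp-converges e ln-β β exp-ln-β

  β^-converges : ∀ {E} → expSeries E → ∀ x y → y ≈ x * ln-β → Converges (E y) (β^ x)
  β^-converges e x y y≈ = exp-converges e y (β^ x) (trans (exp-cong y≈) (exp≈β^ x))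

  inverse-uniqueᴿ : ∀ {y i j} → y * i ≈ 1# → y * j ≈ 1# → i ≈ j
  inverse-uniqueᴿ {y} {i} {j} yi yj = begin-equality
    i  ≈⟨ solve 1 (λ i → i := i :* con 1ℚ) refl i ⟩
    i * 1#  ≈⟨ *-cong refl yj ⟨
    i * (y * j)  ≈⟨ solve 3 (λ i y j → i :* (y :* j) := (y :* i) :* j) refl i y j ⟩
    y * i * j  ≈⟨ *-cong yi refl ⟩
    1# * j  ≈⟨ solve 1 (λ i → con 1ℚ :* i := i) refl j ⟩
    j  ∎

  ^-inverse : ∀ {y i} → y * i ≈ 1# → ∀ n → y ^ n * i ^ n ≈ 1#
  ^-inverse {y} {i} yi zero    = solve 0 (con 1ℚ :* con 1ℚ := con 1ℚ) refl
  ^-inverse {y} {i} yi (suc n) = trans (solve 4 (λ a b c d → (a :* b) :* (c :* d) := (a :* c) :* (b :* d)) refl y (y ^ n) i (i ^ n))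
    (trans (*-cong yi (^-inverse yi n)) (solve 0 (con 1ℚ :* con 1ℚ := con 1ℚ) refl))

  -- The division of the statement enters only through β ^ n * inv n ≈ 1; uniqueness of inverses
  -- identifies it with a power of `β⁻¹`, and a bounded error divided by β ^ n vanishes.
  B-converges : (inv : ℕ → R) → (∀ n → β ^ n * inv n ≈ 1#) → Converges (λ n → Bᴿ n * inv n) c
  B-converges inv β^*inv = rate⇒converges
    (λ n → ∣∣≤-resp (trans (solve 4 (λ b c p i → (b :- c :* p) :* i := b :* i :- c :* (p :* i)) refl (Bᴿ n) c (β ^ n) (β⁻¹ ^ n))
        (+-cong (*-cong refl (sym (inv≈ n))) (-‿cong (trans (*-cong refl (β^*β⁻¹^ n)) (solve 1 (λ c → c :* con 1ℚ := c) refl c)))))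
      (∣*∣≤ (error-bounded n) (≤-trans (≤-reflexive (∣∣-nonNeg (^-nonNeg 0≤β⁻¹ n))) (^-mono-≤ 0≤β⁻¹ (≤-trans β⁻¹≤5/11 (ι≤ _ _)) n))))
    (null-scale errorBound 0≤errorBound null-½^)
    where
    β^*β⁻¹^ : ∀ n → β ^ n * β⁻¹ ^ n ≈ 1#
    β^*β⁻¹^ = ^-inverse (trans (solve 2 (λ a b → a :* b := b :* a) refl β β⁻¹) β⁻¹*β)
    inv≈ : ∀ n → inv n ≈ β⁻¹ ^ n
    inv≈ n = inverse-uniqueᴿ (β^*inv n) (β^*β⁻¹^ n)

  -- `Φ` abstracts `φ-sum`, which carries the exponent as an index, whereas `position` is in Horner
  -- form; they differ by the factor φ⁻¹ ^ k.
  position≈ : (Φ : ℕ → Word → R) (inv : ℕ → R) → (∀ k → φ ^ suc k * inv k ≈ 1#) → (∀ k → Φ k [] ≈ 0#) →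
    (∀ k d r → Φ k (d ∷ r) ≈ natℤ (toℕ d) * inv k + Φ (suc k) r) → ∀ r → Φ 0 r ≈ position r
  position≈ Φ inv φ^*inv Φ-[] Φ-∷ r = trans (go 0 r) (solve 1 (λ p → con 1ℚ :* p := p) refl (position r))
    where
    inv≈ : ∀ k → inv k ≈ φ⁻¹ ^ suc k
    inv≈ k = inverse-uniqueᴿ (φ^*inv k) (^-inverse {φ} {φ⁻¹} (trans (solve 2 (λ a b → a :* b := a :* (b :* con 1ℚ)) refl φ φ⁻¹) (φ*φ⁻¹ 1#)) (suc k))
    go : ∀ k r → Φ k r ≈ φ⁻¹ ^ k * position r
    go k []       = trans (Φ-[] k) (solve 1 (λ p → con 0ℚ := p :* con 0ℚ) refl (φ⁻¹ ^ k))
    go k (0F ∷ r) = trans (Φ-∷ k 0F r) (trans (+-cong (*-cong refl (inv≈ k)) (go (suc k) r))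
      (solve 3 (λ i p a → con 0ℚ :* (i :* p) :+ i :* p :* a := p :* (i :* a)) refl φ⁻¹ (φ⁻¹ ^ k) (position r)))
    go k (1F ∷ r) = trans (Φ-∷ k 1F r) (trans (+-cong (*-cong refl (inv≈ k)) (go (suc k) r))
      (solve 3 (λ i p a → con 1ℚ :* (i :* p) :+ i :* p :* a := p :* (i :* (con 1ℚ :+ a))) refl φ⁻¹ (φ⁻¹ ^ k) (position r)))

  IsLog : R → Word → Set
  IsLog x r = x ≈ natℤ (suc (length r)) + position r

  floor-≤ : ∀ {x r} → IsLog x r → natℤ (suc (length r)) ≤ x
  floor-≤ {x} {r} e = ≤-by (position r) (0≤position r) e

  floor-< : ∀ {x r} → Linked NotBothOne r → IsLog x r → x < natℤ (suc (suc (length r)))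
  floor-< {x} {r} h e = ≤-<-trans (≤-reflexive e) (<-≤-trans (+-monoʳ-< (natℤ (suc (length r))) (position<1 r h))
    (≤-reflexive (trans (solve 1 (λ n → n :+ con 1ℚ := con 1ℚ :+ n) refl (natℤ (suc (length r)))) (sym (natℤ-+ 1 (suc (length r)))))))

  G-continuous-strict : ∀ x ε → 0# < ε → Σ[ δ ∈ R ] 0# < δ × (∀ y → ∣ y - x ∣ < δ → ∣ G y - G x ∣ < ε)
  G-continuous-strict x ε 0<ε = let (δ , 0<δ , h) = G-continuous x (ι ½ * ε) (half 0<ε) in
    δ , 0<δ , λ y yx<δ → ≤-<-trans (h y (<⇒≤ yx<δ)) (<-by (ι ½ * ε) (half 0<ε) (sym (half+half ε)))

  G-shift : ∀ x y → y ≈ x + 1# → G y ≈ G x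
  G-shift x y y≈ = trans (cont⇒cong G-continuous y≈) (G-periodic x)

  littleO : (log : ℕ → R) (pow : ℕ → R) → (∀ n r → rep n ≡ 1F ∷ 0F ∷ r → IsLog (log n) r × pow n ≈ β ^ suc (length r)) →
    ∀ ε → 0# < ε → ∃[ N ] ∀ n → N ℕ.≤ n → ∣ natℤ (ℕ.sum (map sF (upTo (suc n)))) - c * β^ (log n) * G (log n) ∣ ≤ ε * ∣ pow n ∣
  littleO log pow h ε 0<ε =
    let (N , small) = negligible ε 0<ε
    -- From 3 on the representation begins with 10, so that `log` and `pow` are determined.
    in N ℕ.⊔ 3 , λ n n≥ →
      let (r , e) = rep-10 n (ℕ.m⊔n≤o⇒n≤o N 3 n≥)
          (log≈ , pow≈) = h n r e
      in ≤-trans (asymptotics n r e (trans log≈ (+-cong (ι-cong (fromℕ≡nat (suc (length r)))) refl)))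
        (≤-trans (small n r (ℕ.m⊔n≤o⇒m≤o N 3 n≥) e)
          (*-monoʳ-≤ (<⇒≤ 0<ε) (≤-trans (≤-reflexive (sym pow≈)) (x≤∣x∣ (pow n)))))

-- Cauchy sequences form such a field

open import Defs
open Words using (rep-10; linked-10)
open ≡ using (refl; sym; trans; cong; cong₂; subst)

module S = Sequences
open ℚSolver using (solve; _:=_; _:+_; _:*_; _:-_; :-_; con)

eventually : ∀ {P Q : ℕ → Set} → (∃[ M ] ∀ n → M ℕ.≤ n → P n) → (∃[ N ] ∀ n → N ℕ.≤ n → Q n) →
  ∃[ N ] ∀ n → N ℕ.≤ n → P n × Q n
eventually (M , p) (N , q) = M ℕ.⊔ N , λ n n≥ → p n (ℕ.m⊔n≤o⇒m≤o M N n≥) , q n (ℕ.m⊔n≤o⇒n≤o M N n≥)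

≤-pointwise : ∀ x y → (∀ n → seq x n ℚ.≤ seq y n) → x ≤ y
≤-pointwise x y h ε 0<ε = 0 , λ n _ → ℚ.≤-trans (h n)
  (subst (ℚ._≤ seq y n ℚ.+ ε) (ℚ.+-identityʳ (seq y n)) (ℚ.+-monoʳ-≤ (seq y n) (ℚ.<⇒≤ 0<ε)))

≈-pointwise : ∀ x y → (∀ n → seq x n ≡ seq y n) → x ≈ y
≈-pointwise x y h ε 0<ε = 0 , λ n _ → ℚ.≤-trans (ℚ.≤-reflexive (cong ℚ.∣_∣ (trans (cong (ℚ._- seq y n) (h n)) (ℚ.+-inverseʳ (seq y n))))) (ℚ.<⇒≤ 0<ε)

ℝ-≤-reflexive : ∀ {x y} → x ≈ y → x ≤ y
ℝ-≤-reflexive x≈y ε 0<ε = let (N , h) = x≈y ε 0<ε in N , λ n N≤n → S.close⇒≤ (h n N≤n)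

ℝ-≤-antisym : ∀ {x y} → x ≤ y → y ≤ x → x ≈ y
ℝ-≤-antisym x≤y y≤x ε 0<ε = let (N , h) = eventually (x≤y ε 0<ε) (y≤x ε 0<ε) in
  N , λ n N≤n → S.≤⇒close (proj₁ (h n N≤n)) (proj₂ (h n N≤n))

ℝ-≤-trans : ∀ {x y z} → x ≤ y → y ≤ z → x ≤ z
ℝ-≤-trans {x} {y} {z} x≤y y≤z ε 0<ε =
  let (N , h) = eventually (x≤y (ε ℚ.* ½) (S.0<half 0<ε)) (y≤z (ε ℚ.* ½) (S.0<half 0<ε)) in
  N , λ n N≤n → let (p , q) = h n N≤n in begin
    seq x n  ≤⟨ p ⟩
    seq y n ℚ.+ ε ℚ.* ½  ≤⟨ ℚ.+-monoˡ-≤ (ε ℚ.* ½) q ⟩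
    seq z n ℚ.+ ε ℚ.* ½ ℚ.+ ε ℚ.* ½  ≡⟨ trans (ℚ.+-assoc (seq z n) _ _) (cong (seq z n ℚ.+_) (S.half+half ε)) ⟩
    seq z n ℚ.+ ε  ∎
  where open ℚ.≤-Reasoning

ℝ-≈-refl : ∀ {x} → x ≈ x
ℝ-≈-refl {x} = ≈-pointwise x x (λ _ → refl)

ℝ-≈-sym : ∀ {x y} → x ≈ y → y ≈ x
ℝ-≈-sym {x} {y} x≈y ε 0<ε = let (N , h) = x≈y ε 0<ε in N , λ n N≤n → subst (ℚ._≤ ε) (S.abs-sym (seq x n) (seq y n)) (h n N≤n)

ℝ-≈-trans : ∀ {x y z} → x ≈ y → y ≈ z → x ≈ z
ℝ-≈-trans {x} {y} {z} x≈y y≈z = ℝ-≤-antisym {x} {z}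
  (ℝ-≤-trans {x} {y} {z} (ℝ-≤-reflexive {x} {y} x≈y) (ℝ-≤-reflexive {y} {z} y≈z))
  (ℝ-≤-trans {z} {y} {x} (ℝ-≤-reflexive {z} {y} (ℝ-≈-sym {y} {z} y≈z)) (ℝ-≤-reflexive {y} {x} (ℝ-≈-sym {x} {y} x≈y)))

ℝ-+-mono-≤ : ∀ {x x′ y y′} → x ≤ x′ → y ≤ y′ → x + y ≤ x′ + y′
ℝ-+-mono-≤ {x} {x′} {y} {y′} x≤ y≤ ε 0<ε =
  let (N , h) = eventually (x≤ (ε ℚ.* ½) (S.0<half 0<ε)) (y≤ (ε ℚ.* ½) (S.0<half 0<ε)) in
  N , λ n N≤n → let (p , q) = h n N≤n in begin
    seq x n ℚ.+ seq y n  ≤⟨ ℚ.+-mono-≤ p q ⟩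
    (seq x′ n ℚ.+ ε ℚ.* ½) ℚ.+ (seq y′ n ℚ.+ ε ℚ.* ½)  ≡⟨ solve 3 (λ a b e → (a :+ e) :+ (b :+ e) := (a :+ b) :+ (e :+ e)) refl (seq x′ n) (seq y′ n) (ε ℚ.* ½) ⟩
    (seq x′ n ℚ.+ seq y′ n) ℚ.+ (ε ℚ.* ½ ℚ.+ ε ℚ.* ½)  ≡⟨ cong (seq x′ n ℚ.+ seq y′ n ℚ.+_) (S.half+half ε) ⟩
    (seq x′ n ℚ.+ seq y′ n) ℚ.+ ε  ∎
  where open ℚ.≤-Reasoning

ℝ-neg-mono-≤ : ∀ {x y} → x ≤ y → - y ≤ - x
ℝ-neg-mono-≤ {x} {y} x≤y ε 0<ε = let (N , h) = x≤y ε 0<ε in N , λ n N≤n → begin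
    ℚ.- seq y n  ≡⟨ solve 2 (λ y e → :- y := :- (y :+ e) :+ e) refl (seq y n) ε ⟩
    ℚ.- (seq y n ℚ.+ ε) ℚ.+ ε  ≤⟨ ℚ.+-monoˡ-≤ ε (ℚ.neg-antimono-≤ (h n N≤n)) ⟩
    ℚ.- seq x n ℚ.+ ε  ∎
  where open ℚ.≤-Reasoning

ℝ-+-cong : ∀ {x x′ y y′} → x ≈ x′ → y ≈ y′ → x + y ≈ x′ + y′
ℝ-+-cong {x} {x′} {y} {y′} x≈ y≈ = ℝ-≤-antisym {x + y} {x′ + y′}
  (ℝ-+-mono-≤ {x} {x′} {y} {y′} (ℝ-≤-reflexive {x} {x′} x≈) (ℝ-≤-reflexive {y} {y′} y≈))
  (ℝ-+-mono-≤ {x′} {x} {y′} {y} (ℝ-≤-reflexive {x′} {x} (ℝ-≈-sym {x} {x′} x≈)) (ℝ-≤-reflexive {y′} {y} (ℝ-≈-sym {y} {y′} y≈)))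

ℝ-neg-cong : ∀ {x y} → x ≈ y → - x ≈ - y
ℝ-neg-cong {x} {y} x≈y = ℝ-≤-antisym { - x} { - y}
  (ℝ-neg-mono-≤ {y} {x} (ℝ-≤-reflexive {y} {x} (ℝ-≈-sym {x} {y} x≈y))) (ℝ-neg-mono-≤ {x} {y} (ℝ-≤-reflexive {x} {y} x≈y))

ℝ-*-cong : ∀ {x x′ y y′} → x ≈ x′ → y ≈ y′ → x * y ≈ x′ * y′
ℝ-*-cong {x} {x′} {y} {y′} x≈ y≈ ε 0<ε =
  let (M₁ , 0<M₁ , b₁) = S.bounded {seq x} (cauchy x)
      (M₂ , 0<M₂ , b₂) = S.bounded {seq y′} (cauchy y′)
      (δ , 0<δ , eq₁) = S.scale {M₁} (ε ℚ.* ½) 0<M₁ (S.0<half 0<ε)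
      (η , 0<η , eq₂) = S.scale {M₂} (ε ℚ.* ½) 0<M₂ (S.0<half 0<ε)
      (N , h) = eventually (eventually b₁ b₂) (eventually (y≈ δ 0<δ) (x≈ η 0<η))
  in N , λ n N≤n → let ((p , q) , (r , s)) = h n N≤n in ℚ.≤-trans
       (S.*-close (seq x n) (seq y n) (seq x′ n) (seq y′ n) M₁ M₂ δ η p q r s)
       (ℚ.≤-reflexive (trans (cong₂ ℚ._+_ eq₁ eq₂) (S.half+half ε)))

ℝ-isCommutativeRing : IsCommutativeRing _≈_ _+_ _*_ -_ 0ℝ 1ℝ
ℝ-isCommutativeRing = record
  { isRing = record
    { +-isAbelianGroup = record
      { isGroup = record
        { isMonoid = record
          { isSemigroup = record
            { isMagma = record
              { isEquivalence = record
                { refl  = λ {x} → ℝ-≈-refl {x}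
                ; sym   = λ {x} {y} → ℝ-≈-sym {x} {y}
                ; trans = λ {x} {y} {z} → ℝ-≈-trans {x} {y} {z}
                }
              ; ∙-cong = λ {x} {x′} {y} {y′} → ℝ-+-cong {x} {x′} {y} {y′}
              }
            ; assoc = λ x y z → ≈-pointwise (x + y + z) (x + (y + z)) (λ n → ℚ.+-assoc (seq x n) (seq y n) (seq z n))
            }
          ; identity = (λ x → ≈-pointwise (0ℝ + x) x (λ n → ℚ.+-identityˡ (seq x n))) , (λ x → ≈-pointwise (x + 0ℝ) x (λ n → ℚ.+-identityʳ (seq x n)))
          }
        ; inverse = (λ x → ≈-pointwise (- x + x) 0ℝ (λ n → ℚ.+-inverseˡ (seq x n))) , (λ x → ≈-pointwise (x + - x) 0ℝ (λ n → ℚ.+-inverseʳ (seq x n)))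
        ; ⁻¹-cong = λ {x} {y} → ℝ-neg-cong {x} {y}
        }
      ; comm = λ x y → ≈-pointwise (x + y) (y + x) (λ n → ℚ.+-comm (seq x n) (seq y n))
      }
    ; *-cong = λ {x} {x′} {y} {y′} → ℝ-*-cong {x} {x′} {y} {y′}
    ; *-assoc = λ x y z → ≈-pointwise (x * y * z) (x * (y * z)) (λ n → ℚ.*-assoc (seq x n) (seq y n) (seq z n))
    ; *-identity = (λ x → ≈-pointwise (1ℝ * x) x (λ n → ℚ.*-identityˡ (seq x n))) , (λ x → ≈-pointwise (x * 1ℝ) x (λ n → ℚ.*-identityʳ (seq x n)))
    ; distrib = (λ x y z → ≈-pointwise (x * (y + z)) (x * y + x * z) (λ n → ℚ.*-distribˡ-+ (seq x n) (seq y n) (seq z n)))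
              , (λ x y z → ≈-pointwise ((y + z) * x) (y * x + z * x) (λ n → ℚ.*-distribʳ-+ (seq x n) (seq y n) (seq z n)))
    }
  ; *-comm = λ x y → ≈-pointwise (x * y) (y * x) (λ n → ℚ.*-comm (seq x n) (seq y n))
  }

fromℚ-< : ∀ {p q} → p ℚ.< q → fromℚ p < fromℚ q
fromℚ-< {p} {q} p<q = q ℚ.- p , 0<q-p , 0 , λ _ _ → ℚ.≤-reflexive (solve 2 (λ p q → p :+ (q :- p) := q) refl p q)
  where
  0<q-p : 0ℚ ℚ.< q ℚ.- p
  0<q-p = subst (ℚ._< q ℚ.- p) (ℚ.+-inverseʳ p) (ℚ.+-monoˡ-< (ℚ.- p) p<q)

ℝ-<⇒≤ : ∀ {x y} → x < y → x ≤ y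
ℝ-<⇒≤ {x} {y} (δ , 0<δ , N , h) ε 0<ε = N , λ n N≤n → begin
    seq x n  ≡⟨ ℚ.+-identityʳ (seq x n) ⟨
    seq x n ℚ.+ 0ℚ  ≤⟨ ℚ.+-monoʳ-≤ (seq x n) (ℚ.<⇒≤ 0<δ) ⟩
    seq x n ℚ.+ δ  ≤⟨ h n N≤n ⟩
    seq y n  ≡⟨ ℚ.+-identityʳ (seq y n) ⟨
    seq y n ℚ.+ 0ℚ  ≤⟨ ℚ.+-monoʳ-≤ (seq y n) (ℚ.<⇒≤ 0<ε) ⟩
    seq y n ℚ.+ ε  ∎
  where open ℚ.≤-Reasoning

ℝ-<-≤-trans : ∀ {x y z} → x < y → y ≤ z → x < z
ℝ-<-≤-trans {x} {y} {z} (δ , 0<δ , x<y) y≤z =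
  let (N , h) = eventually x<y (y≤z (δ ℚ.* ½) (S.0<half 0<δ)) in
  δ ℚ.* ½ , S.0<half 0<δ , N , λ n N≤n → let (p , q) = h n N≤n in begin
    seq x n ℚ.+ δ ℚ.* ½  ≡⟨ solve 2 (λ x e → x :+ e := (x :+ (e :+ e)) :- e) refl (seq x n) (δ ℚ.* ½) ⟩
    seq x n ℚ.+ (δ ℚ.* ½ ℚ.+ δ ℚ.* ½) ℚ.- δ ℚ.* ½  ≡⟨ cong (λ t → seq x n ℚ.+ t ℚ.- δ ℚ.* ½) (S.half+half δ) ⟩
    seq x n ℚ.+ δ ℚ.- δ ℚ.* ½  ≤⟨ S.p≤q+e⇒p-q≤e {seq x n ℚ.+ δ} {δ ℚ.* ½} (ℚ.≤-trans p (ℚ.≤-trans q (ℚ.≤-reflexive (ℚ.+-comm (seq z n) _)))) ⟩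
    seq z n  ∎
  where open ℚ.≤-Reasoning

ℝ-≤-<-trans : ∀ {x y z} → x ≤ y → y < z → x < z
ℝ-≤-<-trans {x} {y} {z} x≤y (δ , 0<δ , y<z) =
  let (N , h) = eventually y<z (x≤y (δ ℚ.* ½) (S.0<half 0<δ)) in
  δ ℚ.* ½ , S.0<half 0<δ , N , λ n N≤n → let (p , q) = h n N≤n in begin
    seq x n ℚ.+ δ ℚ.* ½  ≤⟨ ℚ.+-monoˡ-≤ (δ ℚ.* ½) q ⟩
    seq y n ℚ.+ δ ℚ.* ½ ℚ.+ δ ℚ.* ½  ≡⟨ trans (ℚ.+-assoc (seq y n) _ _) (cong (seq y n ℚ.+_) (S.half+half δ)) ⟩
    seq y n ℚ.+ δ  ≤⟨ p ⟩
    seq z n  ∎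
  where open ℚ.≤-Reasoning

ℝ-<-irrefl : ∀ {x} → ¬ x < x
ℝ-<-irrefl {x} (δ , 0<δ , N , h) = ℚ.<-irrefl refl (ℚ.<-≤-trans
  (subst (ℚ._< seq x N ℚ.+ δ) (ℚ.+-identityʳ (seq x N)) (ℚ.+-monoʳ-< (seq x N) 0<δ)) (h N ℕ.≤-refl))

-- One rational comparison, at an index beyond which both sequences vary by at most e = ε/5. Either
-- y ≤ x + 3e there, and the drifts give y ≤ x + 5e later; or the gap exceeds 3e, and a margin of e
-- survives the two drifts, so that x < y.
ℝ-≮⇒≥ : ∀ {x y} → ¬ x < y → y ≤ x
ℝ-≮⇒≥ {x} {y} x≮y ε 0<ε = decide (seq y N ℚ.≤? seq x N ℚ.+ 3e)
  where
  open ℚ.≤-Reasoning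
  fifth : ℚ
  fifth = 1 ∕ 5
  e 3e : ℚ
  e = ε ℚ.* fifth
  3e = e ℚ.+ e ℚ.+ e
  0<e : 0ℚ ℚ.< e
  0<e = S.0<* 0<ε (ℚ.positive⁻¹ fifth)
  cx = cauchy x e 0<e
  cy = cauchy y e 0<e
  N = proj₁ cx ℕ.⊔ proj₁ cy
  near-x : ∀ m n → N ℕ.≤ m → N ℕ.≤ n → seq x m ℚ.≤ seq x n ℚ.+ e
  near-x m n m≥ n≥ = S.close⇒≤ (proj₂ cx m n (ℕ.m⊔n≤o⇒m≤o _ (proj₁ cy) m≥) (ℕ.m⊔n≤o⇒m≤o _ (proj₁ cy) n≥))
  near-y : ∀ m n → N ℕ.≤ m → N ℕ.≤ n → seq y m ℚ.≤ seq y n ℚ.+ e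
  near-y m n m≥ n≥ = S.close⇒≤ (proj₂ cy m n (ℕ.m⊔n≤o⇒n≤o (proj₁ cx) _ m≥) (ℕ.m⊔n≤o⇒n≤o (proj₁ cx) _ n≥))
  five : e ℚ.+ 3e ℚ.+ e ≡ ε
  five = trans (solve 2 (λ ε f → (ε :* f :+ (ε :* f :+ ε :* f :+ ε :* f) :+ ε :* f) := ε :* (f :+ f :+ f :+ f :+ f)) refl ε fifth) (ℚ.*-identityʳ ε)
  decide : _ → _
  decide (yes h) = N , λ n N≤n → begin
    seq y n  ≤⟨ near-y n N N≤n ℕ.≤-refl ⟩
    seq y N ℚ.+ e  ≤⟨ ℚ.+-monoˡ-≤ e h ⟩
    seq x N ℚ.+ 3e ℚ.+ e  ≤⟨ ℚ.+-monoˡ-≤ e (ℚ.+-monoˡ-≤ 3e (near-x N n ℕ.≤-refl N≤n)) ⟩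
    seq x n ℚ.+ e ℚ.+ 3e ℚ.+ e  ≡⟨ solve 3 (λ x e f → x :+ e :+ f :+ e := x :+ (e :+ f :+ e)) refl (seq x n) e 3e ⟩
    seq x n ℚ.+ (e ℚ.+ 3e ℚ.+ e)  ≡⟨ cong (seq x n ℚ.+_) five ⟩
    seq x n ℚ.+ ε  ∎
  decide (no ¬h) = contradiction (e , 0<e , N , λ n N≤n → begin
    seq x n ℚ.+ e  ≤⟨ ℚ.+-monoˡ-≤ e (near-x n N N≤n ℕ.≤-refl) ⟩
    seq x N ℚ.+ e ℚ.+ e  ≡⟨ solve 2 (λ x e → x :+ e :+ e := x :+ (e :+ e :+ e) :- e) refl (seq x N) e ⟩
    seq x N ℚ.+ 3e ℚ.- e  ≤⟨ ℚ.+-monoˡ-≤ (ℚ.- e) (ℚ.<⇒≤ (ℚ.≰⇒> ¬h)) ⟩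
    seq y N ℚ.- e  ≤⟨ S.p≤q+e⇒p-q≤e {seq y N} {e} (ℚ.≤-trans (near-y N n ℕ.≤-refl N≤n) (ℚ.≤-reflexive (ℚ.+-comm (seq y n) e))) ⟩
    seq y n  ∎) x≮y

ℝ-+-monoʳ-< : ∀ z {x y} → x < y → z + x < z + y
ℝ-+-monoʳ-< z {x} {y} (δ , 0<δ , N , h) = δ , 0<δ , N , λ n N≤n → ℚ.≤-trans
  (ℚ.≤-reflexive (ℚ.+-assoc (seq z n) (seq x n) δ)) (ℚ.+-monoʳ-≤ (seq z n) (h n N≤n))

∣∣-of-nonNeg : ∀ {x} → 0ℝ ≤ x → x ≈ ∣ x ∣
∣∣-of-nonNeg {x} 0≤x = ℝ-≤-antisym {x} {∣ x ∣} (≤-pointwise x ∣ x ∣ (λ n → S.≤-abs (seq x n)))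
  (λ ε 0<ε → let (N , h) = 0≤x (ε ℚ.* ½) (S.0<half 0<ε) in N , λ n N≤n → S.abs-≤
    (subst (ℚ._≤ seq x n ℚ.+ ε) (ℚ.+-identityʳ (seq x n)) (ℚ.+-monoʳ-≤ (seq x n) (ℚ.<⇒≤ 0<ε)))
    (begin
      ℚ.- seq x n  ≡⟨ solve 1 (λ x → :- x := con 0ℚ :+ (con 0ℚ :- x)) refl (seq x n) ⟩
      0ℚ ℚ.+ (0ℚ ℚ.- seq x n)  ≤⟨ ℚ.+-mono-≤ (h n N≤n) (ℚ.+-monoˡ-≤ (ℚ.- seq x n) (h n N≤n)) ⟩
      (seq x n ℚ.+ ε ℚ.* ½) ℚ.+ ((seq x n ℚ.+ ε ℚ.* ½) ℚ.- seq x n)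
        ≡⟨ solve 2 (λ x e → (x :+ e) :+ ((x :+ e) :- x) := x :+ (e :+ e)) refl (seq x n) (ε ℚ.* ½) ⟩
      seq x n ℚ.+ (ε ℚ.* ½ ℚ.+ ε ℚ.* ½)  ≡⟨ cong (seq x n ℚ.+_) (S.half+half ε) ⟩
      seq x n ℚ.+ ε  ∎))
  where open ℚ.≤-Reasoning

-- A nonnegative real may have negative approximants, so both factors are first replaced by their
-- absolute values.
ℝ-*-nonNeg : ∀ {x y} → 0ℝ ≤ x → 0ℝ ≤ y → 0ℝ ≤ x * y
ℝ-*-nonNeg {x} {y} 0≤x 0≤y = ℝ-≤-trans {0ℝ} {∣ x ∣ * ∣ y ∣} {x * y}
  (≤-pointwise 0ℝ (∣ x ∣ * ∣ y ∣) (λ n → S.*-mono-≤ {0ℚ} {ℚ.∣ seq x n ∣} {0ℚ} {ℚ.∣ seq y n ∣} ℚ.≤-refl (ℚ.0≤∣p∣ (seq x n)) ℚ.≤-refl (ℚ.0≤∣p∣ (seq y n))))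
  (ℝ-≤-reflexive {∣ x ∣ * ∣ y ∣} {x * y} (ℝ-≈-sym {x * y} {∣ x ∣ * ∣ y ∣} (ℝ-*-cong {x} {∣ x ∣} {y} {∣ y ∣} (∣∣-of-nonNeg {x} 0≤x) (∣∣-of-nonNeg {y} 0≤y))))

ℝ-∣∣-lub : ∀ {x y} → x ≤ y → - x ≤ y → ∣ x ∣ ≤ y
ℝ-∣∣-lub x≤y -x≤y ε 0<ε = let (N , h) = eventually (x≤y ε 0<ε) (-x≤y ε 0<ε) in N , λ n N≤n → S.abs-≤ (proj₁ (h n N≤n)) (proj₂ (h n N≤n))

ℝ-archimedean : ∀ x {ε} → 0ℝ < ε → ∃[ n ] x ≤ fromℚ (S.nat n) * ε
ℝ-archimedean x {ε} (δ , 0<δ , h) =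
  let (M , 0<M , b) = S.bounded {seq x} (cauchy x)
      (D , 0<D , δD≡M) = S.scale {δ} M 0<δ 0<M
      (k , D≤k) = S.archimedean D
      (N , e) = eventually h b
  in k , λ η 0<η → N , λ n N≤n → let (p , q) = e n N≤n in begin
    seq x n  ≤⟨ ℚ.≤-trans (S.≤-abs (seq x n)) q ⟩
    M  ≡⟨ trans (sym δD≡M) (ℚ.*-comm δ D) ⟩
    D ℚ.* δ  ≤⟨ S.*-mono-≤ (ℚ.<⇒≤ 0<D) D≤k (ℚ.<⇒≤ 0<δ) (ℚ.≤-trans (ℚ.≤-reflexive (sym (ℚ.+-identityˡ δ))) p) ⟩
    S.nat k ℚ.* seq ε n  ≡⟨ ℚ.+-identityʳ _ ⟨
    S.nat k ℚ.* seq ε n ℚ.+ 0ℚ  ≤⟨ ℚ.+-monoʳ-≤ (S.nat k ℚ.* seq ε n) (ℚ.<⇒≤ 0<η) ⟩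
    S.nat k ℚ.* seq ε n ℚ.+ η  ∎
  where open ℚ.≤-Reasoning

floor : ∀ p → ∃[ m ] m ℚ./ 1 ℚ.≤ p × p ℚ.≤ m ℚ./ 1 ℚ.+ 1ℚ
floor p@(mkℚ n d _) = m ,
  subst (ℚ._≤ p) (sym (fromℤ-mkℚ m)) (ℚ.*≤* (ℤ.≤-trans (ℤ.[n/ℕd]*d≤n n (suc d)) (ℤ.≤-reflexive (sym (ℤ.*-identityʳ n))))) ,
  subst (p ℚ.≤_) (trans (sym (fromℤ-mkℚ (ℤ.suc m))) (trans (fromℤ-+ (+ 1) m) (ℚ.+-comm 1ℚ (m ℚ./ 1))))
    (ℚ.*≤* (ℤ.≤-trans (ℤ.≤-reflexive (ℤ.*-identityʳ n)) (ℤ.<⇒≤ (ℤ.n<s[n/ℕd]*d n (suc d)))))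
  where
  m = n ℤ./ℕ suc d

-- m is the floor of a - ½ for a rational approximation a within 1/4 of x; then a lies in
-- [m + 1/2, m + 3/2], and 1/4 is lost on either side.
ℝ-nearby-integer : ∀ x → ∃[ m ] fromℚ (m ℚ./ 1) + fromℚ (1 ∕ 4) ≤ x × x ≤ fromℚ (m ℚ./ 1) + fromℚ (7 ∕ 4)
ℝ-nearby-integer x = m ,
  (λ ε 0<ε → N , λ n N≤n → weaken 0<ε (begin
    M ℚ.+ ¼  ≤⟨ ℚ.+-monoˡ-≤ ¼ (proj₁ (proj₂ fl)) ⟩
    seq x N ℚ.- ½ ℚ.+ ¼  ≤⟨ ℚ.+-monoˡ-≤ ¼ (ℚ.+-monoˡ-≤ (ℚ.- ½) (near N n ℕ.≤-refl N≤n)) ⟩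
    seq x n ℚ.+ ¼ ℚ.- ½ ℚ.+ ¼  ≡⟨ solve 1 (λ x → x :+ con ¼ :- con ½ :+ con ¼ := x) refl (seq x n) ⟩
    seq x n  ∎)) ,
  (λ ε 0<ε → N , λ n N≤n → weaken 0<ε (begin
    seq x n  ≤⟨ near n N N≤n ℕ.≤-refl ⟩
    seq x N ℚ.+ ¼  ≡⟨ solve 1 (λ x → x :+ con ¼ := x :- con ½ :+ con (3 ∕ 4)) refl (seq x N) ⟩
    seq x N ℚ.- ½ ℚ.+ (3 ∕ 4)  ≤⟨ ℚ.+-monoˡ-≤ (3 ∕ 4) (proj₂ (proj₂ fl)) ⟩
    M ℚ.+ 1ℚ ℚ.+ (3 ∕ 4)  ≡⟨ solve 1 (λ m → m :+ con 1ℚ :+ con (3 ∕ 4) := m :+ con (7 ∕ 4)) refl M ⟩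
    M ℚ.+ (7 ∕ 4)  ∎))
  where
  open ℚ.≤-Reasoning
  ¼ : ℚ
  ¼ = 1 ∕ 4
  cx = cauchy x ¼ (ℚ.positive⁻¹ ¼)
  N = proj₁ cx
  fl = floor (seq x N ℚ.- ½)
  m = proj₁ fl
  M = m ℚ./ 1
  near : ∀ i j → N ℕ.≤ i → N ℕ.≤ j → seq x i ℚ.≤ seq x j ℚ.+ ¼
  near i j i≥ j≥ = S.close⇒≤ (proj₂ cx i j i≥ j≥)
  weaken : ∀ {p q ε} → 0ℚ ℚ.< ε → p ℚ.≤ q → p ℚ.≤ q ℚ.+ ε
  weaken {p} {q} {ε} 0<ε p≤q = ℚ.≤-trans p≤q (subst (ℚ._≤ q ℚ.+ ε) (ℚ.+-identityʳ q) (ℚ.+-monoʳ-≤ q (ℚ.<⇒≤ 0<ε)))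

-- Diagonal argument: the k-th entry approximates u k within ½ ^ k. Entries of different u m and u n
-- are compared through a common late index, which costs four errors; hence the quarters.
ℝ-complete : (u : ℕ → ℝ) → (∀ ε → 0ℝ < ε → ∃[ N ] ∀ m n → N ℕ.≤ m → N ℕ.≤ n → ∣ u m + - u n ∣ ≤ ε) →
  Σ[ ℓ ∈ ℝ ] ∀ ε → 0ℝ < ε → ∃[ N ] ∀ n → N ℕ.≤ n → ∣ u n + - ℓ ∣ ≤ ε
ℝ-complete u cu = mkℝ diagonal diagonal-cauchy , converges
  where
  open ℚ.≤-Reasoning
  0<½^ : ∀ n → 0ℚ ℚ.< S.½^ n
  0<½^ zero    = ℚ.positive⁻¹ 1ℚ
  0<½^ (suc n) = S.0<half (0<½^ n)
  index : ℕ → ℕ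
  index k = proj₁ (cauchy (u k) (S.½^ k) (0<½^ k))
  diagonal : ℕ → ℚ
  diagonal k = seq (u k) (index k)
  near : ∀ k n → index k ℕ.≤ n → ℚ.∣ diagonal k ℚ.- seq (u k) n ∣ ℚ.≤ S.½^ k
  near k n h = proj₂ (cauchy (u k) (S.½^ k) (0<½^ k)) (index k) n ℕ.≤-refl h
  triangle : ∀ a b c {d e} → ℚ.∣ a ℚ.- b ∣ ℚ.≤ d → ℚ.∣ b ℚ.- c ∣ ℚ.≤ e → ℚ.∣ a ℚ.- c ∣ ℚ.≤ d ℚ.+ e
  triangle a b c {d} {e} h k = begin
    ℚ.∣ a ℚ.- c ∣  ≡⟨ cong ℚ.∣_∣ (solve 3 (λ a b c → a :- c := (a :- b) :+ (b :- c)) refl a b c) ⟩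
    ℚ.∣ (a ℚ.- b) ℚ.+ (b ℚ.- c) ∣  ≤⟨ ℚ.∣p+q∣≤∣p∣+∣q∣ (a ℚ.- b) (b ℚ.- c) ⟩
    ℚ.∣ a ℚ.- b ∣ ℚ.+ ℚ.∣ b ℚ.- c ∣  ≤⟨ ℚ.+-mono-≤ h k ⟩
    d ℚ.+ e  ∎
  quarter : ℚ → ℚ
  quarter ε = ε ℚ.* ½ ℚ.* ½
  0<quarter : ∀ {ε} → 0ℚ ℚ.< ε → 0ℚ ℚ.< quarter ε
  0<quarter 0<ε = S.0<half (S.0<half 0<ε)
  quarters : ∀ ε → quarter ε ℚ.+ ((quarter ε ℚ.+ quarter ε) ℚ.+ quarter ε) ≡ ε
  quarters ε = trans (solve 2 (λ e h → e :* h :* h :+ ((e :* h :* h :+ e :* h :* h) :+ e :* h :* h) := e :* (h :* h :+ (h :* h :+ h :* h) :+ h :* h)) refl ε ½) (ℚ.*-identityʳ ε)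
  small : ∀ ε → 0ℚ ℚ.< ε → ∃[ N ] ∀ n → N ℕ.≤ n → S.½^ n ℚ.≤ ε
  small ε 0<ε = let (N , h) = S.½^-small {1ℚ} ε (ℚ.positive⁻¹ 1ℚ) 0<ε in N , λ n N≤n → subst (ℚ._≤ ε) (ℚ.*-identityˡ (S.½^ n)) (h n N≤n)
  close : ∀ ε → 0ℚ ℚ.< ε → ∃[ N ] ∀ m n → N ℕ.≤ m → N ℕ.≤ n → ∣ u m + - u n ∣ ≤ fromℚ ε
  close ε 0<ε = cu (fromℚ ε) (fromℚ-< 0<ε)
  diagonal-cauchy : IsCauchy diagonal
  diagonal-cauchy ε 0<ε =
    let e = quarter ε
        (N₁ , h) = close e (0<quarter 0<ε)
        (N₂ , k) = small e (0<quarter 0<ε)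
    in N₁ ℕ.⊔ N₂ , λ m n m≥ n≥ →
      let (N₃ , g) = h m n (ℕ.m⊔n≤o⇒m≤o N₁ N₂ m≥) (ℕ.m⊔n≤o⇒m≤o N₁ N₂ n≥) e (0<quarter 0<ε)
          i = N₃ ℕ.⊔ (index m ℕ.⊔ index n)
          i≥ = ℕ.m≤n⊔m N₃ (index m ℕ.⊔ index n)
      in ℚ.≤-trans
        (triangle (diagonal m) (seq (u m) i) (diagonal n)
          (ℚ.≤-trans (near m i (ℕ.≤-trans (ℕ.m≤m⊔n _ (index n)) i≥)) (k m (ℕ.m⊔n≤o⇒n≤o N₁ N₂ m≥)))
          (triangle (seq (u m) i) (seq (u n) i) (diagonal n)
            (g i (ℕ.m≤m⊔n N₃ _))
            (ℚ.≤-trans (ℚ.≤-reflexive (S.abs-sym (seq (u n) i) (diagonal n))) (ℚ.≤-trans (near n i (ℕ.≤-trans (ℕ.m≤n⊔m (index m) _) i≥)) (k n (ℕ.m⊔n≤o⇒n≤o N₁ N₂ n≥))))))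
        (ℚ.≤-reflexive (quarters ε))
  converges : ∀ ε → 0ℝ < ε → ∃[ N ] ∀ n → N ℕ.≤ n → ∣ u n + - mkℝ diagonal diagonal-cauchy ∣ ≤ ε
  converges ε (δ , 0<δ , N₀ , δ≤ε) =
    let e = quarter δ
        (N₁ , h) = close e (0<quarter 0<δ)
        (N₂ , k) = small e (0<quarter 0<δ)
    in N₁ , λ n n≥ η 0<η →
      let (N₃ , c) = cauchy (u n) e (0<quarter 0<δ)
      in N₀ ℕ.⊔ (N₃ ℕ.⊔ (N₁ ℕ.⊔ N₂)) , λ i i≥ →
      let i≥′ = ℕ.m⊔n≤o⇒n≤o N₀ _ i≥
          i≥″ = ℕ.m⊔n≤o⇒n≤o N₃ _ i≥′
          i≥N₃ = ℕ.m⊔n≤o⇒m≤o N₃ _ i≥′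
          (N₄ , g) = h n i n≥ (ℕ.m⊔n≤o⇒m≤o N₁ N₂ i≥″) e (0<quarter 0<δ)
          j = N₄ ℕ.⊔ (index i ℕ.⊔ i)
          j≥ = ℕ.m≤n⊔m N₄ (index i ℕ.⊔ i)
      in begin
        ℚ.∣ seq (u n) i ℚ.- diagonal i ∣
          ≤⟨ triangle (seq (u n) i) (seq (u n) j) (diagonal i)
               (c i j i≥N₃ (ℕ.≤-trans i≥N₃ (ℕ.≤-trans (ℕ.m≤n⊔m (index i) i) j≥)))
               (triangle (seq (u n) j) (seq (u i) j) (diagonal i) (g j (ℕ.m≤m⊔n N₄ _))
                 (ℚ.≤-trans (ℚ.≤-reflexive (S.abs-sym (seq (u i) j) (diagonal i)))
                   (ℚ.≤-trans (near i j (ℕ.≤-trans (ℕ.m≤m⊔n (index i) i) j≥)) (k i (ℕ.m⊔n≤o⇒n≤o N₁ N₂ i≥″))))) ⟩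
        e ℚ.+ ((e ℚ.+ e) ℚ.+ e)  ≡⟨ trans (quarters δ) (sym (ℚ.+-identityˡ δ)) ⟩
        0ℚ ℚ.+ δ  ≤⟨ δ≤ε i (ℕ.m⊔n≤o⇒m≤o N₀ _ i≥) ⟩
        seq ε i  ≡⟨ ℚ.+-identityʳ (seq ε i) ⟨
        seq ε i ℚ.+ 0ℚ  ≤⟨ ℚ.+-monoʳ-≤ (seq ε i) (ℚ.<⇒≤ 0<η) ⟩
        seq ε i ℚ.+ η  ∎

ℝ-field : RealField
ℝ-field = record
  { R = ℝ ; _≈_ = _≈_ ; _≤_ = _≤_ ; _<_ = _<_ ; _+_ = _+_ ; _*_ = _*_ ; -_ = -_ ; ∣_∣ = ∣_∣ ; ι = fromℚ
  ; isCommutativeRing = ℝ-isCommutativeRing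
  ; ι-+ = λ p q → ≈-pointwise (fromℚ (p ℚ.+ q)) (fromℚ p + fromℚ q) (λ _ → refl)
  ; ι-* = λ p q → ≈-pointwise (fromℚ (p ℚ.* q)) (fromℚ p * fromℚ q) (λ _ → refl)
  ; ι-neg = λ p → ≈-pointwise (fromℚ (ℚ.- p)) (- fromℚ p) (λ _ → refl)
  ; ι-≤ = λ {p} {q} p≤q → ≤-pointwise (fromℚ p) (fromℚ q) (λ _ → p≤q)
  ; ι-< = fromℚ-<
  ; ≤-reflexive = λ {x} {y} → ℝ-≤-reflexive {x} {y}
  ; ≤-trans = λ {x} {y} {z} → ℝ-≤-trans {x} {y} {z}
  ; ≤-antisym = λ {x} {y} → ℝ-≤-antisym {x} {y}
  ; <⇒≤ = λ {x} {y} → ℝ-<⇒≤ {x} {y}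
  ; <-≤-trans = λ {x} {y} {z} → ℝ-<-≤-trans {x} {y} {z}
  ; ≤-<-trans = λ {x} {y} {z} → ℝ-≤-<-trans {x} {y} {z}
  ; <-irrefl = λ {x} → ℝ-<-irrefl {x}
  ; ≮⇒≥ = λ {x} {y} → ℝ-≮⇒≥ {x} {y}
  ; +-monoʳ-≤ = λ z {x} {y} → ℝ-+-mono-≤ {z} {z} {x} {y} (ℝ-≤-reflexive {z} {z} (ℝ-≈-refl {z}))
  ; +-monoʳ-< = λ z {x} {y} → ℝ-+-monoʳ-< z {x} {y}
  ; *-nonNeg = λ {x} {y} → ℝ-*-nonNeg {x} {y}
  ; *-pos = λ {x} {y} → 0<* x y
  ; x≤∣x∣ = λ x → ≤-pointwise x ∣ x ∣ (λ n → S.≤-abs (seq x n))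
  ; -x≤∣x∣ = λ x → ≤-pointwise (- x) ∣ x ∣ (λ n → ℚ.≤-trans (S.≤-abs (ℚ.- seq x n)) (ℚ.≤-reflexive (ℚ.∣-p∣≡∣p∣ (seq x n))))
  ; ∣∣-lub = λ {x} {y} → ℝ-∣∣-lub {x} {y}
  ; archimedean = λ x {ε} → ℝ-archimedean x {ε}
  ; nearby-integer = ℝ-nearby-integer
  ; complete = ℝ-complete
  }

-- Square roots

√-mono : ∀ x y → x ≤ y → √ x ≤ √ y
√-mono x y x≤y ε 0<ε =
  let 0<e = S.0<half 0<ε
      0<ee = S.0<* 0<e 0<e
      (C , 0<C , N₁ , b) = S.bounded {seq y} (cauchy y)
      (N , h) = eventually (eventually (N₁ , b) (x≤y _ 0<ee)) (S.½^-small {C ℚ.+ 1ℚ} (ε ℚ.* ½) (ℚ.+-mono-< 0<C (ℚ.positive⁻¹ 1ℚ)) 0<e)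
  in N , λ n N≤n → let ((y≤C , xy) , small) = h n N≤n in
    S.lo-≤ (seq x n ℚ.⊔ 0ℚ) (seq y n ℚ.⊔ 0ℚ) n n ε (S.0≤⊔ (seq x n)) (S.0≤⊔ (seq y n)) 0<ε
      (S.width-small (seq y n) C (ε ℚ.* ½) n (ℚ.≤-trans (S.≤-abs (seq y n)) y≤C) (ℚ.<⇒≤ 0<C) small)
      (S.⊔-close 0ℚ {seq x n} {seq y n} (ℚ.<⇒≤ 0<ee) xy)

√5 : ℝ
√5 = √ fromℕ 5

-- The bisection keeps q between s² and (s + w)², and the width w tends to 0.
√*√≈ : ∀ q → 0ℚ ℚ.≤ q → √ fromℚ q * √ fromℚ q ≈ fromℚ q
√*√≈ q 0≤q = ℝ-≤-antisym {√ fromℚ q * √ fromℚ q} {fromℚ q}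
  (≤-pointwise (√ fromℚ q * √ fromℚ q) (fromℚ q) (λ n → subst (s n ℚ.* s n ℚ.≤_) Q≡q (S.lo²≤ {Q} n (S.0≤⊔ q)))) upper
  where
  open ℚ.≤-Reasoning
  Q : ℚ
  Q = q ℚ.⊔ 0ℚ
  Q≡q : Q ≡ q
  Q≡q = ℚ.p≥q⇒p⊔q≡p 0≤q
  s : ℕ → ℚ
  s = S.lo Q
  upper : fromℚ q ≤ √ fromℚ q * √ fromℚ q
  upper ε 0<ε =
    let (M , 0<M , b) = S.bounded {s} (cauchy (√ fromℚ q))
        -- Bounds 2s + w, the factor of w in (s + w)² - s², once w ≤ 1.
        K = M ℚ.+ M ℚ.+ 1ℚ
        0<K = ℚ.+-mono-< (ℚ.+-mono-< 0<M 0<M) (ℚ.positive⁻¹ 1ℚ)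
        0<Q+1 = ℚ.+-mono-≤-< (S.0≤⊔ q) (ℚ.positive⁻¹ 1ℚ)
        (N , h) = eventually (eventually b (S.½^-small {Q ℚ.+ 1ℚ} 1ℚ 0<Q+1 (ℚ.positive⁻¹ 1ℚ)))
                    (S.½^-small {K ℚ.* (Q ℚ.+ 1ℚ)} ε (S.0<* 0<K 0<Q+1) 0<ε)
    in N , λ n N≤n →
      let ((s≤M , w≤1) , Kw≤ε) = h n N≤n
          w = S.width Q n
          0≤w = ℚ.<⇒≤ (S.0<width {Q} n (S.0≤⊔ q))
          w≡ = S.width≡ Q n
          s≤ = ℚ.≤-trans (S.≤-abs (s n)) s≤M
      in begin
        q  ≡⟨ Q≡q ⟨
        Q  ≤⟨ ℚ.<⇒≤ (S.<hi² {Q} n (S.0≤⊔ q)) ⟩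
        (s n ℚ.+ w) ℚ.* (s n ℚ.+ w)  ≡⟨ solve 2 (λ s w → (s :+ w) :* (s :+ w) := s :* s :+ (s :+ s :+ w) :* w) refl (s n) w ⟩
        s n ℚ.* s n ℚ.+ (s n ℚ.+ s n ℚ.+ w) ℚ.* w  ≤⟨ ℚ.+-monoʳ-≤ (s n ℚ.* s n) (ℚ.*-monoʳ-≤-nonNeg w {{ℚ.nonNegative 0≤w}}
                                                              (ℚ.+-mono-≤ (ℚ.+-mono-≤ s≤ s≤) (ℚ.≤-trans (ℚ.≤-reflexive w≡) w≤1))) ⟩
        s n ℚ.* s n ℚ.+ K ℚ.* w  ≡⟨ cong (λ t → s n ℚ.* s n ℚ.+ t) (trans (cong (K ℚ.*_) w≡) (sym (ℚ.*-assoc K (Q ℚ.+ 1ℚ) (S.½^ n)))) ⟩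
        s n ℚ.* s n ℚ.+ K ℚ.* (Q ℚ.+ 1ℚ) ℚ.* S.½^ n  ≤⟨ ℚ.+-monoʳ-≤ (s n ℚ.* s n) Kw≤ε ⟩
        s n ℚ.* s n ℚ.+ ε  ∎

0≤√ : ∀ x → 0ℝ ≤ √ x
0≤√ x = ≤-pointwise 0ℝ (√ x) (λ n → S.0≤lo {seq x n ℚ.⊔ 0ℚ} n (S.0≤⊔ (seq x n)))

-- Assembly over the Cauchy reals

module Γ = Golden ℝ-field √5 (√*√≈ (5 ∕ 1) (ℚ.nonNegative⁻¹ (5 ∕ 1))) (0≤√ (fromℕ 5))
module C = Zeckendorf ℝ-field φ Γ.φ²≈φ+1 Γ.1≤φ Γ.φ<2
module D = Dominance ℝ-field

-- The second factor in the definition of `_÷_⟨_⟩`, so that x ÷ y ⟨ p ⟩ is definitionally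
-- `x * recip y p`.
recip : (y : ℝ) → 0ℝ < y → ℝ
recip y (δ , 0<δ , _) = mkℝ (λ n → S.recip⊔ δ 0<δ (seq y n)) (S.recip-cauchy δ 0<δ {seq y} (cauchy y))

*-recip : ∀ y 0<y → y * recip y 0<y ≈ 1ℝ
*-recip y (δ , 0<δ , N , h) ε 0<ε = N , λ n N≤n → begin
    ℚ.∣ seq y n ℚ.* S.recip⊔ δ 0<δ (seq y n) ℚ.- 1ℚ ∣
      ≡⟨ cong (λ t → ℚ.∣ t ℚ.* S.recip⊔ δ 0<δ (seq y n) ℚ.- 1ℚ ∣) (ℚ.p≥q⇒p⊔q≡p (subst (ℚ._≤ seq y n) (ℚ.+-identityˡ δ) (h n N≤n))) ⟨
    ℚ.∣ (seq y n ℚ.⊔ δ) ℚ.* S.recip⊔ δ 0<δ (seq y n) ℚ.- 1ℚ ∣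
      ≡⟨ cong (λ t → ℚ.∣ t ℚ.- 1ℚ ∣) (S.recip⊔-inverse δ 0<δ (seq y n)) ⟩
    0ℚ
      ≤⟨ ℚ.<⇒≤ 0<ε ⟩
    ε ∎
  where open ℚ.≤-Reasoning

^≈ : ∀ x n → x C.^ n ≈ x ^ n
^≈ x zero    = ℝ-≈-refl {1ℝ}
^≈ x (suc n) = ℝ-*-cong {x} {x} {x C.^ n} {x ^ n} (ℝ-≈-refl {x}) (^≈ x n)

^*-recip : ∀ x n 0<x^n → x C.^ n * recip (x ^ n) 0<x^n ≈ 1ℝ
^*-recip x n 0<x^n = ℝ-≈-trans {x C.^ n * i} {x ^ n * i} {1ℝ} (ℝ-*-cong {x C.^ n} {x ^ n} {i} {i} (^≈ x n) (ℝ-≈-refl {i})) (*-recip (x ^ n) 0<x^n)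
  where
  i = recip (x ^ n) 0<x^n

expSum-series : C.expSeries expSum
expSum-series x = ℝ-≈-refl {1ℝ} , λ n →
  let a = C.1/! (suc n) in
  ℝ-+-cong {expSum x n} {expSum x n} {a * x ^ suc n} {a * x C.^ suc n} (ℝ-≈-refl {expSum x n})
    (ℝ-*-cong {a} {a} {x ^ suc n} {x C.^ suc n} (ℝ-≈-refl {a}) (ℝ-≈-sym {x C.^ suc n} {x ^ suc n} (^≈ x (suc n))))

φ-sum≈position : ∀ r → φ-sum 0 r ≈ C.position r
φ-sum≈position = C.position≈ φ-sum (λ k → recip (φ ^ suc k) (0<^ φ 0<φ (suc k)))
  (λ k → ^*-recip φ (suc k) (0<^ φ 0<φ (suc k)))
  (λ k → ℝ-≈-refl {φ-sum k []})
  (λ k d r → ℝ-≈-refl {φ-sum k (d ∷ r)})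

relpos≡ : ∀ n r → rep n ≡ 1F ∷ 0F ∷ r → relpos n ≡ φ-sum 0 r
relpos≡ n r e with rep n | e
... | _ | refl = refl

relpos≈ : ∀ n r → rep n ≡ 1F ∷ 0F ∷ r → relpos n ≈ C.position r
relpos≈ n r e = subst (_≈ C.position r) (sym (relpos≡ n r e)) (φ-sum≈position r)

⌊logF⌋ : ℕ → ℕ
⌊logF⌋ n = length (rep n) ℕ.∸ 1

⌊logF⌋≡ : ∀ n r → rep n ≡ 1F ∷ 0F ∷ r → ⌊logF⌋ n ≡ suc (length r)
⌊logF⌋≡ n r e = cong (λ w → length w ℕ.∸ 1) e

logF≈ : ∀ n r → rep n ≡ 1F ∷ 0F ∷ r → C.IsLog (logF n) r
logF≈ n r e = ℝ-+-cong {fromℕ (⌊logF⌋ n)} {fromℕ (suc (length r))} {relpos n} {C.position r}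
  (subst (λ k → fromℕ (⌊logF⌋ n) ≈ fromℕ k) (⌊logF⌋≡ n r e) (ℝ-≈-refl {fromℕ (⌊logF⌋ n)})) (relpos≈ n r e)

isFloor : ∀ n → 3 ℕ.≤ n → IsFloor (logF n) (⌊logF⌋ n)
isFloor n 3≤n = let (r , e) = rep-10 n 3≤n in
  subst (IsFloor (logF n)) (sym (⌊logF⌋≡ n r e))
    (C.floor-≤ {logF n} {r} (logF≈ n r e) , C.floor-< {logF n} {r} (linked-10 n r e) (logF≈ n r e))

-- `root-bound` compares squared moduli; monotonicity of the square root carries this over to
-- `modulus`.
dominant : IsDominantRoot C.β
dominant = (D.β-root , D.β-root-im) , λ z (re≈0 , im≈0) →
  √-mono (re z * re z + im z * im z) (C.β * C.β + 0ℝ * 0ℝ) (D.norm≤norm-β {re z * re z + im z * im z} (D.root-bound (re z) (im z) re≈0 im≈0))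

B-limit : (λ n → fromℤ (B n) ÷ C.β ^ n ⟨ 0<^ C.β C.0<β n ⟩) ⟶ C.c
B-limit = C.B-converges (λ n → recip (C.β ^ n) (0<^ C.β C.0<β n)) (λ n → ^*-recip C.β n (0<^ C.β C.0<β n))

β^-isPower : IsPower C.β C.β^
β^-isPower = C.ln-β , C.ln-β-converges {expSum} expSum-series , λ x → C.β^-converges {expSum} expSum-series x (x * C.ln-β) (ℝ-≈-refl {x * C.ln-β})

G-continuous : Continuous C.G
G-continuous = C.G-continuous-strict

G-periodic : Periodic 1ℝ C.G
G-periodic x = C.G-shift x (x + 1ℝ) (ℝ-≈-refl {x + 1ℝ})

β^⌊logF⌋≈ : ∀ n r → rep n ≡ 1F ∷ 0F ∷ r → C.β ^ ⌊logF⌋ n ≈ C.β C.^ suc (length r)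
β^⌊logF⌋≈ n r e = subst (λ k → C.β ^ k ≈ C.β C.^ suc (length r)) (sym (⌊logF⌋≡ n r e)) (ℝ-≈-sym {C.β C.^ suc (length r)} {C.β ^ suc (length r)} (^≈ C.β (suc (length r))))

summatory-asymptotics : (λ N → fromℕ (sum (map sF (upTo (suc N)))) - C.c * C.β^ (logF N) * C.G (logF N)) =o (λ N → C.β ^ ⌊logF⌋ N)
summatory-asymptotics = C.littleO logF (λ n → C.β ^ ⌊logF⌋ n) (λ n r e → logF≈ n r e , β^⌊logF⌋≈ n r e)

theorem2 : Σ[ β ∈ ℝ ] Σ[ 0<β ∈ 0ℝ < β ] IsDominantRoot β ×
    Σ[ c ∈ ℝ ] (λ n → fromℤ (B n) ÷ β ^ n ⟨ 0<^ β 0<β n ⟩) ⟶ c ×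
    Σ[ β^ ∈ (ℝ → ℝ) ] IsPower β β^ ×
    Σ[ ⌊logF⌋ ∈ (ℕ → ℕ) ] (∀ N → 3 ℕ.≤ N → IsFloor (logF N) (⌊logF⌋ N)) ×
    Σ[ G ∈ (ℝ → ℝ) ] Continuous G × Periodic 1ℝ G ×
    (λ N → fromℕ (sum (map sF (upTo (suc N)))) - c * β^ (logF N) * G (logF N)) =o (λ N → β ^ ⌊logF⌋ N)
theorem2 = C.β , C.0<β , dominant , C.c , B-limit , C.β^ , β^-isPower , ⌊logF⌋ , isFloor , C.G , G-continuous , G-periodic , summatory-asymptotics
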